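{- Let $G=(V,E)$ be a connected graph and let $C=(V_C,E_C)$ be a cycle in $G$. Let $5\le k\le|V_C|$ with $k$ odd, $d=\frac{k-1}{2}$, and let $v:\mathbb{Z}_k\to V_C$ be injective and true to $C$. Then the half-chorded odd cycle inequality $\sum_{i\in\mathbb{Z}_k}(x_{v_iv_{i+d}}-x_{v_iv_{i+1}})\le k-3$ is facet-defining for $\mathrm{LMC}(G)$.
   Context: Indices of $v$ are taken modulo $k$. Let $m=|V_C|$ and identify $V_C$ with $\mathbb{Z}_m$ so that $E_C=\{\{u,u+1\}:u\in\mathbb{Z}_m\}$. For $a,b\in\mathbb{Z}_m$, $[a,b]=\{a,a+1,\dots,b\}$ (forward along the cycle), $[a,b[\,=[a,b]\setminus\{b\}$, $]a,b]=[a,b]\setminus\{a\}$. The sequence $v$ is true to $C$ if either $v_i\in[v_0,v_{i+1}[$ for all $i=0,\dots,k-2$, or $v_i\in\,]v_{i+1},v_0]$ for all $i=0,\dots,k-2$. A decomposition of $G$ is a partition of $V$ whose blocks induce connected subgraphs of $G$; its lifted multicut is the set of pairs $ab\in\binom{V}{2}$ with $a,b$ in distinct blocks. $\mathrm{LMC}(G)\subseteq\mathbb{R}^{\binom{V}{2}}$ is the convex hull of the characteristic vectors of these lifted multicuts over all decompositions of $G$.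
   Formalization: The polytope LMC(G), its convex combinations and affine independence are taken over the rational numbers instead of the reals; all vertices are 0/1 vectors and the inequality has integer data. -}

module Defs where

open import Data.Nat as ℕ using (ℕ; zero; suc; _+_; _∸_; _%_)
open import Data.Nat.DivMod using (m%n<n)
open import Data.Fin as Fin using (Fin; toℕ; fromℕ<; _<?_; _≟_)
open import Data.Integer using (+_)
open import Data.Rational as ℚ using (ℚ; 0ℚ; 1ℚ; _/_)
open import Data.Product using (Σ; ∃; _×_; _,_)
open import Data.Sum using (_⊎_)
open import Data.Unit using (⊤)
open import Relation.Nullary using (¬_; yes; no)
open import Relation.Binary.PropositionalEquality using (_≡_; _≢_)
open import Relation.Binary.Construct.Closure.ReflexiveTransitive using (Star)

record Graph (n : ℕ) : Set₁ where
  field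
    Adj     : Fin n → Fin n → Set
    symm    : ∀ {a b} → Adj a b → Adj b a
    irrefl  : ∀ {a} → ¬ Adj a a
open Graph public

Connected : ∀ {n} → Graph n → Set
Connected G = ∀ a b → Star (Adj G) a b

addMod : ∀ {m} → Fin m → ℕ → Fin m
addMod {suc m} i j = fromℕ< (m%n<n (toℕ i + j) (suc m))

fdist : ∀ {m} → Fin m → Fin m → ℕ
fdist {suc m} a x = (toℕ x + (suc m ∸ toℕ a)) % suc m

-- x ∈ [a,b]   (forward interval along the cycle)
InCl : ∀ {m} → Fin m → Fin m → Fin m → Set
InCl a b x = fdist a x ℕ.≤ fdist a b

InClOp : ∀ {m} → Fin m → Fin m → Fin m → Set
InClOp a b x = InCl a b x × x ≢ b

InOpCl : ∀ {m} → Fin m → Fin m → Fin m → Set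
InOpCl a b x = InCl a b x × x ≢ a

-- A cycle C in G with |V_C| = m, given by c : ℤ_m → V injective with
-- {c u, c (u+1)} ∈ E for all u  (so E_C = {{u,u+1}}).
IsCycle : ∀ {n} → Graph n → (m : ℕ) → (Fin m → Fin n) → Set
IsCycle G m c =
  (3 ℕ.≤ m) × (∀ i j → c i ≡ c j → i ≡ j) × (∀ i → Adj G (c i) (c (addMod i 1)))

-- v : ℤ_k → V_C = ℤ_m is true to C
-- (for k = 0 the defining conditions are vacuous)
TrueTo : ∀ {m k} → (Fin k → Fin m) → Set
TrueTo {m} {zero} v = ⊤
TrueTo {m} {suc k} v =
    (∀ (i : Fin (suc k)) → suc (toℕ i) ℕ.< suc k → InClOp (v Fin.zero) (v (addMod i 1)) (v i))
  ⊎ (∀ (i : Fin (suc k)) → suc (toℕ i) ℕ.< suc k → InOpCl (v (addMod i 1)) (v Fin.zero) (v i))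

Pair : ℕ → Set
Pair n = Σ (Fin n) (λ a → Σ (Fin n) (λ b → a Fin.< b))

Vect : ℕ → Set
Vect n = Pair n → ℚ

coord : ∀ {n} → Vect n → Fin n → Fin n → ℚ
coord x a b with a <? b
... | yes p = x (a , b , p)
... | no _ with b <? a
...   | yes q = x (b , a , q)
...   | no _  = 0ℚ

sumℚ : ∀ {t} → (Fin t → ℚ) → ℚ
sumℚ {zero}  f = 0ℚ
sumℚ {suc t} f = f Fin.zero ℚ.+ sumℚ (λ j → f (Fin.suc j))

-- Decompositions and lifted multicuts.
-- A decomposition is given by a block labelling f : V → Fin n (at most n
-- blocks); each block {u | f u ≡ f a} must induce a connected subgraph.

IsDecomposition : ∀ {n} → Graph n → (Fin n → Fin n) → Set
IsDecomposition G f =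
  ∀ a b → f a ≡ f b → Star (λ u w → Adj G u w × f u ≡ f a × f w ≡ f a) a b

liftedMulticut : ∀ {n} → (Fin n → Fin n) → Vect n
liftedMulticut f (a , b , _) with f a ≟ f b
... | yes _ = 0ℚ
... | no _  = 1ℚ

IsLiftedMulticutVec : ∀ {n} → Graph n → Vect n → Set
IsLiftedMulticutVec {n} G x = Σ (Fin n → Fin n) (λ f → IsDecomposition G f × (∀ p → x p ≡ liftedMulticut f p))

ConvHull : ∀ {n} → (Vect n → Set) → Vect n → Set
ConvHull {n} S x =
  Σ ℕ λ t → Σ (Fin t → Vect n) λ y → Σ (Fin t → ℚ) λ λs →
    (∀ j → S (y j)) × (∀ j → 0ℚ ℚ.≤ λs j) × (sumℚ λs ≡ 1ℚ) ×
    (∀ p → x p ≡ sumℚ (λ j → λs j ℚ.* y j p))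

LMC : ∀ {n} → Graph n → Vect n → Set
LMC G = ConvHull (IsLiftedMulticutVec G)

AffinelyIndependent : ∀ {n t} → (Fin t → Vect n) → Set
AffinelyIndependent {n} {t} y =
  ∀ (λs : Fin t → ℚ) → sumℚ λs ≡ 0ℚ →
    (∀ p → sumℚ (λ j → λs j ℚ.* y j p) ≡ 0ℚ) → ∀ j → λs j ≡ 0ℚ

HasAffIndep : ∀ {n} → (Vect n → Set) → ℕ → Set
HasAffIndep {n} S r = Σ (Fin r → Vect n) λ y → (∀ j → S (y j)) × AffinelyIndependent y

-- The maximal number of affinely independent points of S is r,
-- i.e. dim aff(S) = r - 1  (r = 0 iff S = ∅).
AffRank : ∀ {n} → (Vect n → Set) → ℕ → Set
AffRank S r = HasAffIndep S r × ¬ HasAffIndep S (suc r)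

FacetDefining : ∀ {n} → (Vect n → Set) → (Vect n → ℚ) → ℚ → Set
FacetDefining P α β =
  (∀ x → P x → α x ℚ.≤ β) ×
  Σ ℕ λ r → AffRank P (suc r) × AffRank (λ x → P x × α x ≡ β) r

halfChordedLHS : ∀ {n m k} → (Fin m → Fin n) → (Fin k → Fin m) → ℕ → Vect n → ℚ
halfChordedLHS c v d x =
  sumℚ (λ i → coord x (c (v i)) (c (v (addMod i d))) ℚ.- coord x (c (v i)) (c (v (addMod i 1))))

{-# OPTIONS --safe #-}
module Submission where

-- Let a labelling of ℤ_k have D changes between i and i + 1 and E agreements between i and i + d.
-- The left-hand side at the corresponding lifted multicut is k − (D + E), and D + E ≥ 3: if j is a
-- change, the two windows of length d behind it cover the remaining positions, and each contains a
-- change or joins two agreeing positions.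
--
-- LMC(G) has at most 1 + (n choose 2) affinely independent points. To find n choose 2 of them on the
-- face, extend the all-singletons point greedily: as long as the points chosen are too few, some
-- nonzero affine functional vanishes on all of them, so it suffices to show that a functional
-- vanishing at the singletons and on all tight decompositions is zero. Written as a weight γ on the
-- pairs inside blocks, moving one vertex between two blocks of tight decompositions gives a linear
-- relation for the coefficients at that vertex. The partitions of the cycle into three arcs
-- containing at most d of the v_i each, or into arcs containing d and d + 1 of them, kill all
-- coefficients on the cycle except γ(v_i, v_{i+1}) = ρ and γ(v_i, v_{i+d}) = −ρ. The other vertices
-- are added one at a time, each adjacent to one already present, and joining or not joining the new
-- vertex to the block of its neighbour kills its coefficients. Finally a tight decomposition has
-- weight ρ (k − 3), hence ρ = 0.

-- The singletons play a double role. There the left-hand side is 0, which differs from k - 3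
-- because k ≥ 5, so this point extends every affinely independent family of the face to a larger
-- one of the polytope. This yields the dimension of the polytope and also the upper bound on the
-- dimension of the face.
--
-- The functional that survives the relations is, up to the factor ρ, the inequality itself, so no
-- further relation between tight decompositions could kill ρ; only the comparison with the
-- singletons can. For k = 3 this would fail, since the two sums of the inequality coincide.
--
-- Positions on the cycle are unrolled to times in ℕ, a lap lasting m. An arc is then an interval of
-- times even if it passes the base point, and the two ways of being true to C differ only in the
-- direction of the walk.
--
-- Weights are summed over ordered pairs. They split into rows, one for each vertex, and a move of
-- one vertex affects only its row and its column.

open import Defs
open import Data.Nat as ℕ using (ℕ; zero; suc; _+_; _*_; _∸_; _≤_; _<_; z≤n; s≤s)
open import Data.Nat.Properties
open import Data.Nat.DivMod hiding (_/_)
open import Data.Nat.Divisibility using (n∣m*n)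
open import Data.Nat.Tactic.RingSolver using (solve-∀)
import Data.Nat.Coprimality as Coprime
open import Data.Fin as Fin using (Fin; zero; suc; toℕ; fromℕ<; punchIn; punchOut)
import Data.Fin.Properties as Finₚ
import Data.Integer as ℤ
import Data.Integer.Properties as ℤₚ
open import Data.Rational as ℚ using (ℚ; 0ℚ; 1ℚ; mkℚ)
import Data.Rational.Properties as ℚₚ
open import Data.Rational.Solver using (module +-*-Solver)
open import Data.Product using (Σ; ∃; ∃₂; _×_; _,_; proj₁; proj₂)
open import Data.Sum using (_⊎_; inj₁; inj₂; [_,_]′)
open import Data.Empty using (⊥-elim)
open import Function using (_∘_; id)
open import Relation.Nullary using (¬_; Dec; yes; no)
open import Relation.Nullary.Decidable using (¬?; _⊎-dec_)
open import Relation.Binary.Definitions using (tri<; tri≈; tri>)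
open import Relation.Binary.Construct.Closure.ReflexiveTransitive using (Star; ε; _◅_; reverse; gmap)
open import Relation.Binary.PropositionalEquality
  using (_≡_; _≢_; refl; sym; trans; cong; cong₂; subst; subst₂; module ≡-Reasoning)
open +-*-Solver using (solve; _:+_; _:*_; _:-_; :-_; _:=_; con)

-- Finite sums over ℚ

sum-cong : ∀ {t} {f g : Fin t → ℚ} → (∀ i → f i ≡ g i) → sumℚ f ≡ sumℚ g
sum-cong {zero}  e = refl
sum-cong {suc t} e = cong₂ ℚ._+_ (e zero) (sum-cong (λ i → e (suc i)))

sum-zero : ∀ {t} {f : Fin t → ℚ} → (∀ i → f i ≡ 0ℚ) → sumℚ f ≡ 0ℚ
sum-zero {zero}  e = refl
sum-zero {suc t} e = cong₂ ℚ._+_ (e zero) (sum-zero (λ i → e (suc i)))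

sum-+ : ∀ {t} (f g : Fin t → ℚ) → sumℚ (λ i → f i ℚ.+ g i) ≡ sumℚ f ℚ.+ sumℚ g
sum-+ {zero}  f g = refl
sum-+ {suc t} f g = trans (cong (f zero ℚ.+ g zero ℚ.+_) (sum-+ (λ i → f (suc i)) (λ i → g (suc i))))
  (solve 4 (λ a b c d → (a :+ b) :+ (c :+ d) := (a :+ c) :+ (b :+ d)) refl
    (f zero) (g zero) (sumℚ (λ i → f (suc i))) (sumℚ (λ i → g (suc i))))

sum-*ˡ : ∀ {t} c (f : Fin t → ℚ) → c ℚ.* sumℚ f ≡ sumℚ (λ i → c ℚ.* f i)
sum-*ˡ {zero}  c f = ℚₚ.*-zeroʳ c
sum-*ˡ {suc t} c f = trans (ℚₚ.*-distribˡ-+ c (f zero) (sumℚ (λ i → f (suc i))))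
  (cong (c ℚ.* f zero ℚ.+_) (sum-*ˡ c (λ i → f (suc i))))

sum-*ʳ : ∀ {t} c (f : Fin t → ℚ) → sumℚ f ℚ.* c ≡ sumℚ (λ i → f i ℚ.* c)
sum-*ʳ c f = trans (ℚₚ.*-comm (sumℚ f) c) (trans (sum-*ˡ c f) (sum-cong (λ i → ℚₚ.*-comm c (f i))))

sum-neg : ∀ {t} (f : Fin t → ℚ) → ℚ.- sumℚ f ≡ sumℚ (λ i → ℚ.- f i)
sum-neg {zero}  f = refl
sum-neg {suc t} f = trans (ℚₚ.neg-distrib-+ (f zero) (sumℚ (λ i → f (suc i))))
  (cong (ℚ.- f zero ℚ.+_) (sum-neg (λ i → f (suc i))))

sum-- : ∀ {t} (f g : Fin t → ℚ) → sumℚ (λ i → f i ℚ.- g i) ≡ sumℚ f ℚ.- sumℚ g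
sum-- f g = trans (sum-+ f (λ i → ℚ.- g i)) (cong (sumℚ f ℚ.+_) (sym (sum-neg g)))

sum-swap : ∀ {t u} (f : Fin t → Fin u → ℚ) →
  sumℚ (λ i → sumℚ (λ j → f i j)) ≡ sumℚ (λ j → sumℚ (λ i → f i j))
sum-swap {zero}  {u} f = sym (sum-zero {u} {λ j → 0ℚ} (λ j → refl))
sum-swap {suc t} f = trans (cong (sumℚ (f zero) ℚ.+_) (sum-swap (λ i → f (suc i))))
  (sym (sum-+ (f zero) (λ j → sumℚ (λ i → f (suc i) j))))

sum-mono : ∀ {t} {f g : Fin t → ℚ} → (∀ i → f i ℚ.≤ g i) → sumℚ f ℚ.≤ sumℚ g
sum-mono {zero}  e = ℚₚ.≤-refl
sum-mono {suc t} e = ℚₚ.+-mono-≤ (e zero) (sum-mono (λ i → e (suc i)))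

-- Iverson brackets and the Kronecker delta.

⟦_⟧ : ∀ {P : Set} → Dec P → ℚ
⟦ yes _ ⟧ = 1ℚ
⟦ no  _ ⟧ = 0ℚ

⟦⟧-yes : ∀ {P : Set} (d : Dec P) → P → ⟦ d ⟧ ≡ 1ℚ
⟦⟧-yes (yes _) p = refl
⟦⟧-yes (no ¬p) p = ⊥-elim (¬p p)

⟦⟧-no : ∀ {P : Set} (d : Dec P) → ¬ P → ⟦ d ⟧ ≡ 0ℚ
⟦⟧-no (yes p) ¬p = ⊥-elim (¬p p)
⟦⟧-no (no _)  ¬p = refl

⟦⟧-cong : ∀ {P Q : Set} (d : Dec P) (e : Dec Q) → (P → Q) → (Q → P) → ⟦ d ⟧ ≡ ⟦ e ⟧
⟦⟧-cong (yes p) e f g = sym (⟦⟧-yes e (f p))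
⟦⟧-cong (no ¬p) e f g = sym (⟦⟧-no e (λ q → ¬p (g q)))

δ : ∀ {n} → Fin n → Fin n → ℚ
δ a b = ⟦ a Finₚ.≟ b ⟧

δ-refl : ∀ {n} (a : Fin n) → δ a a ≡ 1ℚ
δ-refl a = ⟦⟧-yes (a Finₚ.≟ a) refl

δ-≢ : ∀ {n} {a b : Fin n} → a ≢ b → δ a b ≡ 0ℚ
δ-≢ {a = a} {b} = ⟦⟧-no (a Finₚ.≟ b)

sum-δ : ∀ {t} (f : Fin t → ℚ) a → sumℚ (λ i → f i ℚ.* δ a i) ≡ f a
sum-δ {suc t} f zero = trans
  (cong₂ ℚ._+_ (ℚₚ.*-identityʳ (f zero)) (sum-zero (λ i → ℚₚ.*-zeroʳ (f (suc i)))))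
  (ℚₚ.+-identityʳ _)
sum-δ {suc t} f (suc a) = trans
  (cong₂ ℚ._+_ (ℚₚ.*-zeroʳ (f zero))
    (trans (sum-cong (λ i → cong (f (suc i) ℚ.*_)
      (⟦⟧-cong (suc a Finₚ.≟ suc i) (a Finₚ.≟ i) Finₚ.suc-injective (cong suc))))
      (sum-δ (λ i → f (suc i)) a)))
  (ℚₚ.+-identityˡ _)

*-≢0 : ∀ {p q} → p ≢ 0ℚ → q ≢ 0ℚ → p ℚ.* q ≢ 0ℚ
*-≢0 {p} {q} p≢0 q≢0 e = q≢0 (begin
  q                        ≡⟨ sym (ℚₚ.*-identityˡ q) ⟩
  1ℚ ℚ.* q                 ≡⟨ cong (ℚ._* q) (sym (ℚₚ.*-inverseˡ p)) ⟩
  (ℚ.1/ p) ℚ.* p ℚ.* q     ≡⟨ ℚₚ.*-assoc (ℚ.1/ p) p q ⟩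
  (ℚ.1/ p) ℚ.* (p ℚ.* q)   ≡⟨ cong ((ℚ.1/ p) ℚ.*_) e ⟩
  (ℚ.1/ p) ℚ.* 0ℚ          ≡⟨ ℚₚ.*-zeroʳ (ℚ.1/ p) ⟩
  0ℚ ∎)
  where
  open ≡-Reasoning
  instance
    p-nonZero : ℚ.NonZero p
    p-nonZero = ℚ.≢-nonZero p≢0

*-cancel-0 : ∀ {p q} → p ≢ 0ℚ → p ℚ.* q ≡ 0ℚ → q ≡ 0ℚ
*-cancel-0 {p} {q} p≢0 e with q ℚₚ.≟ 0ℚ
... | yes q≡0 = q≡0
... | no  q≢0 = ⊥-elim (*-≢0 p≢0 q≢0 e)

-- Removes the factor 2 that sums over ordered pairs bring in.
double-injective : ∀ {p q} → p ℚ.+ p ≡ q ℚ.+ q → p ≡ q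
double-injective {p} {q} e = begin
  p                       ≡⟨ solve 2 (λ a b → a := (a :- b) :+ b) refl p q ⟩
  (p ℚ.- q) ℚ.+ q         ≡⟨ cong (ℚ._+ q) (*-cancel-0 {1ℚ ℚ.+ 1ℚ} {p ℚ.- q} (λ ()) dbl) ⟩
  0ℚ ℚ.+ q                ≡⟨ ℚₚ.+-identityˡ q ⟩
  q                       ∎
  where
  open ≡-Reasoning
  dbl : (1ℚ ℚ.+ 1ℚ) ℚ.* (p ℚ.- q) ≡ 0ℚ
  dbl = begin
    (1ℚ ℚ.+ 1ℚ) ℚ.* (p ℚ.- q)   ≡⟨ solve 2 (λ a b → (con 1ℚ :+ con 1ℚ) :* (a :- b) := (a :+ a) :- (b :+ b)) refl p q ⟩
    (p ℚ.+ p) ℚ.- (q ℚ.+ q)     ≡⟨ cong (ℚ._- (q ℚ.+ q)) e ⟩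
    (q ℚ.+ q) ℚ.- (q ℚ.+ q)     ≡⟨ ℚₚ.+-inverseʳ (q ℚ.+ q) ⟩
    0ℚ                          ∎

-- Linear algebra over ℚ

_∙_ : ∀ {M} → (Fin M → ℚ) → (Fin M → ℚ) → ℚ
x ∙ y = sumℚ (λ i → x i ℚ.* y i)

NonZeroVec : ∀ {M} → (Fin M → ℚ) → Set
NonZeroVec x = ∃ λ i → x i ≢ 0ℚ

-- Division-free elimination of the first unknown.
underdetermined : ∀ {M} (A : Fin M → Fin (suc M) → ℚ) →
  Σ (Fin (suc M) → ℚ) λ x → NonZeroVec x × (∀ i → A i ∙ x ≡ 0ℚ)
underdetermined {zero} A = (λ _ → 1ℚ) , (zero , λ ()) , λ ()
underdetermined {suc M} A with Finₚ.any? (λ i → ¬? (A i zero ℚₚ.≟ 0ℚ))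
... | no none = e₀ , (zero , λ ()) , λ i → trans
  (cong₂ ℚ._+_ (trans (ℚₚ.*-identityʳ (A i zero)) (col i)) (sum-zero (λ j → ℚₚ.*-zeroʳ (A i (suc j)))))
  refl
  where
  e₀ : Fin (suc (suc M)) → ℚ
  e₀ zero    = 1ℚ
  e₀ (suc _) = 0ℚ
  col : ∀ i → A i zero ≡ 0ℚ
  col i with A i zero ℚₚ.≟ 0ℚ
  ... | yes e = e
  ... | no ne = ⊥-elim (none (i , ne))
... | yes (r , pivot) = x , (suc (proj₁ (proj₁ (proj₂ sol))) , *-≢0 pivot (proj₂ (proj₁ (proj₂ sol)))) , solves
  where
  open ≡-Reasoning
  π : ℚ
  π = A r zero
  B : Fin M → Fin (suc M) → ℚ
  B i j = π ℚ.* A (punchIn r i) (suc j) ℚ.- A (punchIn r i) zero ℚ.* A r (suc j)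
  sol = underdetermined B
  y : Fin (suc M) → ℚ
  y = proj₁ sol
  tail : Fin (suc M) → ℚ
  tail i = sumℚ (λ j → A i (suc j) ℚ.* y j)
  -- Once the other unknowns are `π * y`, equation `r` reads `π * x₀ + π * tail r = 0`, which
  -- `x₀ = - tail r` solves.
  x : Fin (suc (suc M)) → ℚ
  x zero    = ℚ.- tail r
  x (suc j) = π ℚ.* y j
  row : ∀ i → A i ∙ x ≡ π ℚ.* tail i ℚ.- A i zero ℚ.* tail r
  row i = begin
    A i zero ℚ.* (ℚ.- tail r) ℚ.+ sumℚ (λ j → A i (suc j) ℚ.* (π ℚ.* y j))
      ≡⟨ cong (A i zero ℚ.* (ℚ.- tail r) ℚ.+_) (trans
           (sum-cong (λ j → solve 3 (λ a b c → a :* (b :* c) := b :* (a :* c)) refl (A i (suc j)) π (y j)))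
           (sym (sum-*ˡ π (λ j → A i (suc j) ℚ.* y j)))) ⟩
    A i zero ℚ.* (ℚ.- tail r) ℚ.+ π ℚ.* tail i
      ≡⟨ solve 4 (λ a t p u → a :* (:- t) :+ p :* u := p :* u :- a :* t) refl (A i zero) (tail r) π (tail i) ⟩
    π ℚ.* tail i ℚ.- A i zero ℚ.* tail r ∎
  other : ∀ i → A (punchIn r i) ∙ x ≡ 0ℚ
  other i = begin
    A i′ ∙ x
      ≡⟨ row i′ ⟩
    π ℚ.* tail i′ ℚ.- A i′ zero ℚ.* tail r
      ≡⟨ cong₂ ℚ._-_ (sum-*ˡ π (λ j → A i′ (suc j) ℚ.* y j)) (sum-*ˡ (A i′ zero) (λ j → A r (suc j) ℚ.* y j)) ⟩
    sumℚ (λ j → π ℚ.* (A i′ (suc j) ℚ.* y j)) ℚ.- sumℚ (λ j → A i′ zero ℚ.* (A r (suc j) ℚ.* y j))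
      ≡⟨ sym (sum-- (λ j → π ℚ.* (A i′ (suc j) ℚ.* y j)) (λ j → A i′ zero ℚ.* (A r (suc j) ℚ.* y j))) ⟩
    sumℚ (λ j → π ℚ.* (A i′ (suc j) ℚ.* y j) ℚ.- A i′ zero ℚ.* (A r (suc j) ℚ.* y j))
      ≡⟨ sum-cong (λ j → solve 5 (λ p a y b c → p :* (a :* y) :- b :* (c :* y) := (p :* a :- b :* c) :* y)
           refl π (A i′ (suc j)) (y j) (A i′ zero) (A r (suc j))) ⟩
    B i ∙ y
      ≡⟨ proj₂ (proj₂ sol) i ⟩
    0ℚ ∎
    where i′ = punchIn r i
  solves : ∀ i → A i ∙ x ≡ 0ℚ
  solves i with r Finₚ.≟ i
  ... | yes refl = trans (row r) (ℚₚ.+-inverseʳ (π ℚ.* tail r))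
  ... | no r≢i   = subst (λ l → A l ∙ x ≡ 0ℚ) (Finₚ.punchIn-punchOut r≢i) (other (punchOut r≢i))

-- Adds trivial equations, which reduces any underdetermined system to one with exactly one unknown
-- more than equations.
zero-padded : ∀ {t K M} → (Fin t → Fin K → ℚ) → Fin M → Fin K → ℚ
zero-padded {t} A i with toℕ i <? t
... | yes p = A (Fin.fromℕ< p)
... | no  _ = λ _ → 0ℚ

zero-padded-inject≤ : ∀ {t K M} (A : Fin t → Fin K → ℚ) (t≤M : t ℕ.≤ M) i →
  zero-padded A (Fin.inject≤ i t≤M) ≡ A i
zero-padded-inject≤ {t} A t≤M i with toℕ (Fin.inject≤ i t≤M) <? t
... | yes p = cong A (Finₚ.toℕ-injective (trans (Finₚ.toℕ-fromℕ< p) (Finₚ.toℕ-inject≤ i t≤M)))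
... | no ¬p = ⊥-elim (¬p (subst (ℕ._< t) (sym (Finₚ.toℕ-inject≤ i t≤M)) (Finₚ.toℕ<n i)))

underdetermined-< : ∀ {t M} → t ℕ.< M → (A : Fin t → Fin M → ℚ) →
  Σ (Fin M → ℚ) λ x → NonZeroVec x × (∀ i → A i ∙ x ≡ 0ℚ)
underdetermined-< {t} {suc M} (ℕ.s≤s t≤M) A with underdetermined {M} (zero-padded A)
... | x , nz , sol = x , nz , λ i →
  trans (cong (_∙ x) (sym (zero-padded-inject≤ A t≤M i))) (sol (Fin.inject≤ i t≤M))

LinIndep : ∀ {t M} → (Fin t → Fin M → ℚ) → Set
LinIndep {t} {M} y = ∀ (λs : Fin t → ℚ) → (∀ i → sumℚ (λ j → λs j ℚ.* y j i) ≡ 0ℚ) → ∀ j → λs j ≡ 0ℚ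

∙-sum : ∀ {t M} (γ : Fin M → ℚ) (λs : Fin t → ℚ) (y : Fin t → Fin M → ℚ) →
  sumℚ (λ i → γ i ℚ.* sumℚ (λ j → λs j ℚ.* y j i)) ≡ sumℚ (λ j → λs j ℚ.* (y j ∙ γ))
∙-sum γ λs y = begin
  sumℚ (λ i → γ i ℚ.* sumℚ (λ j → λs j ℚ.* y j i))
    ≡⟨ sum-cong (λ i → sum-*ˡ (γ i) (λ j → λs j ℚ.* y j i)) ⟩
  sumℚ (λ i → sumℚ (λ j → γ i ℚ.* (λs j ℚ.* y j i)))
    ≡⟨ sum-swap (λ i j → γ i ℚ.* (λs j ℚ.* y j i)) ⟩
  sumℚ (λ j → sumℚ (λ i → γ i ℚ.* (λs j ℚ.* y j i)))
    ≡⟨ sum-cong (λ j → trans (sum-cong (λ i →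
         solve 3 (λ a b c → a :* (b :* c) := b :* (c :* a)) refl (γ i) (λs j) (y j i))) (sym (sum-*ˡ (λs j) (λ i
             → y j i ℚ.* γ i)))) ⟩
  sumℚ (λ j → λs j ℚ.* (y j ∙ γ)) ∎
  where open ≡-Reasoning

cons : ∀ {t} {A : Set} → A → (Fin t → A) → Fin (suc t) → A
cons x y zero    = x
cons x y (suc j) = y j

-- Applying `γ` to a relation kills every term but that of `x`. So the coefficient of `x` is 0, and
-- what remains is a relation among the `y j`.
LinIndep-cons : ∀ {t M} (γ : Fin M → ℚ) {y : Fin t → Fin M → ℚ} {x : Fin M → ℚ} →
  (∀ j → y j ∙ γ ≡ 0ℚ) → x ∙ γ ≢ 0ℚ → LinIndep y → LinIndep (cons x y)
LinIndep-cons γ {y} {x} y⊥γ x·γ≢0 ind λs rel = λ { zero → λ₀≡0 ; (suc j) → ind (λ j → λs (suc j)) rel′ j }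
  where
  open ≡-Reasoning
  λ₀≡0 : λs zero ≡ 0ℚ
  λ₀≡0 = *-cancel-0 x·γ≢0 (begin
    (x ∙ γ) ℚ.* λs zero
      ≡⟨ ℚₚ.*-comm (x ∙ γ) (λs zero) ⟩
    λs zero ℚ.* (x ∙ γ)
      ≡⟨ sym (ℚₚ.+-identityʳ _) ⟩
    λs zero ℚ.* (x ∙ γ) ℚ.+ 0ℚ
      ≡⟨ cong (λs zero ℚ.* (x ∙ γ) ℚ.+_) (sym (sum-zero (λ j → trans (cong (λs (suc j) ℚ.*_) (y⊥γ j)) (ℚₚ.*-zeroʳ (λs
          (suc j)))))) ⟩
    sumℚ (λ j → λs j ℚ.* (cons x y j ∙ γ))
      ≡⟨ sym (∙-sum γ λs (cons x y)) ⟩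
    sumℚ (λ i → γ i ℚ.* sumℚ (λ j → λs j ℚ.* cons x y j i))
      ≡⟨ sum-zero (λ i → trans (cong (γ i ℚ.*_) (rel i)) (ℚₚ.*-zeroʳ (γ i))) ⟩
    0ℚ ∎)
  rel′ : ∀ i → sumℚ (λ j → λs (suc j) ℚ.* y j i) ≡ 0ℚ
  rel′ i = begin
    sumℚ (λ j → λs (suc j) ℚ.* y j i)
      ≡⟨ sym (ℚₚ.+-identityˡ _) ⟩
    0ℚ ℚ.+ sumℚ (λ j → λs (suc j) ℚ.* y j i)
      ≡⟨ cong (ℚ._+ _) (sym (trans (cong (ℚ._* x i) λ₀≡0) (ℚₚ.*-zeroˡ (x i)))) ⟩
    λs zero ℚ.* x i ℚ.+ sumℚ (λ j → λs (suc j) ℚ.* y j i)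
      ≡⟨ rel i ⟩
    0ℚ ∎

-- Greedy extension of w: a functional vanishing on the vectors chosen so far
-- does not vanish on some s ∈ S, and that s is independent of them.
extend-indep : ∀ {M} (S : (Fin M → ℚ) → Set) (w : Fin M → ℚ) → NonZeroVec w →
  (∀ γ → NonZeroVec γ → w ∙ γ ≡ 0ℚ → Σ (Fin M → ℚ) λ s → S s × s ∙ γ ≢ 0ℚ) →
  ∀ t → t ℕ.< M → Σ (Fin t → Fin M → ℚ) λ y → (∀ j → S (y j)) × LinIndep (cons w y)
extend-indep S w (i , wᵢ≢0) sep zero _ = (λ ()) , (λ ()) , ind
  where
  ind : LinIndep (cons w (λ ()))
  ind λs rel zero = *-cancel-0 wᵢ≢0 (trans (ℚₚ.*-comm _ (λs zero)) (trans (sym (ℚₚ.+-identityʳ _)) (rel i)))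
extend-indep {M} S w nz sep (suc t) t<M with extend-indep S w nz sep t (<-trans (n<1+n t) t<M)
... | y , y∈S , ind with underdetermined-< t<M (cons w y)
... | γ , γ≢0 , ⊥γ with sep γ γ≢0 (⊥γ zero)
... | s , s∈S , s·γ≢0 = cons s y , (λ { zero → s∈S ; (suc j) → y∈S j }) , swapped
  where
  step : LinIndep (cons s (cons w y))
  step = LinIndep-cons γ {cons w y} {s} ⊥γ s·γ≢0 ind
  -- `w` returns to the front, so that the induction continues in the same form.
  swapped : LinIndep (cons w (cons s y))
  swapped λs rel = λ { zero → μ≡0 (suc zero) ; (suc zero) → μ≡0 zero ; (suc (suc j)) → μ≡0 (suc (suc j)) }
    where
    μ : Fin (suc (suc t)) → ℚ
    μ = cons (λs (suc zero)) (cons (λs zero) (λ j → λs (suc (suc j))))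
    μ≡0 : ∀ j → μ j ≡ 0ℚ
    μ≡0 = step μ (λ i → trans
      (solve 3 (λ a b c → a :+ (b :+ c) := b :+ (a :+ c)) refl (λs (suc zero) ℚ.* s i) (λs zero ℚ.* w i) _) (rel i))

-- Enumeration of the coordinates

-- The binomial coefficient n choose 2; the recursion lists the pairs containing `zero` first.
numPairs : ℕ → ℕ
numPairs zero    = 0
numPairs (suc n) = n ℕ.+ numPairs n

sucPair : ∀ {n} → Pair n → Pair (suc n)
sucPair (a , b , p) = suc a , suc b , ℕ.s≤s p

pairAt : ∀ {n} → Fin (numPairs n) → Pair n
pairAt {suc n} i = [ (λ b → zero , suc b , ℕ.s≤s ℕ.z≤n) , (λ j → sucPair (pairAt j)) ]′ (Fin.splitAt n i)

indexOf : ∀ {n} → Pair n → Fin (numPairs n)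
indexOf {suc n} (zero  , suc b , _)       = b Fin.↑ˡ numPairs n
indexOf {suc n} (suc a , suc b , ℕ.s≤s p) = n Fin.↑ʳ indexOf (a , b , p)

pairAt-indexOf : ∀ {n} (p : Pair n) → pairAt (indexOf p) ≡ p
pairAt-indexOf {suc n} (zero , suc b , ℕ.s≤s ℕ.z≤n) rewrite Finₚ.splitAt-↑ˡ n b (numPairs n) = refl
pairAt-indexOf {suc n} (suc a , suc b , ℕ.s≤s p)
  rewrite Finₚ.splitAt-↑ʳ n (numPairs n) (indexOf (a , b , p)) = cong sucPair (pairAt-indexOf (a , b , p))

indexOf-pairAt : ∀ {n} (i : Fin (numPairs n)) → indexOf {n} (pairAt i) ≡ i
indexOf-pairAt {suc n} i with Fin.splitAt n i | Finₚ.join-splitAt n (numPairs n) i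
... | inj₁ b | e = e
... | inj₂ j | e = trans (cong (n Fin.↑ʳ_) (indexOf-pairAt {n} j)) e

coord-pair : ∀ {n} (x : Vect n) a b (p : a Fin.< b) → coord x a b ≡ x (a , b , p)
coord-pair x a b p with a Fin.<? b
... | yes q = cong (λ r → x (a , b , r)) (<-irrelevant q p)
... | no ¬p = ⊥-elim (¬p p)

coord-pair′ : ∀ {n} (x : Vect n) a b (p : a Fin.< b) → coord x b a ≡ x (a , b , p)
coord-pair′ x a b p with b Fin.<? a
... | yes q = ⊥-elim (<-asym p q)
... | no _ with a Fin.<? b
...   | yes q = cong (λ r → x (a , b , r)) (<-irrelevant q p)
...   | no ¬p = ⊥-elim (¬p p)

coord-sym : ∀ {n} (x : Vect n) a b → coord x a b ≡ coord x b a
coord-sym x a b with Finₚ.<-cmp a b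
... | tri< p _ _    = trans (coord-pair x a b p) (sym (coord-pair′ x a b p))
... | tri≈ _ refl _ = refl
... | tri> _ _ p    = trans (coord-pair′ x b a p) (sym (coord-pair x b a p))

coord-diag : ∀ {n} (x : Vect n) a → coord x a a ≡ 0ℚ
coord-diag x a with a Fin.<? a
... | yes p = ⊥-elim (<-irrefl refl p)
... | no _ with a Fin.<? a
...   | yes p = ⊥-elim (<-irrefl refl p)
...   | no  _ = refl

coord-cong : ∀ {n} {x y : Vect n} → (∀ p → x p ≡ y p) → ∀ a b → coord x a b ≡ coord y a b
coord-cong e a b with a Fin.<? b
... | yes p = e (a , b , p)
... | no _ with b Fin.<? a
...   | yes q = e (b , a , q)
...   | no  _ = refl

coord-combination : ∀ {n t} (λs : Fin t → ℚ) (y : Fin t → Vect n) a b →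
  coord (λ p → sumℚ (λ j → λs j ℚ.* y j p)) a b ≡ sumℚ (λ j → λs j ℚ.* coord (y j) a b)
coord-combination λs y a b with a Fin.<? b
... | yes p = refl
... | no _ with b Fin.<? a
...   | yes q = refl
...   | no  _ = sym (sum-zero (λ j → ℚₚ.*-zeroʳ (λs j)))

sum-↑ : ∀ t u (f : Fin (t ℕ.+ u) → ℚ) →
  sumℚ f ≡ sumℚ (λ i → f (i Fin.↑ˡ u)) ℚ.+ sumℚ (λ j → f (t Fin.↑ʳ j))
sum-↑ zero    u f = sym (ℚₚ.+-identityˡ (sumℚ f))
sum-↑ (suc t) u f = trans (cong (f zero ℚ.+_) (sum-↑ t u (λ i → f (suc i))))
  (sym (ℚₚ.+-assoc (f zero) (sumℚ (λ i → f (suc i Fin.↑ˡ u))) (sumℚ (λ j → f (suc t Fin.↑ʳ j)))))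

onPair : ∀ {n} {A : Set} → (Fin n → Fin n → A) → Pair n → A
onPair K (a , b , _) = K a b

-- Allows a functional on coordinates to be studied as a symmetric matrix, whose entries can be
-- summed row by row at the price of a factor 2.
sum-square : ∀ {n} (K : Fin n → Fin n → ℚ) → (∀ a b → K a b ≡ K b a) → (∀ a → K a a ≡ 0ℚ) →
  sumℚ (λ a → sumℚ (λ b → K a b)) ≡
  sumℚ (λ i → onPair K (pairAt {n} i)) ℚ.+ sumℚ (λ i → onPair K (pairAt {n} i))
sum-square {zero}  K K-sym K-diag = refl
sum-square {suc n} K K-sym K-diag = begin
  K zero zero ℚ.+ R ℚ.+ sumℚ (λ a → K (suc a) zero ℚ.+ sumℚ (λ b → K (suc a) (suc b)))
    ≡⟨ cong₂ (λ x y → x ℚ.+ R ℚ.+ y) (K-diag zero) (trans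
         (sum-+ (λ a → K (suc a) zero) (λ a → sumℚ (λ b → K (suc a) (suc b))))
         (cong₂ ℚ._+_ (sum-cong (λ a → K-sym (suc a) zero))
           (sum-square (λ a b → K (suc a) (suc b)) (λ a b → K-sym (suc a) (suc b)) (λ a → K-diag (suc a))))) ⟩
  0ℚ ℚ.+ R ℚ.+ (R ℚ.+ (T ℚ.+ T))
    ≡⟨ solve 2 (λ r t → con 0ℚ :+ r :+ (r :+ (t :+ t)) := (r :+ t) :+ (r :+ t)) refl R T ⟩
  (R ℚ.+ T) ℚ.+ (R ℚ.+ T)
    ≡⟨ sym (cong₂ ℚ._+_ halves halves) ⟩
  sumℚ (λ i → onPair K (pairAt {suc n} i)) ℚ.+ sumℚ (λ i → onPair K (pairAt {suc n} i)) ∎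
  where
  open ≡-Reasoning
  R = sumℚ (λ b → K zero (suc b))
  T = sumℚ (λ i → onPair (λ a b → K (suc a) (suc b)) (pairAt {n} i))
  at-suc : ∀ p → onPair K (sucPair p) ≡ onPair (λ a b → K (suc a) (suc b)) p
  at-suc (a , b , p) = refl
  halves : sumℚ (λ i → onPair K (pairAt {suc n} i)) ≡ R ℚ.+ T
  halves = trans (sum-↑ n (numPairs n) (λ i → onPair K (pairAt {suc n} i))) (cong₂ ℚ._+_
    (sum-cong (λ b → cong (λ z → onPair K ([ (λ b → zero , suc b , ℕ.s≤s ℕ.z≤n) , (λ j → sucPair (pairAt j)) ]′ z))
                          (Finₚ.splitAt-↑ˡ n b (numPairs n))))
    (sum-cong (λ j → trans
      (cong (λ z → onPair K ([ (λ b → zero , suc b , ℕ.s≤s ℕ.z≤n) , (λ j → sucPair (pairAt j)) ]′ z))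
            (Finₚ.splitAt-↑ʳ n (numPairs n) j))
      (at-suc (pairAt j)))))

-- Labellings of ℤ_k

-- Summands are functions on ℕ, so that cyclic windows become shifts of a periodic function.
Σ< : ℕ → (ℕ → ℕ) → ℕ
Σ< zero    F = 0
Σ< (suc k) F = F 0 + Σ< k (λ i → F (suc i))

Σ<-cong : ∀ k {F G : ℕ → ℕ} → (∀ i → i < k → F i ≡ G i) → Σ< k F ≡ Σ< k G
Σ<-cong zero    e = refl
Σ<-cong (suc k) e = cong₂ _+_ (e 0 (s≤s z≤n)) (Σ<-cong k (λ i i<k → e (suc i) (s≤s i<k)))

Σ<-split : ∀ a b (F : ℕ → ℕ) → Σ< (a + b) F ≡ Σ< a F + Σ< b (λ i → F (a + i))
Σ<-split zero    b F = refl
Σ<-split (suc a) b F = trans (cong (F 0 +_) (Σ<-split a b (λ i → F (suc i))))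
  (sym (+-assoc (F 0) _ _))

Σ<-last : ∀ k (F : ℕ → ℕ) → Σ< (suc k) F ≡ Σ< k F + F k
Σ<-last k F = trans (cong (λ l → Σ< l F) (+-comm 1 k)) (trans (Σ<-split k 1 F)
  (cong (Σ< k F +_) (trans (+-identityʳ (F (k + 0))) (cong F (+-identityʳ k)))))

Σ<-+ : ∀ k (F G : ℕ → ℕ) → Σ< k (λ i → F i + G i) ≡ Σ< k F + Σ< k G
Σ<-+ zero    F G = refl
Σ<-+ (suc k) F G = trans (cong (F 0 + G 0 +_) (Σ<-+ k (λ i → F (suc i)) (λ i → G (suc i))))
  (interchange (F 0) (G 0) (Σ< k (λ i → F (suc i))) (Σ< k (λ i → G (suc i))))
  where
  interchange : ∀ a b c d → a + b + (c + d) ≡ a + c + (b + d)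
  interchange = solve-∀

Σ<-zero : ∀ k {F : ℕ → ℕ} → (∀ i → i < k → F i ≡ 0) → Σ< k F ≡ 0
Σ<-zero zero    e = refl
Σ<-zero (suc k) e = cong₂ _+_ (e 0 (s≤s z≤n)) (Σ<-zero k (λ i i<k → e (suc i) (s≤s i<k)))

Σ<-ones : ∀ k → Σ< k (λ _ → 1) ≡ k
Σ<-ones zero    = refl
Σ<-ones (suc k) = cong suc (Σ<-ones k)

-- Consecutive windows share all but one term, and the term lost, `F c`, equals the term gained,
-- `F (c + k)`.
Σ<-rotate : ∀ k (F : ℕ → ℕ) → (∀ i → F (i + k) ≡ F i) → ∀ c → Σ< k (λ i → F (c + i)) ≡ Σ< k F
Σ<-rotate k F per zero    = refl
Σ<-rotate k F per (suc c) = trans (+-cancelˡ-≡ (F c) _ _ (begin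
  F c + Σ< k (λ i → F (suc c + i))
    ≡⟨ cong₂ _+_ (cong F (sym (+-identityʳ c))) (Σ<-cong k (λ i _ → cong F (sym (+-suc c i)))) ⟩
  Σ< (suc k) (λ i → F (c + i))
    ≡⟨ Σ<-last k (λ i → F (c + i)) ⟩
  Σ< k (λ i → F (c + i)) + F (c + k)
    ≡⟨ cong (Σ< k (λ i → F (c + i)) +_) (per c) ⟩
  Σ< k (λ i → F (c + i)) + F c
    ≡⟨ +-comm _ (F c) ⟩
  F c + Σ< k (λ i → F (c + i)) ∎)) (Σ<-rotate k F per c)
  where open ≡-Reasoning

Σ<-pos? : ∀ k (F : ℕ → ℕ) → (∀ i → i < k → F i ≡ 0) ⊎ ∃ λ i → i < k × 1 ≤ F i
Σ<-pos? zero    F = inj₁ (λ _ ())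
Σ<-pos? (suc k) F with F 0 in F0
... | suc _ = inj₂ (0 , s≤s z≤n , subst (1 ≤_) (sym F0) (s≤s z≤n))
... | zero with Σ<-pos? k (λ i → F (suc i))
...   | inj₁ none          = inj₁ (λ { zero _ → F0 ; (suc i) (s≤s i<k) → none i i<k })
...   | inj₂ (i , i<k , p) = inj₂ (suc i , s≤s i<k , p)

term≤Σ< : ∀ k (F : ℕ → ℕ) i → i < k → F i ≤ Σ< k F
term≤Σ< (suc k) F zero    _         = m≤m+n (F 0) _
term≤Σ< (suc k) F (suc i) (s≤s i<k) = ≤-trans (term≤Σ< k (λ i → F (suc i)) i i<k) (m≤n+m _ (F 0))

neq : ℕ → ℕ → ℕ
neq a b with a ≟ b
... | yes _ = 0
... | no  _ = 1

eq : ℕ → ℕ → ℕ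
eq a b with a ≟ b
... | yes _ = 1
... | no  _ = 0

module _ (h : ℕ → ℕ) where

  differ : ℕ → ℕ → ℕ
  differ i j = neq (h i) (h j)

  agree : ℕ → ℕ → ℕ
  agree i j = eq (h i) (h j)

  differ-≡ : ∀ {i j} → h i ≡ h j → differ i j ≡ 0
  differ-≡ {i} {j} e with h i ≟ h j
  ... | yes _ = refl
  ... | no ne = ⊥-elim (ne e)

  differ-0 : ∀ {i j} → differ i j ≡ 0 → h i ≡ h j
  differ-0 {i} {j} e with h i ≟ h j
  ... | yes p = p

  differ≤1 : ∀ i j → differ i j ≤ 1
  differ≤1 i j with h i ≟ h j
  ... | yes _ = z≤n
  ... | no  _ = s≤s z≤n

  agree-≡ : ∀ {i j} → h i ≡ h j → agree i j ≡ 1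
  agree-≡ {i} {j} e with h i ≟ h j
  ... | yes _ = refl
  ... | no ne = ⊥-elim (ne e)

  agree-≢ : ∀ {i j} → h i ≢ h j → agree i j ≡ 0
  agree-≢ {i} {j} ne with h i ≟ h j
  ... | yes e = ⊥-elim (ne e)
  ... | no  _ = refl

  agree≤1 : ∀ i j → agree i j ≤ 1
  agree≤1 i j with h i ≟ h j
  ... | yes _ = s≤s z≤n
  ... | no  _ = z≤n

  agree+differ : ∀ i j → agree i j + differ i j ≡ 1
  agree+differ i j with h i ≟ h j
  ... | yes _ = refl
  ... | no  _ = refl

-- Summed over a period, the deficit of a labelling h of ℤ_k is k minus the
-- left-hand side of the half-chorded odd cycle inequality.
deficit : ℕ → (ℕ → ℕ) → ℕ → ℕ
deficit d h i = agree h i (i + d) + differ h i (suc i)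

constant-run : ∀ (h : ℕ → ℕ) i e → (∀ o → o < e → differ h (i + o) (suc (i + o)) ≡ 0) → h i ≡ h (i + e)
constant-run h i zero    z = cong h (sym (+-identityʳ i))
constant-run h i (suc e) z = trans (constant-run h i e (λ o o<e → z o (<-trans o<e (n<1+n e))))
  (trans (differ-0 h (z e (n<1+n e))) (cong h (sym (+-suc i e))))

-- If nothing changes from `i` to `i + d`, then the two ends of the window agree.
window : ∀ d (h : ℕ → ℕ) i → 1 ≤ Σ< d (λ o → differ h (i + o) (suc (i + o))) + agree h i (i + d)
window d h i with Σ<-pos? d (λ o → differ h (i + o) (suc (i + o)))
... | inj₁ none = ≤-trans (≤-reflexive (sym (agree-≡ h (constant-run h i d none)))) (m≤n+m _ _)
... | inj₂ (o , o<d , p) = ≤-trans (≤-trans p (term≤Σ< d _ o o<d)) (m≤m+n _ _)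

Periodic : ∀ {A : Set} → ℕ → (ℕ → A) → Set
Periodic k h = ∀ i → h (i + k) ≡ h i

periodic-+* : ∀ {A : Set} k (f : ℕ → A) → Periodic k f → ∀ i q → f (i + q * k) ≡ f i
periodic-+* k f per i zero    = cong f (+-identityʳ i)
periodic-+* k f per i (suc q) = trans (cong f (reorder i k (q * k))) (trans (per _) (periodic-+* k f per i q))
  where
  reorder : ∀ r m p → r + (m + p) ≡ r + p + m
  reorder = solve-∀

periodic-window : ∀ {A : Set} k (f : ℕ → A) → Periodic k f → 0 < k → ∀ p i → ∃ λ o → o < k × f (p + o) ≡ f i
-- Modulo `suc k`, adding `p * k` amounts to subtracting `p`.
periodic-window (suc k) f per _ p i = o , m%n<n (i + p * k) (suc k) , (begin
  f (p + o)                    ≡⟨ sym (periodic-+* (suc k) f per (p + o) q) ⟩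
  f (p + o + q * suc k)        ≡⟨ cong f (trans (+-assoc p o _) (cong (p +_) (sym (m≡m%n+[m/n]*n (i + p * k)
      (suc k))))) ⟩
  f (p + (i + p * k))          ≡⟨ cong f (reorder p i k) ⟩
  f (i + p * suc k)            ≡⟨ periodic-+* (suc k) f per i p ⟩
  f i                          ∎)
  where
  open ≡-Reasoning
  o = (i + p * k) % suc k
  q = (i + p * k) ℕ./ suc k
  reorder : ∀ p i k → p + (i + p * k) ≡ i + p * suc k
  reorder = solve-∀

differ-periodic : ∀ k {h} → Periodic k h → ∀ i → differ h (i + k) (suc (i + k)) ≡ differ h i (suc i)
differ-periodic k per i = cong₂ neq (per i) (per (suc i))

+-rotate : ∀ i k d → i + k + d ≡ i + d + k
+-rotate = solve-∀

agree-periodic : ∀ k d {h} → Periodic k h → ∀ i → agree h (i + k) (i + k + d) ≡ agree h i (i + d)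
agree-periodic k d {h} per i = cong₂ eq (per i) (trans (cong h (+-rotate i k d)) (per (i + d)))

deficit-periodic : ∀ k d {h} → Periodic k h → Periodic k (deficit d h)
deficit-periodic k d per i = cong₂ _+_ (agree-periodic k d per i) (differ-periodic k per i)

-- If j is a change then the windows following j and j + d, of length d each,
-- exhaust the remaining positions, and each contains a change or starts at an agreement.
deficit≥3 : ∀ d → 1 ≤ d → ∀ h → Periodic (suc (2 * d)) h → 3 ≤ Σ< (suc (2 * d)) (deficit d h)
deficit≥3 d@(suc d′) _ h per with Σ<-pos? (suc (2 * d)) (λ i → differ h i (suc i))
-- Without any change the labelling is constant, and each of the `3 + 2 * d′` positions is an
-- agreement.
... | inj₁ none = ≤-trans (≤-trans (s≤s (s≤s (s≤s z≤n))) (≤-reflexive (sym (three d′))))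
                          (Σ<-≥ (suc (2 * d)) (λ i i<k → ≤-trans (≤-reflexive (sym (agree-≡ h (all-equal i)))) (m≤m+n
                              (agree h i (i + d)) (differ h i (suc i)))))
  where
  three : ∀ d′ → suc (2 * suc d′) ≡ 3 + 2 * d′
  three = solve-∀
  Σ<-≥ : ∀ k {F : ℕ → ℕ} → (∀ i → i < k → 1 ≤ F i) → k ≤ Σ< k F
  Σ<-≥ zero    p = z≤n
  Σ<-≥ (suc k) p = +-mono-≤ (p 0 (s≤s z≤n)) (Σ<-≥ k (λ i i<k → p (suc i) (s≤s i<k)))
  always : ∀ i → differ h i (suc i) ≡ 0
  always i with Σ<-pos? (suc (2 * d)) (λ o → differ h (i + o) (suc (i + o)))
  ... | inj₁ z = trans (cong (λ l → differ h l (suc l)) (sym (+-identityʳ i))) (z 0 (s≤s z≤n))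
  ... | inj₂ (o , o<k , p) = ⊥-elim (<-irrefl (sym total) (≤-trans p (≤-trans (term≤Σ< (suc (2 * d)) (λ o → differ h
      (i + o) (suc (i + o))) o o<k) (≤-reflexive rot))))
    where
    rot = Σ<-rotate (suc (2 * d)) (λ i → differ h i (suc i)) (differ-periodic (suc (2 * d)) per) i
    total = Σ<-zero (suc (2 * d)) {λ i → differ h i (suc i)} none
  all-equal : ∀ i → h i ≡ h (i + d)
  all-equal i = constant-run h i d (λ o _ → always (i + o))
... | inj₂ (j , j<k , p) = begin
  3
    ≤⟨ +-mono-≤ p (+-mono-≤ (window d h (suc j)) (window d h (suc j + d))) ⟩
  D j + ((W₁ + E (suc j)) + (W₂ + E (suc j + d)))
    ≤⟨ m≤m+n _ (R₁ + R₂ + E j) ⟩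
  D j + ((W₁ + E (suc j)) + (W₂ + E (suc j + d))) + (R₁ + R₂ + E j)
    ≡⟨ regroup (D j) W₁ (E (suc j)) W₂ (E (suc j + d)) R₁ R₂ (E j) ⟩
  E j + ((E (suc j) + R₁) + (E (suc j + d) + R₂)) + (D j + (W₁ + W₂))
    ≡⟨ sym (cong₂ _+_ ΣE ΣD) ⟩
  Σ< (suc (2 * d)) (λ i → E (j + i)) + Σ< (suc (2 * d)) (λ i → D (j + i))
    ≡⟨ cong₂ _+_ (Σ<-rotate (suc (2 * d)) E (agree-periodic (suc (2 * d)) d per) j)
                 (Σ<-rotate (suc (2 * d)) D (differ-periodic (suc (2 * d)) per) j) ⟩
  Σ< (suc (2 * d)) E + Σ< (suc (2 * d)) D
    ≡⟨ sym (Σ<-+ (suc (2 * d)) E D) ⟩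
  Σ< (suc (2 * d)) (deficit d h) ∎
  where
  open ≤-Reasoning
  D E : ℕ → ℕ
  D i = differ h i (suc i)
  E i = agree h i (i + d)
  W₁ W₂ R₁ R₂ : ℕ
  W₁ = Σ< d (λ o → D (suc j + o))
  W₂ = Σ< d (λ o → D (suc j + d + o))
  R₁ = Σ< d′ (λ o → E (suc j + suc o))
  R₂ = Σ< d′ (λ o → E (suc j + d + suc o))
  halves : ∀ (F : ℕ → ℕ) → Σ< (suc (2 * d)) (λ i → F (j + i)) ≡
    F j + (Σ< d (λ o → F (suc j + o)) + Σ< d (λ o → F (suc j + d + o)))
  halves F = cong₂ _+_ (cong F (+-identityʳ j)) (trans (cong (λ l → Σ< l (λ i → F (j + suc i))) (cong (d +_)
      (+-identityʳ d)))
    (trans (Σ<-split d d (λ i → F (j + suc i)))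
      (cong₂ _+_ (Σ<-cong d (λ i _ → cong F (+-suc j i))) (Σ<-cong d (λ i _ → cong F (shift j d i))))))
    where
    shift : ∀ j d i → j + suc (d + i) ≡ suc j + d + i
    shift = solve-∀
  ΣD : Σ< (suc (2 * d)) (λ i → D (j + i)) ≡ D j + (W₁ + W₂)
  ΣD = halves D
  ΣE : Σ< (suc (2 * d)) (λ i → E (j + i)) ≡ E j + ((E (suc j) + R₁) + (E (suc j + d) + R₂))
  ΣE = trans (halves E) (cong (E j +_) (cong₂ _+_ (cong (λ l → E l + R₁) (+-identityʳ (suc j))) (cong (λ l → E l + R₂)
      (+-identityʳ (suc j + d)))))
  regroup : ∀ a b c d e f g i → a + ((b + c) + (d + e)) + (f + g + i) ≡ i + ((c + f) + (e + g)) + (a + (b + d))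
  regroup = solve-∀

-- Cost d e bounds the deficit over a maximal run of e equal labels.
data Cost (d : ℕ) : ℕ → ℕ → Set where
  none  : Cost d 0 0
  short : ∀ {e} → e ≤ d → Cost d e 1
  long  : Cost d (suc d) 2

-- Only the last position of a run can be a change. From a position of a run of length at most `d`,
-- a jump by `d` leaves the run and does not yet come back to it a period later, so there is no
-- agreement. In a run of length `d + 1` only the first position can agree, namely with the last
-- one.
run-cost : ∀ d (h : ℕ → ℕ) a j e c → 1 ≤ d → Cost d e c →
  (∀ o → o < e → h (j + o) ≡ a) → (∀ o → e ≤ o → o < suc (2 * d) → h (j + o) ≢ a) →
  Σ< e (λ o → deficit d h (j + o)) ≤ c
run-cost d h a j zero c 1≤d cost inside outside = z≤n
run-cost d h a j e@(suc e′) c 1≤d cost inside outside = bound cost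
  where
  no-change : ∀ o → suc o < e → differ h (j + o) (suc (j + o)) ≡ 0
  no-change o so<e = differ-≡ h (trans (inside o (<-trans (n<1+n o) so<e))
    (sym (trans (cong h (sym (+-suc j o))) (inside (suc o) so<e))))
  e≤1+d : ∀ {c} → Cost d e c → e ≤ suc d
  e≤1+d (short e≤d) = ≤-trans e≤d (n≤1+n d)
  e≤1+d long        = ≤-refl
  no-agree : ∀ o → o < e → e ≤ o + d → e ≤ suc d → agree h (j + o) (j + o + d) ≡ 0
  no-agree o o<e e≤o+d e≤1+d = agree-≢ h (λ same → outside (o + d) e≤o+d
    (s≤s (≤-trans (+-monoˡ-≤ d (≤-pred (≤-trans o<e e≤1+d))) (≤-reflexive (cong (d +_) (sym (+-identityʳ d))))))
    (trans (cong h (sym (+-assoc j o d))) (trans (sym same) (inside o o<e))))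
  bound : ∀ {c} → Cost d (suc e′) c → Σ< e (λ o → deficit d h (j + o)) ≤ c
  bound (short e≤d) = ≤-trans (≤-reflexive (Σ<-last e′ _)) (+-mono-≤
    (≤-reflexive (Σ<-zero e′ (λ o o<e′ → cong₂ _+_
      (no-agree o (≤-trans o<e′ (n≤1+n e′)) (≤-trans e≤d (m≤n+m d o)) (≤-trans e≤d (n≤1+n d)))
      (no-change o (s≤s o<e′)))))
    (+-mono-≤ (≤-reflexive (no-agree e′ ≤-refl (≤-trans e≤d (m≤n+m d e′)) (≤-trans e≤d (n≤1+n d)))) (differ≤1 h _ _)))
  bound long = long-bound e′ refl no-change (λ o o<e q → no-agree o o<e q ≤-refl)
    where
    long-bound : ∀ d″ → d″ ≡ d → (∀ o → suc o < suc d″ → differ h (j + o) (suc (j + o)) ≡ 0) →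
      (∀ o → o < suc d″ → suc d″ ≤ o + d → agree h (j + o) (j + o + d) ≡ 0) →
      Σ< (suc d″) (λ o → deficit d h (j + o)) ≤ 2
    long-bound zero     refl _  _  = ⊥-elim (n≮0 1≤d)
    long-bound (suc d‴) refl nc na = +-mono-≤ {y = 1}
      (+-mono-≤ (agree≤1 h _ _) (≤-reflexive (nc 0 (s≤s (s≤s z≤n)))))
      (≤-trans (≤-reflexive (Σ<-last d‴ _)) (+-mono-≤
        (≤-reflexive (Σ<-zero d‴ (λ o o<d‴ → cong₂ _+_
          (na (suc o) (s≤s (≤-trans o<d‴ (n≤1+n d‴))) (s≤s (m≤n+m (suc d‴) o)))
          (nc (suc o) (s≤s (s≤s o<d‴))))))
        (+-mono-≤ (≤-reflexive (na (suc d‴) ≤-refl (s≤s (m≤n+m (suc d‴) d‴)))) (differ≤1 h _ _))))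

-- Natural numbers as rationals.

ι : ℕ → ℚ
ι n = ℤ.+ n ℚ./ 1

-- The fraction normalises by a gcd, which is stuck on a variable; the explicit normal form lets
-- sums and comparisons with `0ℚ` compute.
ι-mkℚ : ∀ n → ι n ≡ mkℚ (ℤ.+ n) 0 (Coprime.sym (Coprime.1-coprimeTo n))
ι-mkℚ n = ℚₚ.normalize-coprime (Coprime.sym (Coprime.1-coprimeTo n))

ι-+ : ∀ a b → ι (a ℕ.+ b) ≡ ι a ℚ.+ ι b
ι-+ a b = sym (trans (cong₂ ℚ._+_ (ι-mkℚ a) (ι-mkℚ b))
  (ℚₚ./-cong (cong₂ ℤ._+_ (ℤₚ.*-identityʳ (ℤ.+ a)) (ℤₚ.*-identityʳ (ℤ.+ b))) refl))

ι-suc≢0 : ∀ n → ι (suc n) ≢ 0ℚ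
ι-suc≢0 n e with () ← trans (sym (ι-mkℚ (suc n))) e

0≤ι : ∀ n → 0ℚ ℚ.≤ ι n
0≤ι n = ℚₚ.nonNegative⁻¹ (ι n) {{ℚₚ.normalize-nonNeg n 1}}

⟦⟧-eq : ∀ a b → ⟦ a ≟ b ⟧ ≡ ι (eq a b)
⟦⟧-eq a b with a ≟ b
... | yes _ = refl
... | no  _ = refl

sum-ι : ∀ k (F : ℕ → ℕ) → sumℚ {k} (λ i → ι (F (toℕ i))) ≡ ι (Σ< k F)
sum-ι zero    F = refl
sum-ι (suc k) F = trans (cong (ι (F 0) ℚ.+_) (sum-ι k (λ i → F (suc i)))) (sym (ι-+ (F 0) _))

-- The cycle and its partitions into arcs

-- Labels in ℕ leave room for three special labels beside one for each vertex; `canonical` brings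
-- them back to `Fin n`.
Decomposition : ∀ {n} → Graph n → (Fin n → ℕ) → Set
Decomposition G g = ∀ a b → g a ≡ g b → Star (λ u w → Adj G u w × g u ≡ g a × g w ≡ g a) a b

-- z walks around the cycle C for ever, and visits the vertices v_i (i taken modulo k)
-- at the times s i.
record Frame {n} (G : Graph n) (m d : ℕ) : Set where
  field
    2≤d   : 2 ≤ d
    z     : ℕ → Fin n
    z-per : ∀ t → z (t + m) ≡ z t
    z-inj : ∀ t o o′ → o < m → o′ < m → z (t + o) ≡ z (t + o′) → o ≡ o′
    z-adj : ∀ t → Adj G (z t) (z (suc t))
    s     : ℕ → ℕ
    s-0   : s 0 ≡ 0
    s-suc : ∀ i → s i < s (suc i)
    s-per : ∀ i → s (i + suc (2 * d)) ≡ s i + m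

module FrameProperties {n} {G : Graph n} {m d : ℕ} (F : Frame G m d) where
  open Frame F public

  k : ℕ
  k = suc (2 * d)

  V : ℕ → Fin n
  V i = z (s i)

  V-per : ∀ i → V (i + k) ≡ V i
  V-per i = trans (cong z (s-per i)) (z-per (s i))

  s-mono-≤ : ∀ {i j} → i ≤ j → s i ≤ s j
  s-mono-≤ {i} {j} i≤j = subst (λ l → s i ≤ s l) (m+[n∸m]≡n i≤j) (go (j ∸ i))
    where
    go : ∀ l → s i ≤ s (i + l)
    go zero    = ≤-reflexive (cong s (sym (+-identityʳ i)))
    go (suc l) = ≤-trans (go l) (≤-trans (<⇒≤ (s-suc (i + l))) (≤-reflexive (cong s (sym (+-suc i l)))))

  s-mono-< : ∀ {i j} → i < j → s i < s j
  s-mono-< {i} i<j = ≤-trans (s-suc i) (s-mono-≤ i<j)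

  -- N t is the number of i with s i < t.
  N : ℕ → ℕ
  N zero    = 0
  N (suc t) with s (N t) ≟ t
  ... | yes _ = suc (N t)
  ... | no  _ = N t

  N-upper : ∀ t → t ≤ s (N t)
  N-upper zero    = z≤n
  N-upper (suc t) with s (N t) ≟ t
  ... | yes e = subst (_< s (suc (N t))) e (s-suc (N t))
  ... | no ne = ≤∧≢⇒< (N-upper t) (ne ∘ sym)

  <N⇒s< : ∀ t i → i < N t → s i < t
  <N⇒s< (suc t) i i<N with s (N t) ≟ t
  <N⇒s< (suc t) i (s≤s i≤N) | yes e = s≤s (subst (s i ≤_) e (s-mono-≤ i≤N))
  <N⇒s< (suc t) i i<N | no _ = ≤-trans (<N⇒s< t i i<N) (n≤1+n t)

  -- With `≤s⇒N≤` this makes `N` and `s` a Galois connection between times and indices, on which the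
  -- counting of marked vertices in arcs rests.
  N≤⇒≤s : ∀ {t i} → N t ≤ i → t ≤ s i
  N≤⇒≤s {t} p = ≤-trans (N-upper t) (s-mono-≤ p)

  ≤s⇒N≤ : ∀ {t i} → t ≤ s i → N t ≤ i
  ≤s⇒N≤ {t} {i} p = ≮⇒≥ (λ i<N → <-irrefl refl (≤-trans (<N⇒s< t i i<N) p))

  s<⇒<N : ∀ {t i} → s i < t → i < N t
  s<⇒<N p = ≰⇒> (λ N≤i → <-irrefl refl (≤-trans p (N≤⇒≤s N≤i)))

  N-mono : ∀ {t u} → t ≤ u → N t ≤ N u
  N-mono {t} {u} p = ≤s⇒N≤ (≤-trans p (N-upper u))

  N-s : ∀ i → N (s i) ≡ i
  N-s i = ≤-antisym (≤s⇒N≤ ≤-refl) (≮⇒≥ (λ N<i → <-irrefl refl (≤-trans (s-mono-< N<i) (N-upper (s i)))))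

  N-suc-s : ∀ i → N (suc (s i)) ≡ suc i
  N-suc-s i = ≤-antisym (≤s⇒N≤ (s-suc i)) (s<⇒<N ≤-refl)

  N-suc-≢ : ∀ t → s (N t) ≢ t → N (suc t) ≡ N t
  N-suc-≢ t ne with s (N t) ≟ t
  ... | yes e = ⊥-elim (ne e)
  ... | no  _ = refl

  N-m : N m ≡ k
  N-m = trans (cong N (sym (trans (s-per 0) (cong (_+ m) s-0)))) (N-s k)

  N-per : ∀ t → N (t + m) ≡ N t + k
  N-per t = ≤-antisym
    (≤s⇒N≤ (≤-trans (+-monoˡ-≤ m (N-upper t)) (≤-reflexive (sym (s-per (N t))))))
    (subst (N t + k ≤_) (m∸n+n≡m k≤i) (+-monoˡ-≤ k (≤s⇒N≤ (+-cancelʳ-≤ m t _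
      (≤-trans (N-upper (t + m)) (≤-reflexive (trans (cong s (sym (m∸n+n≡m k≤i))) (s-per _))))))))
    where
    k≤i : k ≤ N (t + m)
    k≤i = ≤-trans (≤-reflexive (sym N-m)) (N-mono (m≤n+m m t))

  0<m : 0 < m
  0<m = n≢0⇒n>0 λ m≡0 → 1+n≢0 (trans (sym N-m) (cong N m≡0))

  z-inj′ : ∀ p {τ τ′} → p ≤ τ → τ < p + m → p ≤ τ′ → τ′ < p + m → z τ ≡ z τ′ → τ ≡ τ′
  z-inj′ p {τ} {τ′} a b a′ b′ e = begin
    τ            ≡⟨ sym (m+[n∸m]≡n a) ⟩
    p + (τ ∸ p)  ≡⟨ cong (p +_) (z-inj p (τ ∸ p) (τ′ ∸ p) (below a b) (below a′ b′)
                      (trans (cong z (m+[n∸m]≡n a)) (trans e (cong z (sym (m+[n∸m]≡n a′)))))) ⟩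
    p + (τ′ ∸ p) ≡⟨ m+[n∸m]≡n a′ ⟩
    τ′           ∎
    where
    open ≡-Reasoning
    below : ∀ {τ} → p ≤ τ → τ < p + m → τ ∸ p < m
    below {τ} a b = +-cancelˡ-< p _ _ (subst (_< p + m) (sym (m+[n∸m]≡n a)) b)

  V-per′ : ∀ q e → V (q + k + e) ≡ V (q + e)
  V-per′ q e = trans (cong V (+-rotate q k e)) (V-per (q + e))

  V-inj : ∀ p o o′ → o < k → o′ < k → V (p + o) ≡ V (p + o′) → o ≡ o′
  V-inj p o o′ o<k o′<k e = +-cancelˡ-≡ p o o′ (trans (sym (N-s (p + o))) (trans
    (cong N (z-inj′ (s p) (s-mono-≤ (m≤m+n p o)) (below o o<k) (s-mono-≤ (m≤m+n p o′)) (below o′ o′<k) e)) (N-s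
        (p + o′))))
    where
    below : ∀ o → o < k → s (p + o) < s p + m
    below o o<k = ≤-trans (s-mono-< (+-monoʳ-< p o<k)) (≤-reflexive (s-per p))

  Tight : (Fin n → ℕ) → Set
  Tight g = Σ< k (deficit d (λ i → g (V i))) ≡ 3

  record Good (g : Fin n → ℕ) : Set where
    constructor good
    field
      decomposition : Decomposition G g
      tight         : Tight g

  -- The block labelled `a` is the half-open interval of times from `p` to `q`, at most one lap
  -- long. It may be empty, and it may pass the base point of the cycle.
  record Arc (g : Fin n → ℕ) (a p q : ℕ) : Set where
    constructor arc
    field
      q≤p+m  : q ≤ p + m
      inside : ∀ τ → p ≤ τ → τ < q → g (z τ) ≡ a
      only   : ∀ x → g x ≡ a → ∃ λ τ → p ≤ τ × τ < q × z τ ≡ x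

    outside : ∀ τ → q ≤ τ → τ < p + m → p ≤ q → g (z τ) ≢ a
    outside τ q≤τ τ<p+m p≤q e with only (z τ) e
    ... | τ′ , p≤τ′ , τ′<q , zτ′≡zτ =
      <-irrefl (z-inj′ p p≤τ′ (≤-trans τ′<q q≤p+m) (≤-trans p≤q q≤τ) τ<p+m zτ′≡zτ) (≤-trans τ′<q q≤τ)

    index-inside : ∀ i → N p ≤ i → i < N q → g (V i) ≡ a
    index-inside i Np≤i i<Nq = inside (s i) (N≤⇒≤s Np≤i) (<N⇒s< q i i<Nq)

    index-outside : ∀ i → N q ≤ i → i < N p + k → p ≤ q → g (V i) ≢ a
    index-outside i Nq≤i i<Np+k = outside (s i) (N≤⇒≤s Nq≤i) (<N⇒s< (p + m) i (subst (i <_) (sym (N-per p)) i<Np+k))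

  Within : (Fin n → ℕ) → ℕ → Fin n → Fin n → Set
  Within g a u w = Adj G u w × g u ≡ a × g w ≡ a

  z-path : ∀ (g : Fin n → ℕ) a τ l → (∀ o → o ≤ l → g (z (τ + o)) ≡ a) →
    Star (Within g a) (z τ) (z (τ + l))
  z-path g a τ zero    lab = subst (λ t → Star (Within g a) (z τ) (z t)) (sym (+-identityʳ τ)) ε
  z-path g a τ (suc l) lab =
    (z-adj τ , trans (cong (g ∘ z) (sym (+-identityʳ τ))) (lab 0 z≤n) , trans (cong (g ∘ z) (+-comm 1 τ)) (lab 1
        (s≤s z≤n)))
    ◅ subst (λ t → Star (Within g a) (z (suc τ)) (z t)) (sym (+-suc τ l))
        (z-path g a (suc τ) l (λ o o≤l → trans (cong (g ∘ z) (sym (+-suc τ o))) (lab (suc o) (s≤s o≤l))))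

  arc-path : ∀ {g a p q} → Arc g a p q → ∀ {τ τ′} → p ≤ τ → τ′ < q → τ ≤ τ′ →
    Star (Within g a) (z τ) (z τ′)
  arc-path {g} {a} A {τ} p≤τ τ′<q τ≤τ′ = subst (λ t → Star (Within g a) (z τ) (z t)) (m+[n∸m]≡n τ≤τ′) (z-path g a τ _
      (λ o o≤l →
    Arc.inside A (τ + o) (≤-trans p≤τ (m≤m+n τ o))
      (≤-trans (s≤s (≤-trans (+-monoʳ-≤ τ o≤l) (≤-reflexive (m+[n∸m]≡n τ≤τ′)))) τ′<q)))

  arc-connected : ∀ {g a p q} → Arc g a p q → ∀ x y → g x ≡ a → g y ≡ a →
    Star (Within g a) x y
  arc-connected A x y gx gy with Arc.only A x gx | Arc.only A y gy
  ... | τ , p≤τ , τ<q , refl | τ′ , p≤τ′ , τ′<q , refl with ≤-total τ τ′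
  ...   | inj₁ τ≤τ′ = arc-path A p≤τ τ′<q τ≤τ′
  ...   | inj₂ τ′≤τ = reverse (λ { (e , p , q) → symm G e , q , p }) (arc-path A p≤τ′ τ<q τ′≤τ)

  OnCycle : Fin n → Set
  OnCycle x = ∃ λ (o : Fin m) → z (toℕ o) ≡ x

  z-on-cycle : ∀ τ → OnCycle (z τ)
  z-on-cycle τ = Fin.fromℕ< (m%n<n τ m) , trans (cong z (Finₚ.toℕ-fromℕ< (m%n<n τ m)))
    (sym (trans (cong z (m≡m%n+[m/n]*n τ m)) (periodic-+* m z z-per (τ % m) (τ ℕ./ m))))
    where
    instance
      m-nonZero : ℕ.NonZero m
      m-nonZero = ℕ.>-nonZero 0<m

  -- The third arc runs from `t₂` to `t₀ + m`. The inequalities are weak because tight partitions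
  -- with an empty arc occur.
  record Cuts (t₀ t₁ t₂ : ℕ) : Set where
    constructor cuts
    field
      t₀≤t₁   : t₀ ≤ t₁
      t₁≤t₂   : t₁ ≤ t₂
      t₂≤t₀+m : t₂ ≤ t₀ + m

  locate : ∀ t x → Dec (∃ λ (o : Fin m) → z (t + toℕ o) ≡ x)
  locate t x = Finₚ.any? (λ o → z (t + toℕ o) Finₚ.≟ x)

  level : ℕ → ℕ → ℕ → ℕ
  level t₁ t₂ τ with τ <? t₁
  ... | yes _ = 0
  ... | no  _ with τ <? t₂
  ...   | yes _ = 1
  ...   | no  _ = 2

  -- The labels 0, 1, 2 belong to the arcs; labels from 3 on make each vertex off the cycle a block
  -- of its own.
  arcs : ℕ → ℕ → ℕ → Fin n → ℕ
  arcs t₀ t₁ t₂ x with locate t₀ x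
  ... | yes (o , _) = level t₁ t₂ (t₀ + toℕ o)
  ... | no  _       = 3 + toℕ x

  level-0 : ∀ t₁ t₂ {τ} → τ < t₁ → level t₁ t₂ τ ≡ 0
  level-0 t₁ t₂ {τ} p with τ <? t₁
  ... | yes _ = refl
  ... | no ¬p = ⊥-elim (¬p p)

  level-1 : ∀ t₁ t₂ {τ} → t₁ ≤ τ → τ < t₂ → level t₁ t₂ τ ≡ 1
  level-1 t₁ t₂ {τ} p q with τ <? t₁
  ... | yes r = ⊥-elim (<-irrefl refl (≤-trans r p))
  ... | no  _ with τ <? t₂
  ...   | yes _ = refl
  ...   | no ¬q = ⊥-elim (¬q q)

  level-2 : ∀ t₁ t₂ {τ} → t₁ ≤ τ → t₂ ≤ τ → level t₁ t₂ τ ≡ 2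
  level-2 t₁ t₂ {τ} p q with τ <? t₁
  ... | yes r = ⊥-elim (<-irrefl refl (≤-trans r p))
  ... | no  _ with τ <? t₂
  ...   | yes r = ⊥-elim (<-irrefl refl (≤-trans r q))
  ...   | no  _ = refl

  level-view : ∀ t₁ t₂ τ → (level t₁ t₂ τ ≡ 0 × τ < t₁) ⊎ (level t₁ t₂ τ ≡ 1 × t₁ ≤ τ × τ < t₂) ⊎ (level t₁ t₂ τ
      ≡ 2 × t₂ ≤ τ)
  level-view t₁ t₂ τ with τ <? t₁
  ... | yes p = inj₁ (refl , p)
  ... | no ¬p with τ <? t₂
  ...   | yes q = inj₂ (inj₁ (refl , ≮⇒≥ ¬p , q))
  ...   | no ¬q = inj₂ (inj₂ (refl , ≮⇒≥ ¬q))

  module _ {t₀ t₁ t₂ : ℕ} (C : Cuts t₀ t₁ t₂) where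
    open Cuts C

    arcs-z : ∀ τ → t₀ ≤ τ → τ < t₀ + m → arcs t₀ t₁ t₂ (z τ) ≡ level t₁ t₂ τ
    arcs-z τ p q with locate t₀ (z τ)
    ... | yes (o , e) = cong (level t₁ t₂) (z-inj′ t₀ (m≤m+n t₀ (toℕ o)) (+-monoʳ-< t₀ (Finₚ.toℕ<n o)) p q e)
    ... | no nowhere = ⊥-elim (nowhere (Fin.fromℕ< below , trans (cong (λ l → z (t₀ + l)) (Finₚ.toℕ-fromℕ< below))
        (cong z (m+[n∸m]≡n p))))
      where
      below : τ ∸ t₀ < m
      below = +-cancelˡ-< t₀ _ _ (subst (_< t₀ + m) (sym (m+[n∸m]≡n p)) q)

    arcs-only : ∀ x → arcs t₀ t₁ t₂ x < 3 →
      ∃ λ τ → t₀ ≤ τ × τ < t₀ + m × z τ ≡ x × arcs t₀ t₁ t₂ x ≡ level t₁ t₂ τ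
    arcs-only x p with locate t₀ x
    ... | yes (o , e) = t₀ + toℕ o , m≤m+n t₀ (toℕ o) , +-monoʳ-< t₀ (Finₚ.toℕ<n o) , e , refl
    ... | no _ = ⊥-elim (<-irrefl refl (≤-trans p (m≤m+n 3 (toℕ x))))

    arc₀ : Arc (arcs t₀ t₁ t₂) 0 t₀ t₁
    arc₀ = arc (≤-trans t₁≤t₂ t₂≤t₀+m)
      (λ τ p q → trans (arcs-z τ p (≤-trans q (≤-trans t₁≤t₂ t₂≤t₀+m))) (level-0 t₁ t₂ q))
      only
      where
      only : ∀ x → arcs t₀ t₁ t₂ x ≡ 0 → ∃ λ τ → t₀ ≤ τ × τ < t₁ × z τ ≡ x
      only x e with arcs-only x (subst (_< 3) (sym e) (s≤s z≤n))
      ... | τ , p , q , r , l with level-view t₁ t₂ τ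
      ...   | inj₁ (_ , u)            = τ , p , u , r
      ...   | inj₂ (inj₁ (l′ , _))    with () ← trans (sym e) (trans l l′)
      ...   | inj₂ (inj₂ (l′ , _))    with () ← trans (sym e) (trans l l′)

    arc₁ : Arc (arcs t₀ t₁ t₂) 1 t₁ t₂
    arc₁ = arc (≤-trans t₂≤t₀+m (+-monoˡ-≤ m t₀≤t₁))
      (λ τ p q → trans (arcs-z τ (≤-trans t₀≤t₁ p) (≤-trans q t₂≤t₀+m)) (level-1 t₁ t₂ p q))
      only
      where
      only : ∀ x → arcs t₀ t₁ t₂ x ≡ 1 → ∃ λ τ → t₁ ≤ τ × τ < t₂ × z τ ≡ x
      only x e with arcs-only x (subst (_< 3) (sym e) (s≤s (s≤s z≤n)))
      ... | τ , p , q , r , l with level-view t₁ t₂ τ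
      ...   | inj₁ (l′ , _)           with () ← trans (sym e) (trans l l′)
      ...   | inj₂ (inj₁ (_ , u , v)) = τ , u , v , r
      ...   | inj₂ (inj₂ (l′ , _))    with () ← trans (sym e) (trans l l′)

    arc₂ : Arc (arcs t₀ t₁ t₂) 2 t₂ (t₀ + m)
    arc₂ = arc (+-monoˡ-≤ m (≤-trans t₀≤t₁ t₁≤t₂))
      (λ τ p q → trans (arcs-z τ (≤-trans t₀≤t₁ (≤-trans t₁≤t₂ p)) q) (level-2 t₁ t₂ (≤-trans t₁≤t₂ p) p))
      only
      where
      only : ∀ x → arcs t₀ t₁ t₂ x ≡ 2 → ∃ λ τ → t₂ ≤ τ × τ < t₀ + m × z τ ≡ x
      only x e with arcs-only x (subst (_< 3) (sym e) (s≤s (s≤s (s≤s z≤n))))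
      ... | τ , p , q , r , l with level-view t₁ t₂ τ
      ...   | inj₁ (l′ , _)           with () ← trans (sym e) (trans l l′)
      ...   | inj₂ (inj₁ (l′ , _))    with () ← trans (sym e) (trans l l′)
      ...   | inj₂ (inj₂ (_ , u))     = τ , u , q , r

    arcs-solo : ∀ x y → 3 ≤ arcs t₀ t₁ t₂ x → arcs t₀ t₁ t₂ x ≡ arcs t₀ t₁ t₂ y → x ≡ y
    arcs-solo x y p e with locate t₀ x
    ... | yes (o , _) with level-view t₁ t₂ (t₀ + toℕ o)
    ...   | inj₁ (l , _)        = ⊥-elim (n≮0 (subst (3 ≤_) l p))
    ...   | inj₂ (inj₁ (l , _)) = ⊥-elim (<⇒≱ (s≤s (s≤s z≤n)) (subst (3 ≤_) l p))
    ...   | inj₂ (inj₂ (l , _)) = ⊥-elim (<⇒≱ (s≤s (s≤s (s≤s z≤n))) (subst (3 ≤_) l p))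
    arcs-solo x y p e | no _ with locate t₀ y
    ... | no _ = Finₚ.toℕ-injective (+-cancelˡ-≡ 3 _ _ e)
    ... | yes (o , _) with level-view t₁ t₂ (t₀ + toℕ o)
    ...   | inj₁ (l , _)        with () ← trans e l
    ...   | inj₂ (inj₁ (l , _)) with () ← trans e l
    ...   | inj₂ (inj₂ (l , _)) with () ← trans e l

    arcs-off : ∀ x → ¬ OnCycle x → 3 ≤ arcs t₀ t₁ t₂ x
    arcs-off x off with 3 ≤? arcs t₀ t₁ t₂ x
    ... | yes p = p
    ... | no ¬p with arcs-only x (≰⇒> ¬p)
    ...   | τ , p , q , r , _ = ⊥-elim (off (subst OnCycle r (z-on-cycle τ)))

    arcs-decomposition : Decomposition G (arcs t₀ t₁ t₂)
    arcs-decomposition x y e with 3 ≤? arcs t₀ t₁ t₂ x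
    ... | yes p = subst (Star _ x) (arcs-solo x y p e) ε
    ... | no ¬p = by-label (arcs t₀ t₁ t₂ x) refl (≰⇒> ¬p)
      where
      Path : ℕ → Set
      Path a = Star (λ u w → Adj G u w × arcs t₀ t₁ t₂ u ≡ a × arcs t₀ t₁ t₂ w ≡ a) x y
      by-label : ∀ a → arcs t₀ t₁ t₂ x ≡ a → a < 3 → Path a
      by-label 0 ex _ = arc-connected arc₀ x y ex (trans (sym e) ex)
      by-label 1 ex _ = arc-connected arc₁ x y ex (trans (sym e) ex)
      by-label 2 ex _ = arc-connected arc₂ x y ex (trans (sym e) ex)
      by-label (suc (suc (suc _))) _ (s≤s (s≤s (s≤s ())))

  V-label-periodic : ∀ (g : Fin n → ℕ) → Periodic k (λ i → g (V i))
  V-label-periodic g i = cong g (V-per i)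

  -- `e₀`, `e₁`, `e₂` count the marked vertices in the three arcs. The total cost 3 arises either as
  -- 1 + 1 + 1, with at most `d` in each arc, or from 2, 1 and 0 in some order, with `d + 1`, `d`
  -- and none.
  record Shape (t₀ t₁ t₂ : ℕ) : Set where
    constructor shape
    field
      {e₀ e₁ e₂ c₀ c₁ c₂} : ℕ
      N₁    : N t₁ ≡ N t₀ + e₀
      N₂    : N t₂ ≡ N t₁ + e₁
      N₃    : N t₀ + k ≡ N t₂ + e₂
      cost₀ : Cost d e₀ c₀
      cost₁ : Cost d e₁ c₁
      cost₂ : Cost d e₂ c₂
      total : c₀ + (c₁ + c₂) ≡ 3

  1≤d : 1 ≤ d
  1≤d = ≤-trans (s≤s z≤n) 2≤d

  -- The costs of the three runs bound the deficit by 3 from above, and `deficit≥3` bounds it from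
  -- below.
  arcs-tight : ∀ {t₀ t₁ t₂} → Cuts t₀ t₁ t₂ → Shape t₀ t₁ t₂ → Tight (arcs t₀ t₁ t₂)
  arcs-tight {t₀} {t₁} {t₂} C S = ≤-antisym upper (deficit≥3 d 1≤d h (V-label-periodic g))
    where
    open Cuts C
    open Shape S
    open ≤-Reasoning
    g = arcs t₀ t₁ t₂
    h = λ i → g (V i)
    run : ∀ {a p q e c} → Arc g a p q → p ≤ q → N q ≡ N p + e → Cost d e c →
      Σ< e (λ o → deficit d h (N p + o)) ≤ c
    run {a} {p} {q} {e} {c} A p≤q Nq cost = run-cost d h a (N p) e c 1≤d cost
      (λ o o<e → Arc.index-inside A (N p + o) (m≤m+n (N p) o) (subst (N p + o <_) (sym Nq) (+-monoʳ-< (N p) o<e)))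
      (λ o e≤o o<k → Arc.index-outside A (N p + o) (subst (_≤ N p + o) (sym Nq) (+-monoʳ-≤ (N p) e≤o)) (+-monoʳ-<
          (N p) o<k) p≤q)
    k≡ : k ≡ e₀ + (e₁ + e₂)
    k≡ = +-cancelˡ-≡ (N t₀) _ _ (begin-equality
      N t₀ + k                  ≡⟨ N₃ ⟩
      N t₂ + e₂                 ≡⟨ cong (_+ e₂) (trans N₂ (cong (_+ e₁) N₁)) ⟩
      N t₀ + e₀ + e₁ + e₂       ≡⟨ reassoc (N t₀) e₀ e₁ e₂ ⟩
      N t₀ + (e₀ + (e₁ + e₂))   ∎)
      where
      reassoc : ∀ a b c d → a + b + c + d ≡ a + (b + (c + d))
      reassoc = solve-∀
    upper : Σ< k (deficit d h) ≤ 3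
    upper = begin
      Σ< k (deficit d h)
        ≡⟨ sym (Σ<-rotate k (deficit d h) (deficit-periodic k d (V-label-periodic g)) (N t₀)) ⟩
      Σ< k f
        ≡⟨ cong (λ l → Σ< l f) k≡ ⟩
      Σ< (e₀ + (e₁ + e₂)) f
        ≡⟨ trans (Σ<-split e₀ (e₁ + e₂) f) (cong (Σ< e₀ f +_) (Σ<-split e₁ e₂ (λ i → f (e₀ + i)))) ⟩
      Σ< e₀ f + (Σ< e₁ (λ i → f (e₀ + i)) + Σ< e₂ (λ i → f (e₀ + (e₁ + i))))
        ≡⟨ cong (Σ< e₀ f +_) (cong₂ _+_
             (Σ<-cong e₁ (λ i _ → cong (deficit d h) (trans (sym (+-assoc (N t₀) e₀ i)) (cong (_+ i) (sym N₁)))))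
             (Σ<-cong e₂ (λ i _ → cong (deficit d h) (trans (reassoc (N t₀) e₀ e₁ i) (cong (_+ i) (sym (trans N₂ (cong
                 (_+ e₁) N₁)))))))) ⟩
      Σ< e₀ f + (Σ< e₁ (λ i → deficit d h (N t₁ + i)) + Σ< e₂ (λ i → deficit d h (N t₂ + i)))
        ≤⟨ +-mono-≤ (run (arc₀ C) t₀≤t₁ N₁ cost₀) (+-mono-≤ (run (arc₁ C) t₁≤t₂ N₂ cost₁)
             (run (arc₂ C) t₂≤t₀+m (trans (N-per t₀) N₃) cost₂)) ⟩
      c₀ + (c₁ + c₂)
        ≡⟨ total ⟩
      3 ∎
      where
      f = λ i → deficit d h (N t₀ + i)
      reassoc : ∀ a b c d → a + (b + (c + d)) ≡ a + b + c + d
      reassoc = solve-∀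

  arcs-good : ∀ {t₀ t₁ t₂} → Cuts t₀ t₁ t₂ → Shape t₀ t₁ t₂ → Good (arcs t₀ t₁ t₂)
  arcs-good C S = good (arcs-decomposition C) (arcs-tight C S)

-- Tight partitions into arcs

≤⇒∃+ : ∀ {a b} → a ≤ b → ∃ λ c → b ≡ a + c
≤⇒∃+ {a} {b} p = b ∸ a , sym (m+[n∸m]≡n p)

-- An arc with exactly `d` marked vertices leaves `d + 1` for the other two, and every way of
-- sharing them costs 2: either both get some and hence at most `d`, or one gets all.
split-cost : ∀ d e e′ → e + e′ ≡ suc d → ∃₂ λ c c′ → Cost d e c × Cost d e′ c′ × c + c′ ≡ 2
split-cost d zero    e′ refl = 0 , 2 , none , long , refl
split-cost d (suc e) zero eq with refl ← trans (sym (+-identityʳ (suc e))) eq = 2 , 0 , long , none , refl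
split-cost d (suc e) (suc e′) eq = 1 , 1 ,
  short (≤-trans (≤-trans (s≤s (m≤m+n e e′)) (≤-reflexive (sym (+-suc e e′)))) (≤-reflexive (suc-injective eq))) ,
  short (≤-trans (m≤n+m (suc e′) e) (≤-reflexive (suc-injective eq))) , refl

+-shuffle : ∀ a b c e → a + b + (c + e) ≡ a + c + b + e
+-shuffle = solve-∀

+-half : ∀ a b → a + suc (2 * b) ≡ a + b + suc b
+-half = solve-∀

module Slides {n} {G : Graph n} {m d : ℕ} (F : Frame G m d) where
  open FrameProperties F
  open ≡-Reasoning

  -- The two tight partitions into arcs obtained by putting z x at the end of the first
  -- arc or at the beginning of the second one.
  record Slide (t₀ x t₂ : ℕ) : Set where
    constructor slide
    field
      t₀≤x    : t₀ ≤ x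
      x<t₂    : x < t₂
      t₂≤t₀+m : t₂ ≤ t₀ + m
      upper   : Shape t₀ (suc x) t₂
      lower   : Shape t₀ x t₂

    cuts-upper : Cuts t₀ (suc x) t₂
    cuts-upper = cuts (≤-trans t₀≤x (n≤1+n x)) x<t₂ t₂≤t₀+m

    cuts-lower : Cuts t₀ x t₂
    cuts-lower = cuts t₀≤x (<⇒≤ x<t₂) t₂≤t₀+m

  -- `s (N x) ≢ x` says that no marked vertex is visited at time `x`, so moving `z x` leaves the
  -- three counts unchanged.
  slide-nonv : ∀ {t₀ x t₂} → s (N x) ≢ x → t₀ ≤ x → x < t₂ → t₂ ≤ t₀ + m → Shape t₀ x t₂ → Slide t₀ x t₂
  slide-nonv {t₀} {x} {t₂} nv p q r S = slide p q r
    (shape (trans (N-suc-≢ x nv) N₁) (trans N₂ (cong (_+ e₁) (sym (N-suc-≢ x nv)))) N₃ cost₀ cost₁ cost₂ total) S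
    where open Shape S

  nonv<s : ∀ {x} → s (N x) ≢ x → x < s (N x)
  nonv<s {x} nv = ≤∧≢⇒< (N-upper x) (nv ∘ sym)

  -- The right end is chosen so that the middle arc has exactly `d` marked vertices. By `split-cost`
  -- the start `t` is then free.
  slide-nonv-left : ∀ {t x} → s (N x) ≢ x → t ≤ x → s (N x + d) ≤ t + m → Slide t x (s (N x + d))
  slide-nonv-left {t} {x} nv t≤x t₂≤t+m
    with e₀ , E₀ ← ≤⇒∃+ (N-mono t≤x)
    with e₂ , E₂ ← ≤⇒∃+ (≤-trans (≤-reflexive (sym (N-s (N x + d)))) (≤-trans (N-mono t₂≤t+m) (≤-reflexive (N-per t))))
    with c₀ , c₂ , C₀ , C₂ , C≡ ← split-cost d e₀ e₂ (+-cancelˡ-≡ (N t + d) _ _ (begin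
      N t + d + (e₀ + e₂)   ≡⟨ +-shuffle (N t) d e₀ e₂ ⟩
      N t + e₀ + d + e₂     ≡⟨ cong (λ l → l + d + e₂) (sym E₀) ⟩
      N x + d + e₂          ≡⟨ sym E₂ ⟩
      N t + suc (2 * d)     ≡⟨ +-half (N t) d ⟩
      N t + d + suc d       ∎))
    = slide-nonv nv t≤x (≤-trans (nonv<s nv) (s-mono-≤ (m≤m+n (N x) d))) t₂≤t+m
        (shape E₀ (N-s (N x + d)) (trans E₂ (cong (_+ e₂) (sym (N-s (N x + d))))) C₀ (short ≤-refl) C₂
          (trans (+-comm c₀ (1 + c₂)) (cong suc (trans (+-comm c₂ c₀) C≡))))

  -- Here the first arc has exactly `d` marked vertices, which leaves the end `t₂` free.
  slide-nonv-right : ∀ {j x t₂} → s (N x) ≢ x → N x ≡ j + d → x < t₂ → t₂ ≤ s j + m → Slide (s j) x t₂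
  slide-nonv-right {j} {x} {t₂} nv Nx x<t₂ t₂≤t₀+m
    with e₁ , E₁ ← ≤⇒∃+ (N-mono (<⇒≤ x<t₂))
    with e₂ , E₂ ← ≤⇒∃+ (≤-trans (N-mono t₂≤t₀+m) (≤-reflexive (N-per (s j))))
    with c₁ , c₂ , C₁ , C₂ , C≡ ← split-cost d e₁ e₂ (+-cancelˡ-≡ (j + d) _ _ (begin
      j + d + (e₁ + e₂)   ≡⟨ sym (+-assoc (j + d) e₁ e₂) ⟩
      j + d + e₁ + e₂     ≡⟨ cong (λ l → l + e₁ + e₂) (sym Nx) ⟩
      N x + e₁ + e₂       ≡⟨ cong (_+ e₂) (sym E₁) ⟩
      N t₂ + e₂           ≡⟨ sym E₂ ⟩
      N (s j) + k         ≡⟨ cong (_+ k) (N-s j) ⟩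
      j + suc (2 * d)     ≡⟨ +-half j d ⟩
      j + d + suc d       ∎))
    = slide-nonv nv (<⇒≤ (<N⇒s< x j (subst (j <_) (sym Nx) (m<m+n j 1≤d)))) x<t₂ t₂≤t₀+m
        (shape (trans Nx (cong (_+ d) (sym (N-s j)))) E₁ E₂ (short ≤-refl) C₁ C₂ (cong suc C≡))

  -- The moving vertex is marked; `i` marked vertices precede it in the first arc, `j` follow it in
  -- the second and `e₂` lie in the third. The move takes the counts from `(i + 1, j, e₂)` to
  -- `(i, j + 1, e₂)`, and both triples must cost 3.
  module _ {t₀ i j e₂ t₂ : ℕ} (t₀≤x : t₀ ≤ s (N t₀ + i)) (x<t₂ : s (N t₀ + i) < t₂) (t₂≤t₀+m : t₂ ≤ t₀ + m)
           (Nt₂ : N t₂ ≡ suc (N t₀ + i) + j) (i+j+e₂ : i + j + e₂ ≡ 2 * d) where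

    private
      p : ℕ
      p = N t₀ + i
      U₁ : N (suc (s p)) ≡ N t₀ + suc i
      U₁ = trans (N-suc-s p) (sym (+-suc (N t₀) i))
      U₂ : N t₂ ≡ N (suc (s p)) + j
      U₂ = trans Nt₂ (cong (_+ j) (sym (N-suc-s p)))
      L₂ : N t₂ ≡ N (s p) + suc j
      L₂ = trans Nt₂ (trans (sym (+-suc p j)) (cong (_+ suc j) (sym (N-s p))))
      T : N t₀ + k ≡ N t₂ + e₂
      T = trans (cong (λ l → N t₀ + suc l) (sym i+j+e₂)) (trans (shuffle (N t₀) i j e₂) (cong (_+ e₂) (sym Nt₂)))
        where
        shuffle : ∀ a i j e → a + suc (i + j + e) ≡ suc (a + i) + j + e
        shuffle = solve-∀

    slide-v : suc i ≤ d → suc j ≤ d → e₂ ≤ d → Slide t₀ (s p) t₂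
    slide-v i<d j<d e₂≤d = slide t₀≤x x<t₂ t₂≤t₀+m
      (shape U₁ U₂ T (short i<d) (short (<⇒≤ j<d)) (short e₂≤d) refl)
      (shape (N-s p) L₂ T (short (<⇒≤ i<d)) (short j<d) (short e₂≤d) refl)

    -- The counts go from `(d + 1, 0, d)` to `(d, 1, d)`.
    slide-v-left : i ≡ d → j ≡ 0 → e₂ ≡ d → Slide t₀ (s p) t₂
    slide-v-left refl refl refl = slide t₀≤x x<t₂ t₂≤t₀+m
      (shape U₁ U₂ T long none (short ≤-refl) refl)
      (shape (N-s p) L₂ T (short ≤-refl) (short 1≤d) (short ≤-refl) refl)

    -- The counts go from `(1, d, d)` to `(0, d + 1, d)`.
    slide-v-right : i ≡ 0 → j ≡ d → e₂ ≡ d → Slide t₀ (s p) t₂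
    slide-v-right refl refl refl = slide t₀≤x x<t₂ t₂≤t₀+m
      (shape U₁ U₂ T (short 1≤d) (short ≤-refl) (short ≤-refl) refl)
      (shape (N-s p) L₂ T none long (short ≤-refl) refl)

  <-k⇒s< : ∀ {t j} → j < N t + k → s j < t + m
  <-k⇒s< {t} {j} p = <N⇒s< (t + m) j (subst (j <_) (sym (N-per t)) p)

  -- For a marked vertex the number `i ≤ d` of marked vertices before it decides where the second
  -- arc ends. At the extremes `i = 0` and `i = d` one of the two counts of the first arc needs
  -- special treatment, which leaves `j = d` and `j = 0` respectively.
  slide-left : ∀ {t x} → t ≤ x → x < t + m → N x ≤ N t + d → ∃ (Slide t x)
  slide-left {t} {x} t≤x x<t+m few with s (N x) ≟ x
  ... | no nv = s (N x + d) , slide-nonv-left nv t≤x (<⇒≤ (<-k⇒s< (≤-trans (s≤s (+-monoˡ-≤ d few)) (≤-reflexive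
      (shuffle (N t) d)))))
    where
    shuffle : ∀ a d → suc (a + d + d) ≡ a + suc (2 * d)
    shuffle = solve-∀
  ... | yes v with ≤⇒∃+ (N-mono t≤x)
  ...   | i , E = t₂ , subst (λ l → Slide t l t₂) x≡ S
    where
    x≡ : s (N t + i) ≡ x
    x≡ = trans (cong s (sym E)) v
    t≤x′ : t ≤ s (N t + i)
    t≤x′ = subst (t ≤_) (sym x≡) t≤x
    i≤d : i ≤ d
    i≤d = +-cancelˡ-≤ (N t) i d (≤-trans (≤-reflexive (sym E)) few)
    right : ∀ j → ℕ
    right j = s (suc (N t + i) + j)
    ends : ∀ j → i + j < 2 * d → right j ≤ t + m
    ends j p = <⇒≤ (<-k⇒s< (≤-trans (s≤s (≤-reflexive (shuffle (N t) i j))) (≤-trans (≤-reflexive (sym (+-suc (N t)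
        (suc (i + j))))) (+-monoʳ-≤ (N t) (s≤s p)))))
      where
      shuffle : ∀ a i j → suc (a + i) + j ≡ a + suc (i + j)
      shuffle = solve-∀
    begins : ∀ j → s (N t + i) < right j
    begins j = s-mono-< (s≤s (m≤m+n (N t + i) j))
    choice : Σ ℕ (Slide t (s (N t + i)))
    choice with i ≟ 0 | i ≟ d
    ... | yes refl | _ = right d , slide-v-right t≤x′ (begins d) (ends d (≤-trans (m<m+n d 1≤d) (≤-reflexive (cong
        (d +_) (sym (+-identityʳ d))))))
                           (N-s _) (cong (d +_) (sym (+-identityʳ d))) refl refl refl
    ... | no _ | yes refl = suc (s (N t + i)) , slide-v-left t≤x′ ≤-refl (subst (λ l → suc l ≤ t + m) (sym x≡) x<t+m)
                           (trans (N-suc-s (N t + i)) (sym (+-identityʳ (suc (N t + i))))) (trans (cong (_+ d)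
                               (+-identityʳ d)) (cong (d +_) (sym (+-identityʳ d)))) refl refl refl
    -- In between, `j = d - 1`; the third arc gets `d + 1 - i` marked vertices, at most `d` because
    -- `i ≥ 1`.
    ... | no i≢0 | no i≢d with ≤⇒∃+ (n≢0⇒n>0 i≢0) | ≤⇒∃+ (≤∧≢⇒< i≤d i≢d)
    ...   | i′ , refl | e , refl = right (suc (i′ + e)) , slide-v t≤x′ (begins _) (ends (suc (i′ + e)) (≤-trans
        (m≤m+n _ (suc e)) (≤-reflexive (arith₁ i′ e))))
               (N-s _) (arith₂ i′ e) (m≤m+n (suc (suc i′)) e) ≤-refl (≤-trans (s≤s (m≤n+m (suc e) i′)) (≤-reflexive
                   (arith₃ i′ e)))
      where
      arith₁ : ∀ i e → suc (suc i + suc (i + e)) + suc e ≡ 2 * (suc (suc i) + e)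
      arith₁ = solve-∀
      arith₂ : ∀ i e → suc i + suc (i + e) + suc (suc e) ≡ 2 * (suc (suc i) + e)
      arith₂ = solve-∀
      arith₃ : ∀ i e → suc (i + suc e) ≡ suc (suc i) + e
      arith₃ = solve-∀
    t₂ = proj₁ choice
    S = proj₂ choice

  -- The mirror image of `slide-left`: the right end is given and the start is chosen. `d ≤ N x`
  -- leaves room to go back by `d` indices without reaching negative ones.
  slide-right : ∀ {x t₂} → d ≤ N x → x < t₂ → t₂ ≤ x + m → N t₂ ≤ N x + suc d → ∃ λ t₀ → Slide t₀ x t₂
  slide-right {x} {t₂} d≤Nx x<t₂ t₂≤x+m few with ≤⇒∃+ d≤Nx | s (N x) ≟ x
  ... | b , Nx | no nv = s b , slide-nonv-right nv (trans Nx (+-comm d b)) x<t₂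
    (≤-trans (N≤⇒≤s (≤-trans few (≤-reflexive (trans (cong (_+ suc d) Nx) (shuffle d b))))) (≤-reflexive (s-per b)))
    where
    shuffle : ∀ d b → d + b + suc d ≡ b + suc (2 * d)
    shuffle = solve-∀
  ... | b , Nx | yes v with ≤⇒∃+ {suc (N x)} {N t₂} (s<⇒<N (subst (_< t₂) (sym v) x<t₂))
  ...   | j , E = choice
    where
    j≤d : j ≤ d
    j≤d = +-cancelˡ-≤ (suc (N x)) j d (≤-trans (≤-reflexive (sym E)) (≤-trans few (≤-reflexive (+-suc (N x) d))))
    at : ∀ i l → N x ≡ l + i → s (N (s l) + i) ≡ x
    at i l Nx≡ = trans (cong s (trans (cong (_+ i) (N-s l)) (sym Nx≡))) v
    begins : ∀ i l → s l ≤ s (N (s l) + i)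
    begins i l = s-mono-≤ (≤-trans (m≤m+n l i) (≤-reflexive (cong (_+ i) (sym (N-s l)))))
    before : ∀ i l → N x ≡ l + i → s (N (s l) + i) < t₂
    before i l Nx≡ = subst (_< t₂) (sym (at i l Nx≡)) x<t₂
    ends : ∀ i l → N x ≡ l + i → i + j ≤ 2 * d → t₂ ≤ s l + m
    ends i l Nx≡ p = ≤-trans (N≤⇒≤s (≤-trans (≤-reflexive (trans E (trans (cong (λ q → suc q + j) Nx≡)
        (shuffle l i j)))) (+-monoʳ-≤ l (s≤s p))))
                             (≤-reflexive (s-per l))
      where
      shuffle : ∀ l i j → suc (l + i) + j ≡ l + suc (i + j)
      shuffle = solve-∀
    counts : ∀ i l → N x ≡ l + i → N t₂ ≡ suc (N (s l) + i) + j
    counts i l Nx≡ = trans E (cong (λ q → suc q + j) (trans Nx≡ (cong (_+ i) (sym (N-s l)))))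
    back : ∀ i l → N x ≡ l + i → Slide (s l) (s (N (s l) + i)) t₂ → ∃ λ t₀ → Slide t₀ x t₂
    back i l Nx≡ S = s l , subst (λ y → Slide (s l) y t₂) (at i l Nx≡) S
    choice : ∃ λ t₀ → Slide t₀ x t₂
    choice with j ≟ 0 | j ≟ d
    ... | yes refl | _ = back d b (trans Nx (+-comm d b)) (slide-v-left (begins d b) (before d b Nx′) (ends d b Nx′
        (≤-trans (≤-reflexive (+-identityʳ d)) (m≤m+n d (d + 0))))
            (counts d b Nx′) (trans (cong (_+ d) (+-identityʳ d)) (cong (d +_) (sym (+-identityʳ d)))) refl refl refl)
      where Nx′ = trans Nx (+-comm d b)
    ... | no _ | yes refl = back 0 (N x) Nx′ (slide-v-right (begins 0 (N x)) (before 0 (N x) Nx′) (ends 0 (N x) Nx′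
        (m≤m+n d (d + 0)))
            (counts 0 (N x) Nx′) (cong (d +_) (sym (+-identityʳ d))) refl refl refl)
      where Nx′ = sym (+-identityʳ (N x))
    ... | no j≢0 | no j≢d with ≤⇒∃+ (n≢0⇒n>0 j≢0) | ≤⇒∃+ (≤∧≢⇒< j≤d j≢d)
    ...   | j′ , refl | e , refl = back (suc (j′ + e)) (suc b) Nx′
            (slide-v (begins _ (suc b)) (before _ (suc b) Nx′) (ends _ (suc b) Nx′ (≤-trans (m≤m+n _ (suc (suc e)))
                (≤-reflexive (arith₂ j′ e))))
              (counts _ (suc b) Nx′) (arith₂ j′ e) ≤-refl (m≤m+n (suc (suc j′)) e) (≤-trans (s≤s (m≤n+m (suc e) j′))
                  (≤-reflexive (arith₃ j′ e))))
      where
      arith₁ : ∀ b i e → suc (suc i) + e + b ≡ suc b + suc (i + e)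
      arith₁ = solve-∀
      Nx′ : N x ≡ suc b + suc (j′ + e)
      Nx′ = trans Nx (arith₁ b j′ e)
      arith₂ : ∀ i e → suc (i + e) + suc i + suc (suc e) ≡ 2 * (suc (suc i) + e)
      arith₂ = solve-∀
      arith₃ : ∀ i e → suc (i + suc e) ≡ suc (suc i) + e
      arith₃ = solve-∀

  -- An instance of `slide-v` with `i = e`, `j = d - 1` and `e₂ = d + 1 - e`.
  slide-chord : ∀ q e → 1 ≤ e → e < d → Slide (s q) (s (q + e)) (s (q + e + d))
  slide-chord q e 1≤e e<d with ≤⇒∃+ 1≤e | ≤⇒∃+ e<d
  ... | e′ , refl | f , refl = subst (λ l → Slide (s q) (s (l + e)) (s (q + e + d))) (N-s q)
    (slide-v (≤-trans (s-mono-≤ (m≤m+n q e)) (≤-reflexive (cong (λ l → s (l + e)) (sym (N-s q)))))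
      (s-mono-< (≤-trans (≤-reflexive (cong (λ l → suc (l + e)) (N-s q))) (m<m+n (q + e) 1≤d)))
      (≤-trans (s-mono-≤ (≤-trans (m≤m+n (q + e + d) (suc (suc f))) (≤-reflexive (arith₁ q e′ f)))) (≤-reflexive
          (s-per q)))
      (trans (N-s _) (trans (arith₂ q e′ f) (cong (λ l → suc (l + e) + suc (e′ + f)) (sym (N-s q)))))
      (arith₃ e′ f) e<d ≤-refl (≤-trans (s≤s (m≤n+m (suc f) e′)) (≤-reflexive (arith₄ e′ f))))
    where
    arith₁ : ∀ q e′ f → q + suc e′ + (suc (suc e′) + f) + suc (suc f) ≡ q + suc (2 * (suc (suc e′) + f))
    arith₁ = solve-∀
    arith₂ : ∀ q e′ f → q + suc e′ + (suc (suc e′) + f) ≡ suc (q + suc e′) + suc (e′ + f)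
    arith₂ = solve-∀
    arith₃ : ∀ e′ f → suc e′ + suc (e′ + f) + suc (suc f) ≡ 2 * (suc (suc e′) + f)
    arith₃ = solve-∀
    arith₄ : ∀ e′ f → suc (e′ + suc f) ≡ suc (suc e′) + f
    arith₄ = solve-∀

  -- The same slide with `V q` moved into the third arc, which then holds `d + 2 - e` marked
  -- vertices; this is at most `d` only for `e ≥ 2`. The chords of length 1 thus escape.
  slide-chord-suc : ∀ q e → 2 ≤ e → e < d → Slide (suc (s q)) (s (q + e)) (s (q + e + d))
  slide-chord-suc q e 2≤e e<d with ≤⇒∃+ 2≤e | ≤⇒∃+ e<d
  ... | e′ , refl | f , refl = subst (λ l → Slide (suc (s q)) (s l) (s (q + e + d))) Nq+
    (slide-v (≤-trans (s-mono-< (m<m+n q (s≤s z≤n))) (≤-reflexive (cong s (sym Nq+))))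
      (s-mono-< (≤-trans (≤-reflexive (cong suc Nq+)) (m<m+n (q + e) 1≤d)))
      (≤-trans (s-mono-≤ (≤-trans (m≤m+n (q + e + d) (suc (suc f))) (≤-reflexive (arith₁ q e′ f)))) (≤-trans
          (≤-reflexive (s-per q)) (n≤1+n _)))
      (trans (N-s _) (trans (arith₂ q e′ f) (cong (λ l → suc l + suc (suc (e′ + f))) (sym Nq+))))
      (arith₃ e′ f) (<⇒≤ e<d) ≤-refl (≤-trans (s≤s (s≤s (m≤n+m (suc f) e′))) (≤-reflexive (arith₄ e′ f))))
    where
    Nq+ : N (suc (s q)) + suc e′ ≡ q + e
    Nq+ = trans (cong (_+ suc e′) (N-suc-s q)) (sym (+-suc q (suc e′)))
    arith₁ : ∀ q e′ f → q + suc (suc e′) + (suc (suc (suc e′)) + f) + suc (suc f) ≡ q + suc (2 * (suc (suc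
        (suc e′)) + f))
    arith₁ = solve-∀
    arith₂ : ∀ q e′ f → q + suc (suc e′) + (suc (suc (suc e′)) + f) ≡ suc (q + suc (suc e′)) + suc (suc (e′ + f))
    arith₂ = solve-∀
    arith₃ : ∀ e′ f → suc e′ + suc (suc (e′ + f)) + suc (suc (suc f)) ≡ 2 * (suc (suc (suc e′)) + f)
    arith₃ = solve-∀
    arith₄ : ∀ e′ f → suc (suc (e′ + suc f)) ≡ suc (suc (suc e′)) + f
    arith₄ = solve-∀

  -- `V (q + d)` moves between being the last of `d + 1` marked vertices in one arc and being a
  -- block of its own.
  slide-half : ∀ q → Slide (s q) (s (q + d)) (suc (s (q + d)))
  slide-half q = subst (λ l → Slide (s q) (s (l + d)) (suc (s (q + d)))) (N-s q)
    (slide-v-left (s-mono-≤ (≤-trans (m≤m+n q d) (≤-reflexive q+d)))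
      (s≤s (≤-reflexive (cong s (sym q+d))))
      (≤-trans (s-mono-< (+-monoʳ-< q (s≤s (m≤m+n d (d + 0))))) (≤-reflexive (s-per q)))
      (trans (N-suc-s (q + d)) (trans (cong suc q+d) (sym (+-identityʳ _))))
      (trans (cong (_+ d) (+-identityʳ d)) (cong (d +_) (sym (+-identityʳ d)))) refl refl refl)
    where
    q+d : q + d ≡ N (s q) + d
    q+d = cong (_+ d) (sym (N-s q))

-- Coefficients of a functional vanishing on the tight decompositions

p≡p+q⇒q≡0 : ∀ p q → p ≡ p ℚ.+ q → q ≡ 0ℚ
p≡p+q⇒q≡0 p q e = begin
  q                   ≡⟨ solve 2 (λ a b → b := (a :+ b) :- a) refl p q ⟩
  (p ℚ.+ q) ℚ.- p     ≡⟨ cong (ℚ._- p) (sym e) ⟩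
  p ℚ.- p             ≡⟨ ℚₚ.+-inverseʳ p ⟩
  0ℚ                  ∎
  where open ≡-Reasoning

ind : ∀ {n} → (Fin n → ℕ) → Fin n → Fin n → ℚ
ind g a b = ⟦ g a ≟ g b ⟧

ind-≡ : ∀ {n} (g : Fin n → ℕ) {a b} → g a ≡ g b → ind g a b ≡ 1ℚ
ind-≡ g {a} {b} = ⟦⟧-yes (g a ≟ g b)

ind-≢ : ∀ {n} (g : Fin n → ℕ) {a b} → g a ≢ g b → ind g a b ≡ 0ℚ
ind-≢ g {a} {b} = ⟦⟧-no (g a ≟ g b)

module Weights {n} (γ : Fin n → Fin n → ℚ) (γ-sym : ∀ a b → γ a b ≡ γ b a) (γ-diag : ∀ a → γ a a ≡ 0ℚ) where
  open ≡-Reasoning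

  mass : Fin n → (Fin n → ℚ) → ℚ
  mass a f = sumℚ (λ b → γ a b ℚ.* f b)

  row : (Fin n → ℕ) → Fin n → ℚ
  row g a = mass a (ind g a)

  -- Every pair inside a block counts twice, once in the row of each of its ends.
  weight : (Fin n → ℕ) → ℚ
  weight g = sumℚ (row g)

  mass-cong : ∀ a {f f′ : Fin n → ℚ} → (∀ y → f y ≡ f′ y) → mass a f ≡ mass a f′
  mass-cong a e = sum-cong (λ y → cong (γ a y ℚ.*_) (e y))

  mass-δ : ∀ a b {f : Fin n → ℚ} → (∀ y → f y ≡ δ b y) → mass a f ≡ γ a b
  mass-δ a b e = trans (mass-cong a e) (sum-δ (γ a) b)

  mass-+δ : ∀ a b {f f′ : Fin n → ℚ} → (∀ y → f y ≡ f′ y ℚ.+ δ b y) → mass a f ≡ mass a f′ ℚ.+ γ a b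
  mass-+δ a b {f} {f′} e = begin
    sumℚ (λ y → γ a y ℚ.* f y)
      ≡⟨ sum-cong (λ y → trans (cong (γ a y ℚ.*_) (e y)) (ℚₚ.*-distribˡ-+ (γ a y) (f′ y) (δ b y))) ⟩
    sumℚ (λ y → γ a y ℚ.* f′ y ℚ.+ γ a y ℚ.* δ b y)
      ≡⟨ sum-+ (λ y → γ a y ℚ.* f′ y) (λ y → γ a y ℚ.* δ b y) ⟩
    mass a f′ ℚ.+ sumℚ (λ y → γ a y ℚ.* δ b y)
      ≡⟨ cong (mass a f′ ℚ.+_) (sum-δ (γ a) b) ⟩
    mass a f′ ℚ.+ γ a b ∎

  -- Relabelling only `a` changes the matrix only in the row and the column of `a`. These have equal
  -- sums by symmetry, so the weights differ by twice the difference of the rows.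
  row-move : ∀ g g′ a → (∀ x → x ≢ a → g x ≡ g′ x) → weight g ≡ weight g′ → row g a ≡ row g′ a
  row-move g g′ a agree-off W≡ = begin
    row g a                            ≡⟨ solve 2 (λ p q → p := (p :- q) :+ q) refl (row g a) (row g′ a) ⟩
    (row g a ℚ.- row g′ a) ℚ.+ row g′ a ≡⟨ cong (ℚ._+ row g′ a) (trans (sym R≡) R≡0) ⟩
    0ℚ ℚ.+ row g′ a                    ≡⟨ ℚₚ.+-identityˡ (row g′ a) ⟩
    row g′ a                           ∎
    where
    H : Fin n → Fin n → ℚ
    H x y = γ x y ℚ.* ind g x y ℚ.- γ x y ℚ.* ind g′ x y
    R : ℚ
    R = sumℚ (H a)
    R≡ : R ≡ row g a ℚ.- row g′ a
    R≡ = sum-- (λ y → γ a y ℚ.* ind g a y) (λ y → γ a y ℚ.* ind g′ a y)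
    ind-sym : ∀ g x y → ind g x y ≡ ind g y x
    ind-sym g x y = ⟦⟧-cong (g x ≟ g y) (g y ≟ g x) sym sym
    H-sym : ∀ x y → H x y ≡ H y x
    H-sym x y = cong₂ ℚ._-_ (cong₂ ℚ._*_ (γ-sym x y) (ind-sym g x y)) (cong₂ ℚ._*_ (γ-sym x y) (ind-sym g′ x y))
    Haa : H a a ≡ 0ℚ
    Haa = trans (cong (λ c → c ℚ.* ind g a a ℚ.- c ℚ.* ind g′ a a) (γ-diag a))
      (solve 2 (λ p q → con 0ℚ :* p :- con 0ℚ :* q := con 0ℚ) refl (ind g a a) (ind g′ a a))
    -- The entry where row and column meet is counted twice on the right, which is harmless because
    -- it is 0.
    cross : ∀ x y → H x y ≡ H a y ℚ.* δ a x ℚ.+ H x a ℚ.* δ a y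
    cross x y with a Finₚ.≟ x | a Finₚ.≟ y
    ... | yes refl | yes refl = trans Haa (sym (cong₂ (λ p q → p ℚ.* 1ℚ ℚ.+ q ℚ.* 1ℚ) Haa Haa))
    ... | yes refl | no _     = solve 2 (λ p q → p := p :* con 1ℚ :+ q :* con 0ℚ) refl (H a y) (H a a)
    ... | no _     | yes refl = solve 2 (λ p q → q := p :* con 0ℚ :+ q :* con 1ℚ) refl (H a a) (H x a)
    ... | no a≢x   | no a≢y   = trans
      (trans (cong (λ i → γ x y ℚ.* i ℚ.- γ x y ℚ.* ind g′ x y)
               (⟦⟧-cong (g x ≟ g y) (g′ x ≟ g′ y)
                 (λ e → trans (sym (agree-off x (a≢x ∘ sym))) (trans e (agree-off y (a≢y ∘ sym))))
                 (λ e → trans (agree-off x (a≢x ∘ sym)) (trans e (sym (agree-off y (a≢y ∘ sym)))))))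
             (ℚₚ.+-inverseʳ (γ x y ℚ.* ind g′ x y)))
      (solve 2 (λ p q → con 0ℚ := p :* con 0ℚ :+ q :* con 0ℚ) refl (H a y) (H x a))
    R+R : R ℚ.+ R ≡ 0ℚ ℚ.+ 0ℚ
    R+R = begin
      R ℚ.+ R
        ≡⟨ cong₂ ℚ._+_ (sym (sum-δ (λ _ → R) a)) (sum-cong (λ x → trans (H-sym a x) (sym (sum-δ (λ _ → H x a) a)))) ⟩
      sumℚ (λ x → R ℚ.* δ a x) ℚ.+ sumℚ (λ x → sumℚ (λ y → H x a ℚ.* δ a y))
        ≡⟨ cong (ℚ._+ sumℚ (λ x → sumℚ (λ y → H x a ℚ.* δ a y))) (sum-cong (λ x → sum-*ʳ (δ a x) (H a))) ⟩
      sumℚ (λ x → sumℚ (λ y → H a y ℚ.* δ a x)) ℚ.+ sumℚ (λ x → sumℚ (λ y → H x a ℚ.* δ a y))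
        ≡⟨ sym (sum-+ (λ x → sumℚ (λ y → H a y ℚ.* δ a x)) (λ x → sumℚ (λ y → H x a ℚ.* δ a y))) ⟩
      sumℚ (λ x → sumℚ (λ y → H a y ℚ.* δ a x) ℚ.+ sumℚ (λ y → H x a ℚ.* δ a y))
        ≡⟨ sum-cong (λ x → trans (sym (sum-+ (λ y → H a y ℚ.* δ a x) (λ y → H x a ℚ.* δ a y))) (sum-cong (λ y → sym
            (cross x y)))) ⟩
      sumℚ (λ x → sumℚ (λ y → H x y))
        ≡⟨ sum-cong (λ x → sum-- (λ y → γ x y ℚ.* ind g x y) (λ y → γ x y ℚ.* ind g′ x y)) ⟩
      sumℚ (λ x → row g x ℚ.- row g′ x)
        ≡⟨ sum-- (row g) (row g′) ⟩
      weight g ℚ.- weight g′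
        ≡⟨ cong (ℚ._- weight g′) W≡ ⟩
      weight g′ ℚ.- weight g′
        ≡⟨ ℚₚ.+-inverseʳ (weight g′) ⟩
      0ℚ ∎
    R≡0 : R ≡ 0ℚ
    R≡0 = double-injective R+R

-- Blocks of the arc partitions and the relations they yield.

module ArcIndicators {n} {G : Graph n} {m d : ℕ} (F : Frame G m d) where
  open FrameProperties F
  open Slides F

  ind-arc : ∀ {g g′ a a′ p q} → Arc g a p q → Arc g′ a′ p q → ∀ {u} → g u ≡ a → g′ u ≡ a′ →
    ∀ y → ind g u y ≡ ind g′ u y
  ind-arc {g} {g′} A A′ {u} gu g′u y = ⟦⟧-cong (g u ≟ g y) (g′ u ≟ g′ y) (transfer A A′ gu g′u) (transfer A′ A g′u gu)
    where
    transfer : ∀ {g g′ a a′ p q} → Arc g a p q → Arc g′ a′ p q → g u ≡ a → g′ u ≡ a′ → g u ≡ g y → g′ u ≡ g′ y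
    transfer A A′ gu g′u e with Arc.only A y (trans (sym e) gu)
    ... | τ , p≤τ , τ<q , refl = trans g′u (sym (Arc.inside A′ τ p≤τ τ<q))

  ind-arc-snoc : ∀ {g g′ a a′ p q} → Arc g a p (suc q) → Arc g′ a′ p q → p ≤ q → ∀ {u} → g u ≡ a → g′ u ≡ a′ →
    ∀ y → ind g u y ≡ ind g′ u y ℚ.+ δ (z q) y
  ind-arc-snoc {g} {g′} {q = q} A A′ p≤q {u} gu g′u y with z q Finₚ.≟ y
  ... | yes refl = trans (ind-≡ g (trans gu (sym (Arc.inside A q p≤q ≤-refl))))
    (cong (ℚ._+ 1ℚ) (sym (ind-≢ g′ (λ e → Arc.outside A′ q ≤-refl (Arc.q≤p+m A) p≤q (trans (sym e) g′u)))))
  ... | no zq≢y = trans (⟦⟧-cong (g u ≟ g y) (g′ u ≟ g′ y) there back) (sym (ℚₚ.+-identityʳ _))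
    where
    there : g u ≡ g y → g′ u ≡ g′ y
    there e with Arc.only A y (trans (sym e) gu)
    ... | τ , p≤τ , s≤s τ≤q , refl = trans g′u (sym (Arc.inside A′ τ p≤τ (≤∧≢⇒< τ≤q (λ { refl → zq≢y refl }))))
    back : g′ u ≡ g′ y → g u ≡ g y
    back e with Arc.only A′ y (trans (sym e) g′u)
    ... | τ , p≤τ , τ<q , refl = trans gu (sym (Arc.inside A τ p≤τ (≤-trans τ<q (n≤1+n q))))

  ind-arc-cons : ∀ {g g′ a a′ p q} → Arc g a p q → Arc g′ a′ (suc p) q → p < q → ∀ {u} → g u ≡ a → g′ u ≡ a′ →
    ∀ y → ind g u y ≡ ind g′ u y ℚ.+ δ (z p) y
  ind-arc-cons {g} {g′} {p = p} {q} A A′ p<q {u} gu g′u y with z p Finₚ.≟ y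
  -- Counted from the start `suc p` of the shorter arc, `z p` appears at time `p + m`, the last of
  -- the lap.
  ... | yes refl = trans (ind-≡ g (trans gu (sym (Arc.inside A p ≤-refl p<q))))
    (cong (ℚ._+ 1ℚ) (sym (ind-≢ g′ (λ e → Arc.outside A′ (p + m) (Arc.q≤p+m A) ≤-refl p<q (trans (cong g′ (z-per p))
        (trans (sym e) g′u))))))
  ... | no zp≢y = trans (⟦⟧-cong (g u ≟ g y) (g′ u ≟ g′ y) there back) (sym (ℚₚ.+-identityʳ _))
    where
    there : g u ≡ g y → g′ u ≡ g′ y
    there e with Arc.only A y (trans (sym e) gu)
    ... | τ , p≤τ , τ<q , refl = trans g′u (sym (Arc.inside A′ τ (≤∧≢⇒< p≤τ (λ { refl → zp≢y refl })) τ<q))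
    back : g′ u ≡ g′ y → g u ≡ g y
    back e with Arc.only A′ y (trans (sym e) g′u)
    ... | τ , p<τ , τ<q , refl = trans gu (sym (Arc.inside A τ (<⇒≤ p<τ) τ<q))

  arcs-move : ∀ t₀ x t₂ y → x < t₂ → y ≢ z x → arcs t₀ (suc x) t₂ y ≡ arcs t₀ x t₂ y
  arcs-move t₀ x t₂ y x<t₂ y≢zx with locate t₀ y
  ... | no _ = refl
  ... | yes (o , e) with <-cmp (t₀ + toℕ o) x
  ...   | tri< τ<x _ _ = trans (level-0 (suc x) t₂ (≤-trans τ<x (n≤1+n x))) (sym (level-0 x t₂ τ<x))
  ...   | tri≈ _ τ≡x _ = ⊥-elim (y≢zx (trans (sym e) (cong z τ≡x)))
  ...   | tri> _ _ x<τ with (t₀ + toℕ o) <? t₂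
  ...     | yes τ<t₂ = trans (level-1 (suc x) t₂ x<τ τ<t₂) (sym (level-1 x t₂ (<⇒≤ x<τ) τ<t₂))
  ...     | no τ≮t₂  = trans (level-2 (suc x) t₂ x<τ (≮⇒≥ τ≮t₂)) (sym (level-2 x t₂ (<⇒≤ x<τ) (≮⇒≥ τ≮t₂)))

  slide-good-upper : ∀ {t₀ x t₂} → Slide t₀ x t₂ → Good (arcs t₀ (suc x) t₂)
  slide-good-upper S = arcs-good (Slide.cuts-upper S) (Slide.upper S)

  slide-good-lower : ∀ {t₀ x t₂} → Slide t₀ x t₂ → Good (arcs t₀ x t₂)
  slide-good-lower S = arcs-good (Slide.cuts-lower S) (Slide.lower S)

  slide-upper-0 : ∀ {t₀ x t₂} → Slide t₀ x t₂ → arcs t₀ (suc x) t₂ (z x) ≡ 0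
  slide-upper-0 S = Arc.inside (arc₀ (Slide.cuts-upper S)) _ (Slide.t₀≤x S) ≤-refl

  slide-lower-1 : ∀ {t₀ x t₂} → Slide t₀ x t₂ → arcs t₀ x t₂ (z x) ≡ 1
  slide-lower-1 S = Arc.inside (arc₁ (Slide.cuts-lower S)) _ ≤-refl (Slide.x<t₂ S)

  cycle-position : ∀ {y} → OnCycle y → ∀ p → ∃ λ t → p ≤ t × t < p + m × z t ≡ y
  cycle-position (o , e) p with periodic-window m z z-per 0<m p (toℕ o)
  ... | o′ , o′<m , e′ = p + o′ , m≤m+n p o′ , +-monoʳ-< p o′<m , trans e′ e

  Marked : Fin n → Set
  Marked a = ∃ λ i → V i ≡ a

  marked-window : ∀ {a} → Marked a → ∀ p → ∃ λ o → o < k × V (p + o) ≡ a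
  marked-window (i , e) p with periodic-window k V V-per (s≤s z≤n) p i
  ... | o , o<k , e′ = o , o<k , trans e′ e

  marked? : ∀ a → Dec (Marked a)
  marked? a with Finₚ.any? {k} (λ o → V (toℕ o) Finₚ.≟ a)
  ... | yes (o , e) = yes (toℕ o , e)
  ... | no nowhere  = no λ M → let (o , o<k , e) = marked-window M 0 in
    nowhere (Fin.fromℕ< o<k , trans (cong V (Finₚ.toℕ-fromℕ< o<k)) e)

  onCycle? : ∀ a → Dec (OnCycle a)
  onCycle? a = locate 0 a

  d≤k : d ≤ k
  d≤k = ≤-trans (m≤m+n d (d + 0)) (n≤1+n _)

  k≤N : ∀ {x} → m ≤ x → k ≤ N x
  k≤N m≤x = ≤-trans (≤-reflexive (sym N-m)) (N-mono m≤x)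

  module Forcing (γ : Fin n → Fin n → ℚ) (γ-sym : ∀ a b → γ a b ≡ γ b a) (γ-diag : ∀ a → γ a a ≡ 0ℚ)
    (Found : Set) (weigh : ∀ g → Good g → Found ⊎ Weights.weight γ γ-sym γ-diag g ≡ 0ℚ) where
    open Weights γ γ-sym γ-diag

    -- Adjacency is not decidable, so instead of assuming that all tight decompositions have weight 0,
    -- every use of one may stop with a decomposition violating this (Found).
    infixl 1 _>>=_
    _>>=_ : ∀ {a b} {A : Set a} {B : Set b} → Found ⊎ A → (A → Found ⊎ B) → Found ⊎ B
    inj₁ f >>= _ = inj₁ f
    inj₂ a >>= k = k a

    pure : ∀ {a} {A : Set a} → A → Found ⊎ A
    pure = inj₂

    sequence : ∀ {t} {P : Fin t → Set} → (∀ i → Found ⊎ P i) → Found ⊎ (∀ i → P i)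
    sequence {zero}  f = pure (λ ())
    sequence {suc t} f = do
      p  ← f zero
      ps ← sequence (λ i → f (suc i))
      pure (λ { zero → p ; (suc i) → ps i })

    same-weight : ∀ g g′ → Good g → Good g′ → Found ⊎ weight g ≡ weight g′
    same-weight g g′ G G′ = do
      e  ← weigh g G
      e′ ← weigh g′ G′
      pure (trans e (sym e′))

    slide-row : ∀ {t₀ x t₂} → Slide t₀ x t₂ → Found ⊎ row (arcs t₀ (suc x) t₂) (z x) ≡ row (arcs t₀ x t₂) (z x)
    slide-row {t₀} {x} {t₂} S = do
      e ← same-weight _ _ (slide-good-upper S) (slide-good-lower S)
      pure (row-move (arcs t₀ (suc x) t₂) (arcs t₀ x t₂) (z x) (λ y y≢zx → arcs-move t₀ x t₂ y (Slide.x<t₂ S) y≢zx) e)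

    -- In the two lower partitions `z x` lies in the same second arc. In the two upper ones its
    -- block differs just by `z t`, so the two row equations leave only that coefficient.
    zero-left : ∀ {t x t₂} → Slide t x t₂ → Slide (suc t) x t₂ → Found ⊎ γ (z x) (z t) ≡ 0ℚ
    zero-left {t} {x} {t₂} S S′ = do
      e  ← slide-row S
      e′ ← slide-row S′
      pure (p≡p+q⇒q≡0 (row (arcs (suc t) (suc x) t₂) (z x)) (γ (z x) (z t)) (begin
        row (arcs (suc t) (suc x) t₂) (z x)  ≡⟨ e′ ⟩
        row (arcs (suc t) x t₂) (z x)        ≡⟨ mass-cong (z x)
          (ind-arc (arc₁ (Slide.cuts-lower S′)) (arc₁ (Slide.cuts-lower S)) (slide-lower-1 S′) (slide-lower-1 S)) ⟩
        row (arcs t x t₂) (z x)              ≡⟨ sym e ⟩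
        row (arcs t (suc x) t₂) (z x)        ≡⟨ mass-+δ (z x) (z t)
          (ind-arc-cons (arc₀ (Slide.cuts-upper S)) (arc₀ (Slide.cuts-upper S′)) (s≤s (Slide.t₀≤x S))
              (slide-upper-0 S) (slide-upper-0 S′)) ⟩
        row (arcs (suc t) (suc x) t₂) (z x) ℚ.+ γ (z x) (z t) ∎))
      where open ≡-Reasoning

    zero-right : ∀ {t₀ x t} → Slide t₀ x t → Slide t₀ x (suc t) → Found ⊎ γ (z x) (z t) ≡ 0ℚ
    zero-right {t₀} {x} {t} S S′ = do
      e  ← slide-row S
      e′ ← slide-row S′
      pure (p≡p+q⇒q≡0 (row (arcs t₀ x t) (z x)) (γ (z x) (z t)) (begin
        row (arcs t₀ x t) (z x)              ≡⟨ sym e ⟩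
        row (arcs t₀ (suc x) t) (z x)        ≡⟨ mass-cong (z x)
          (ind-arc (arc₀ (Slide.cuts-upper S)) (arc₀ (Slide.cuts-upper S′)) (slide-upper-0 S) (slide-upper-0 S′)) ⟩
        row (arcs t₀ (suc x) (suc t)) (z x)  ≡⟨ e′ ⟩
        row (arcs t₀ x (suc t)) (z x)        ≡⟨ mass-+δ (z x) (z t)
          (ind-arc-snoc (arc₁ (Slide.cuts-lower S′)) (arc₁ (Slide.cuts-lower S)) (<⇒≤ (Slide.x<t₂ S))
              (slide-lower-1 S′) (slide-lower-1 S)) ⟩
        row (arcs t₀ x t) (z x) ℚ.+ γ (z x) (z t) ∎))
      where open ≡-Reasoning

    -- `y` is sought in the lap that ends at time `s (N x + d)`. If it comes before `x`, the start
    -- of the first arc is moved across it; if it comes after `x`, the end of the second arc is. The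
    -- tight arc with exactly `d` marked vertices stays the same in both cases.
    zero-nonv : ∀ x → m ≤ x → s (N x) ≢ x → ∀ y → OnCycle y → y ≢ z x → Found ⊎ γ (z x) y ≡ 0ℚ
    zero-nonv x m≤x nv y on y≢ with ≤⇒∃+ (≤-trans (≤-trans m≤x (N-upper x)) (s-mono-≤ (m≤m+n (N x) d)))
    ... | p , t₂≡ with cycle-position on p
    ...   | t , p≤t , t<p+m , refl with <-cmp t x
    ...     | tri≈ _ refl _ = ⊥-elim (y≢ refl)
    ...     | tri< t<x _ _ = zero-left (slide-nonv-left nv (<⇒≤ t<x) t₂≤t+m) (slide-nonv-left nv t<x (≤-trans t₂≤t+m
        (n≤1+n _)))
      where
      t₂≤t+m : s (N x + d) ≤ t + m
      t₂≤t+m = ≤-trans (≤-reflexive (trans t₂≡ (+-comm m p))) (+-monoˡ-≤ m p≤t)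
    ...     | tri> _ _ x<t with ≤⇒∃+ (≤-trans d≤k (k≤N m≤x))
    ...       | j , Nx = zero-right (slide-nonv-right nv Nx′ x<t (≤-trans (n≤1+n t) t<)) (slide-nonv-right nv Nx′
        (≤-trans x<t (n≤1+n t)) t<)
      where
      Nx′ : N x ≡ j + d
      Nx′ = trans Nx (+-comm d j)
      t< : suc t ≤ s j + m
      t< = ≤-trans t<p+m (≤-trans (≤-reflexive (sym (trans t₂≡ (+-comm m p))))
        (≤-trans (s-mono-≤ (≤-trans (≤-reflexive (cong (_+ d) Nx′)) (≤-trans (n≤1+n _) (≤-reflexive (shuffle j d)))))
            (≤-reflexive (s-per j))))
        where
        shuffle : ∀ j d → suc (j + d + d) ≡ j + suc (2 * d)
        shuffle = solve-∀

    zero-unmarked : ∀ a b → OnCycle a → OnCycle b → ¬ Marked a → Found ⊎ γ a b ≡ 0ℚ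
    zero-unmarked a b a-on b-on a-un with b Finₚ.≟ a | cycle-position a-on m
    ... | yes refl | _ = pure (γ-diag a)
    ... | no b≢a | x , m≤x , _ , refl = zero-nonv x m≤x (λ e → a-un (N x , cong z e)) b b-on b≢a

    zero-chord : ∀ q e → 2 ≤ e → e < d → Found ⊎ γ (V (q + e)) (V q) ≡ 0ℚ
    zero-chord q e 2≤e e<d = zero-left (slide-chord q e (≤-trans (s≤s z≤n) 2≤e) e<d) (slide-chord-suc q e 2≤e e<d)

-- Vertices off the cycle

join : ∀ {n} → (Fin n → ℕ) → Fin n → Fin n → Fin n → ℕ
join g a u x with x Finₚ.≟ a
... | yes _ = g u
... | no  _ = g x

join-≡ : ∀ {n} (g : Fin n → ℕ) a u → join g a u a ≡ g u
join-≡ g a u with a Finₚ.≟ a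
... | yes _ = refl
... | no ne = ⊥-elim (ne refl)

join-≢ : ∀ {n} (g : Fin n → ℕ) {a u x} → x ≢ a → join g a u x ≡ g x
join-≢ g {a} {u} {x} ne with x Finₚ.≟ a
... | yes e = ⊥-elim (ne e)
... | no _  = refl

module _ {n} (g : Fin n → ℕ) {a u : Fin n} (u≢a : u ≢ a) (alone : ∀ y → g a ≡ g y → a ≡ y) where

  ind-join : ∀ w → w ≢ a → g w ≡ g u → ∀ y → ind (join g a u) w y ≡ ind g w y ℚ.+ δ a y
  ind-join w w≢a gw y with a Finₚ.≟ y
  ... | yes refl = trans (ind-≡ (join g a u) {w} {a} (trans (join-≢ g w≢a) (trans gw (sym (join-≡ g a u)))))
    (cong (ℚ._+ 1ℚ) (sym (ind-≢ g (λ e → w≢a (sym (alone w (sym e)))))))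
  ... | no a≢y = trans (⟦⟧-cong (join g a u w ≟ join g a u y) (g w ≟ g y)
      (λ e → trans (sym (join-≢ g w≢a)) (trans e (join-≢ g (a≢y ∘ sym))))
      (λ e → trans (join-≢ g w≢a) (trans e (sym (join-≢ g (a≢y ∘ sym))))))
    (sym (ℚₚ.+-identityʳ _))

  ind-join-leaf : ∀ y → ind (join g a u) a y ≡ ind g u y ℚ.+ δ a y
  ind-join-leaf y = trans
    (⟦⟧-cong (join g a u a ≟ join g a u y) (join g a u u ≟ join g a u y) (trans (sym a~u)) (trans a~u))
    (ind-join u u≢a refl y)
    where
    a~u : join g a u a ≡ join g a u u
    a~u = trans (join-≡ g a u) (sym (join-≢ g u≢a))

  join-decomposition : ∀ {G : Graph n} → Adj G a u → Decomposition G g → Decomposition G (join g a u)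
  join-decomposition {G} a—u dec x y e = by-cases (x Finₚ.≟ a) (y Finₚ.≟ a)
    where
    g⁺ : Fin n → ℕ
    g⁺ = join g a u
    lift : ∀ {x y} → x ≢ a → g x ≡ g y → Star (λ p q → Adj G p q × g⁺ p ≡ g⁺ x × g⁺ q ≡ g⁺ x) x y
    lift {x} {y} x≢a gx≡gy = gmap id (λ { (pq , gp , gq) → pq , relabel gp , relabel gq }) (dec x y gx≡gy)
      where
      relabel : ∀ {p} → g p ≡ g x → g⁺ p ≡ g⁺ x
      relabel {p} gp = trans (join-≢ g (λ { refl → x≢a (sym (alone x gp)) })) (trans gp (sym (join-≢ g x≢a)))
    from-leaf : ∀ {y} → y ≢ a → g⁺ a ≡ g⁺ y → Star (λ p q → Adj G p q × g⁺ p ≡ g⁺ a × g⁺ q ≡ g⁺ a) a y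
    from-leaf {y} y≢a e = (a—u , refl , sym a~u) ◅
      gmap id (λ { (pq , ep , eq′) → pq , trans ep (sym a~u) , trans eq′ (sym a~u) }) (lift u≢a (trans (sym
          (join-≡ g a u)) (trans e (join-≢ g y≢a))))
      where
      a~u : g⁺ a ≡ g⁺ u
      a~u = trans (join-≡ g a u) (sym (join-≢ g u≢a))
    by-cases : Dec (x ≡ a) → Dec (y ≡ a) → Star (λ p q → Adj G p q × g⁺ p ≡ g⁺ x × g⁺ q ≡ g⁺ x) x y
    by-cases (yes refl) (yes refl) = ε
    by-cases (yes refl) (no y≢a)   = from-leaf y≢a e
    by-cases (no x≢a)   (yes refl) = reverse (λ { (pq , ep , eq′) → symm G pq , trans eq′ (sym e) , trans ep
        (sym e) }) (from-leaf x≢a (sym e))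
    by-cases (no x≢a)   (no y≢a)   = lift x≢a (trans (sym (join-≢ g x≢a)) (trans e (join-≢ g y≢a)))

module Leaves {n} {G : Graph n} {m d : ℕ} (F : Frame G m d)
  (γ : Fin n → Fin n → ℚ) (γ-sym : ∀ a b → γ a b ≡ γ b a) (γ-diag : ∀ a → γ a a ≡ 0ℚ)
  (Found : Set) (weigh : ∀ g → FrameProperties.Good F g → Found ⊎ Weights.weight γ γ-sym γ-diag g ≡ 0ℚ) where
  open FrameProperties F
  open Slides F
  open ArcIndicators F
  open Weights γ γ-sym γ-diag
  open Forcing γ γ-sym γ-diag Found weigh

  -- Keeps the vertices not yet treated as singletons, so that each can later be joined to the block
  -- of a neighbour.
  Solo : (Fin n → Set) → (Fin n → ℕ) → Set
  Solo U g = ∀ x → ¬ U x → ∀ y → g x ≡ g y → x ≡ y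

  -- Joining a new vertex a adjacent to u to the block of u in both g and g′ isolates the coefficient of the pair a, b.
  record Separated (U : Fin n → Set) (u b : Fin n) : Set where
    constructor separated
    field
      {g g′} : Fin n → ℕ
      good-g  : Good g
      good-g′ : Good g′
      solo-g  : Solo U g
      solo-g′ : Solo U g′
      differs : ∀ y → ind g u y ≡ ind g′ u y ℚ.+ δ b y

    -- At `b` the equation `differs` reads `ind g u b ≡ ind g′ u b + 1`, so the left side cannot be
    -- 0.
    together : g u ≡ g b
    together with g u ≟ g b | differs b
    ... | yes e | _ = e
    ... | no _  | e with g′ u ≟ g′ b
    ...   | yes _ with () ← trans e (cong (1ℚ ℚ.+_) (δ-refl b))
    ...   | no  _ with () ← trans e (cong (0ℚ ℚ.+_) (δ-refl b))

  -- The counterpart of `Separated` for `b = u`: joining `a` to `u` alone isolates the coefficient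
  -- of the pair `a`, `u`.
  record Isolated (U : Fin n → Set) (u : Fin n) : Set where
    constructor isolated
    field
      {g} : Fin n → ℕ
      good-g : Good g
      solo-g : Solo U g
      single : ∀ y → ind g u y ≡ δ u y

  arcs-trivial : ∀ {t₀ t₁ t₂} → Cuts t₀ t₁ t₂ → Solo OnCycle (arcs t₀ t₁ t₂)
  arcs-trivial C x off y e = arcs-solo C x y (arcs-off C x off) e

  -- A slide with `x = t`, whose upper partition has the single vertex `z t` as first arc.
  cycle-isolated : ∀ u → OnCycle u → Isolated OnCycle u
  cycle-isolated u on with cycle-position on m
  ... | t , m≤t , _ , refl with slide-left {t} ≤-refl (m<m+n t 0<m) (m≤m+n (N t) d)
  ...   | t₂ , S = isolated (slide-good-upper S) (arcs-trivial (Slide.cuts-upper S)) λ y →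
    ⟦⟧-cong (arcs t (suc t) t₂ (z t) ≟ arcs t (suc t) t₂ y) (z t Finₚ.≟ y) (alone y) (cong (arcs t (suc t) t₂))
    where
    alone : ∀ y → arcs t (suc t) t₂ (z t) ≡ arcs t (suc t) t₂ y → z t ≡ y
    alone y e with Arc.only (arc₀ (Slide.cuts-upper S)) y (trans (sym e) (slide-upper-0 S))
    ... | τ , t≤τ , s≤s τ≤t , zτ≡y = trans (cong z (≤-antisym t≤τ τ≤t)) zτ≡y

  N-suc≤ : ∀ t → N (suc t) ≤ suc (N t)
  N-suc≤ t with s (N t) ≟ t
  ... | yes _ = ≤-refl
  ... | no  _ = n≤1+n (N t)

  -- One of the two ways round the cycle between `u` and `b` has few enough marked vertices. If it
  -- leads from `u` to `b`, then `b` is the last vertex of a first arc beginning at `u`; otherwise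
  -- `b` is the first vertex of a second arc ending at `u`. Sliding `b` out gives the other
  -- decomposition.
  cycle-separated : ∀ u b → OnCycle u → OnCycle b → u ≢ b → Separated OnCycle u b
  cycle-separated u b u-on b-on u≢b with cycle-position b-on m
  ... | x , m≤x , _ , refl with ≤⇒∃+ m≤x
  ...   | x′ , x≡ with cycle-position u-on (suc x′)
  ...     | t , x′<t , t< , refl with N x ≤? N t + d
  ...       | yes few with slide-left (<⇒≤ t<x) x<t+m few
    where
    t<x : t < x
    t<x = ≤∧≢⇒< (≤-trans (≤-pred t<) (≤-reflexive (trans (+-comm x′ m) (sym x≡)))) (λ t≡x → u≢b (cong z t≡x))
    x<t+m : x < t + m
    x<t+m = ≤-trans (s≤s (≤-reflexive (trans x≡ (+-comm m x′)))) (+-monoˡ-≤ m x′<t)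
  ...         | t₂ , S = separated (slide-good-upper S) (slide-good-lower S) (arcs-trivial (Slide.cuts-upper S))
      (arcs-trivial (Slide.cuts-lower S))
    (ind-arc-snoc (arc₀ (Slide.cuts-upper S)) (arc₀ (Slide.cuts-lower S)) (Slide.t₀≤x S)
      (Arc.inside (arc₀ (Slide.cuts-upper S)) t ≤-refl (s≤s (Slide.t₀≤x S)))
      (Arc.inside (arc₀ (Slide.cuts-lower S)) t ≤-refl t<x))
    where
    t<x : t < x
    t<x = ≤∧≢⇒< (Slide.t₀≤x S) (λ t≡x → u≢b (cong z t≡x))
  cycle-separated u b u-on b-on u≢b | x , m≤x , _ , refl | x′ , x≡ | t , x′<t , t< , refl | no many
    with slide-right (≤-trans d≤k (k≤N m≤x)) (s≤s (<⇒≤ x<t+m)) t₂≤x+m few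
    where
    t<x : t < x
    t<x = ≤∧≢⇒< (≤-trans (≤-pred t<) (≤-reflexive (trans (+-comm x′ m) (sym x≡)))) (λ t≡x → u≢b (cong z t≡x))
    x<t+m : x < t + m
    x<t+m = ≤-trans (s≤s (≤-reflexive (trans x≡ (+-comm m x′)))) (+-monoˡ-≤ m x′<t)
    t₂≤x+m : suc (t + m) ≤ x + m
    t₂≤x+m = +-monoˡ-≤ m t<x
    few : N (suc (t + m)) ≤ N x + suc d
    few = ≤-trans (≤-reflexive (N-per (suc t))) (≤-trans (+-monoˡ-≤ k (N-suc≤ t))
      (≤-trans (≤-reflexive (shuffle (N t) d)) (+-monoˡ-≤ (suc d) (≰⇒> many))))
      where
      shuffle : ∀ a d → suc a + suc (2 * d) ≡ suc (a + d) + suc d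
      shuffle = solve-∀
  ... | t₀ , S = separated (slide-good-lower S) (slide-good-upper S) (arcs-trivial (Slide.cuts-lower S)) (arcs-trivial
      (Slide.cuts-upper S))
    (ind-arc-cons (arc₁ (Slide.cuts-lower S)) (arc₁ (Slide.cuts-upper S)) (Slide.x<t₂ S)
      (trans (cong (arcs t₀ x (suc (t + m))) (sym (z-per t))) (Arc.inside (arc₁ (Slide.cuts-lower S)) (t + m)
          (<⇒≤ x<t+m) ≤-refl))
      (trans (cong (arcs t₀ (suc x) (suc (t + m))) (sym (z-per t))) (Arc.inside (arc₁ (Slide.cuts-upper S))
          (t + m) x<t+m ≤-refl)))
    where
    x<t+m : x < t + m
    x<t+m = ≤-trans (s≤s (≤-reflexive (trans x≡ (+-comm m x′)))) (+-monoˡ-≤ m x′<t)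

  -- The invariant of the induction on vertices. `separate` and `isolate` supply the decompositions
  -- to which the next vertex is attached; `vanish` collects the coefficients already known to be 0.
  record Grown (U : Fin n → Set) : Set where
    constructor grown
    field
      U?        : ∀ x → Dec (U x)
      has-cycle : ∀ x → OnCycle x → U x
      separate  : ∀ u b → U u → U b → u ≢ b → Separated U u b
      isolate   : ∀ u → U u → Isolated U u
      vanish    : ∀ a b → U a → U b → ¬ (OnCycle a × OnCycle b) → γ a b ≡ 0ℚ

  cycle-grown : Grown OnCycle
  cycle-grown = grown onCycle? (λ _ on → on) cycle-separated cycle-isolated (λ a b ao bo ¬both → ⊥-elim (¬both
      (ao , bo)))

  module Grow {U : Fin n → Set} (gr : Grown U) {a u : Fin n} (a∉U : ¬ U a) (u∈U : U u) (a—u : Adj G a u) where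
    open Grown gr

    U⁺ : Fin n → Set
    U⁺ x = U x ⊎ x ≡ a

    ∈U⇒≢a : ∀ {x} → U x → x ≢ a
    ∈U⇒≢a x∈U refl = a∉U x∈U

    weaken : ∀ {g} → Solo U g → Solo U⁺ g
    weaken solo x x∉ = solo x (x∉ ∘ inj₁)

    join-good : ∀ {g} → Good g → Solo U g → Good (join g a u)
    join-good {g} (good dec tight) solo = good (join-decomposition g (∈U⇒≢a u∈U) (solo a a∉U) {G} a—u dec)
      (trans (Σ<-cong k {deficit d (λ i → join g a u (V i))} {deficit d (λ i → g (V i))} (λ i _ →
        cong₂ _+_ (cong₂ eq (same i) (same (i + d))) (cong₂ neq (same i) (same (suc i))))) tight)
      where
      same : ∀ i → join g a u (V i) ≡ g (V i)
      same i = join-≢ g (∈U⇒≢a (has-cycle (V i) (z-on-cycle (s i))))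

    join-solo : ∀ {g} → Solo U g → Solo U⁺ (join g a u)
    join-solo {g} solo x x∉ y e = by-cases (y Finₚ.≟ a)
      where
      gx : join g a u x ≡ g x
      gx = join-≢ g (x∉ ∘ inj₂)
      by-cases : Dec (y ≡ a) → x ≡ y
      by-cases (yes refl) = ⊥-elim (x∉ (inj₁ (subst U (sym (solo x (x∉ ∘ inj₁) u (trans (sym gx) (trans e
          (join-≡ g a u))))) u∈U)))
      by-cases (no y≢a)   = solo x (x∉ ∘ inj₁) y (trans (sym gx) (trans e (join-≢ g y≢a)))

    ind-solo : ∀ {g} → Solo U g → ∀ y → ind g a y ≡ δ a y
    ind-solo {g} solo y = ⟦⟧-cong (g a ≟ g y) (a Finₚ.≟ y) (solo a a∉U y) (cong g)

    -- `a` lies off the cycle, so joining it to the block of `u` preserves tightness. As `a` was a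
    -- singleton before, its coefficients to that block sum to 0.
    leaf-mass : ∀ {g} → Good g → Solo U g → Found ⊎ mass a (ind g u) ≡ 0ℚ
    leaf-mass {g} G solo = do
      e ← same-weight (join g a u) g (join-good G solo) G
      pure (begin
        mass a (ind g u)                 ≡⟨ sym (ℚₚ.+-identityʳ _) ⟩
        mass a (ind g u) ℚ.+ 0ℚ          ≡⟨ cong (mass a (ind g u) ℚ.+_) (sym (γ-diag a)) ⟩
        mass a (ind g u) ℚ.+ γ a a       ≡⟨ sym (mass-+δ a a (ind-join-leaf g (∈U⇒≢a u∈U) (solo a a∉U))) ⟩
        row (join g a u) a               ≡⟨ row-move (join g a u) g a (λ x x≢a → join-≢ g x≢a) e ⟩
        row g a                          ≡⟨ mass-δ a a (ind-solo solo) ⟩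
        γ a a                            ≡⟨ γ-diag a ⟩
        0ℚ                               ∎)
      where open ≡-Reasoning

    leaf-zero : ∀ b → U b → Found ⊎ γ a b ≡ 0ℚ
    leaf-zero b b∈U with u Finₚ.≟ b
    ... | yes refl = do
      e ← leaf-mass (Isolated.good-g I) (Isolated.solo-g I)
      pure (trans (sym (mass-δ a u (Isolated.single I))) e)
      where I = isolate u u∈U
    ... | no u≢b = do
      e  ← leaf-mass (Separated.good-g S) (Separated.solo-g S)
      e′ ← leaf-mass (Separated.good-g′ S) (Separated.solo-g′ S)
      pure (p≡p+q⇒q≡0 0ℚ (γ a b) (trans (sym e) (trans (mass-+δ a b (Separated.differs S)) (cong (ℚ._+ γ a b) e′))))
      where S = separate u b u∈U b∈U u≢b

    leaf-zeros : Found ⊎ (∀ b → U b → γ a b ≡ 0ℚ)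
    leaf-zeros = sequence each
      where
      each : ∀ b → Found ⊎ (U b → γ a b ≡ 0ℚ)
      each b with U? b
      ... | no b∉U  = pure (λ b∈U → ⊥-elim (b∉U b∈U))
      ... | yes b∈U = do
        e ← leaf-zero b b∈U
        pure (λ _ → e)

    -- If `b` is the new vertex, a decomposition with `w` in the block of `u` is compared with and
    -- without `a` joined. If `w` is the new vertex, its block is that of `u` plus `a`, so
    -- separating `u` from `b` separates `a` from `b`; for `b = u` the vertex `u` is taken alone,
    -- with and without `a`.
    separate⁺ : ∀ w b → U⁺ w → U⁺ b → w ≢ b → Separated U⁺ w b
    separate⁺ w b (inj₁ w∈U) (inj₁ b∈U) w≢b = separated (Separated.good-g S) (Separated.good-g′ S)
      (weaken (Separated.solo-g S)) (weaken (Separated.solo-g′ S)) (Separated.differs S)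
      where S = separate w b w∈U b∈U w≢b
    separate⁺ w b (inj₂ refl) (inj₂ refl) w≢b = ⊥-elim (w≢b refl)
    separate⁺ w b (inj₁ w∈U) (inj₂ refl) w≢b with w Finₚ.≟ u
    ... | yes refl = separated (join-good (Isolated.good-g I) (Isolated.solo-g I)) (Isolated.good-g I)
      (join-solo (Isolated.solo-g I)) (weaken (Isolated.solo-g I))
      (ind-join (Isolated.g I) (∈U⇒≢a u∈U) (Isolated.solo-g I a a∉U) u (∈U⇒≢a u∈U) refl)
      where I = isolate u u∈U
    ... | no w≢u = separated (join-good (Separated.good-g S) (Separated.solo-g S)) (Separated.good-g S)
      (join-solo (Separated.solo-g S)) (weaken (Separated.solo-g S))
      (ind-join (Separated.g S) (∈U⇒≢a u∈U) (Separated.solo-g S a a∉U) w (∈U⇒≢a w∈U) (Separated.together S))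
      where S = separate w u w∈U u∈U w≢u
    separate⁺ w b (inj₂ refl) (inj₁ b∈U) w≢b with u Finₚ.≟ b
    ... | yes refl = separated (join-good (Isolated.good-g I) (Isolated.solo-g I)) (Isolated.good-g I)
      (join-solo (Isolated.solo-g I)) (weaken (Isolated.solo-g I))
      (λ y → trans (ind-join-leaf (Isolated.g I) (∈U⇒≢a u∈U) (Isolated.solo-g I a a∉U) y)
        (trans (cong (ℚ._+ δ a y) (Isolated.single I y)) (trans (ℚₚ.+-comm (δ u y) (δ a y)) (cong (ℚ._+ δ u y) (sym
            (ind-solo (Isolated.solo-g I) y))))))
      where I = isolate u u∈U
    ... | no u≢b = separated (join-good (Separated.good-g S) (Separated.solo-g S)) (join-good (Separated.good-g′ S)
        (Separated.solo-g′ S))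
      (join-solo (Separated.solo-g S)) (join-solo (Separated.solo-g′ S))
      (λ y → begin
        ind (join (Separated.g S) a u) a y
          ≡⟨ ind-join-leaf (Separated.g S) (∈U⇒≢a u∈U) (Separated.solo-g S a a∉U) y ⟩
        ind (Separated.g S) u y ℚ.+ δ a y
          ≡⟨ cong (ℚ._+ δ a y) (Separated.differs S y) ⟩
        ind (Separated.g′ S) u y ℚ.+ δ b y ℚ.+ δ a y
          ≡⟨ +-swapʳ (ind (Separated.g′ S) u y) (δ b y) (δ a y) ⟩
        ind (Separated.g′ S) u y ℚ.+ δ a y ℚ.+ δ b y
          ≡⟨ cong (ℚ._+ δ b y) (sym (ind-join-leaf (Separated.g′ S) (∈U⇒≢a u∈U) (Separated.solo-g′ S a a∉U) y)) ⟩
        ind (join (Separated.g′ S) a u) a y ℚ.+ δ b y ∎)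
      where
      S = separate u b u∈U b∈U u≢b
      open ≡-Reasoning
      +-swapʳ : ∀ p q r → p ℚ.+ q ℚ.+ r ≡ p ℚ.+ r ℚ.+ q
      +-swapʳ p q r = trans (ℚₚ.+-assoc p q r) (trans (cong (p ℚ.+_) (ℚₚ.+-comm q r)) (sym (ℚₚ.+-assoc p r q)))

    isolate⁺ : ∀ w → U⁺ w → Isolated U⁺ w
    isolate⁺ w (inj₁ w∈U)  = isolated (Isolated.good-g I) (weaken (Isolated.solo-g I)) (Isolated.single I)
      where I = isolate w w∈U
    isolate⁺ w (inj₂ refl) = isolated (Isolated.good-g I) (weaken (Isolated.solo-g I)) (ind-solo (Isolated.solo-g I))
      where I = isolate u u∈U

    grow : Found ⊎ Grown U⁺
    grow = do
      zeros ← leaf-zeros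
      pure (grown (λ x → U? x ⊎-dec (x Finₚ.≟ a)) (λ x on → inj₁ (has-cycle x on)) separate⁺ isolate⁺
        (λ { x y (inj₁ x∈U) (inj₁ y∈U) ¬both → vanish x y x∈U y∈U ¬both
           ; x y (inj₁ x∈U) (inj₂ refl) ¬both → trans (γ-sym x a) (zeros x x∈U)
           ; x y (inj₂ refl) (inj₁ y∈U) ¬both → zeros y y∈U
           ; x y (inj₂ refl) (inj₂ refl) ¬both → γ-diag a }))

  Extension : (Fin n → Set) → (Fin n → Set) → Set₁
  Extension U P = Σ (Fin n → Set) λ U′ → Grown U′ × (∀ {x} → U x → U′ x) × (∀ {x} → P x → U′ x)

  -- The path is consumed from its end in `U`, so each vertex is added next to one already present.
  reach : ∀ {U} → Grown U → ∀ {x y} → Star (Adj G) x y → U y → Found ⊎ Extension U (_≡ x)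
  reach {U} gr ε y∈U = pure (U , gr , id , λ { refl → y∈U })
  reach {U} gr {x} (x—x₁ ◅ path) y∈U = do
    (U′ , gr′ , ⊆ , x₁∈) ← reach gr path y∈U
    extend gr′ ⊆ (x₁∈ refl)
    where
    extend : ∀ {U′} → Grown U′ → (∀ {x} → U x → U′ x) → U′ _ → Found ⊎ Extension U (_≡ x)
    extend {U′} gr′ ⊆ x₁∈ with Grown.U? gr′ x
    ... | yes x∈ = pure (U′ , gr′ , ⊆ , λ { refl → x∈ })
    ... | no x∉  = do
      gr″ ← Grow.grow gr′ x∉ x₁∈ x—x₁
      pure (_ , gr″ , (λ x∈ → inj₁ (⊆ x∈)) , inj₂)

  cover : Connected G → ∀ {t} (f : Fin t → Fin n) → Found ⊎ Extension OnCycle (λ x → ∃ λ i → f i ≡ x)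
  cover conn {zero} f = pure (OnCycle , cycle-grown , id , λ { (() , _) })
  cover conn {suc t} f = do
    (U , gr , ⊆ , cov) ← cover conn (λ i → f (suc i))
    (U′ , gr′ , ⊆′ , new) ← reach gr (conn (f zero) (z 0)) (⊆ (z-on-cycle 0))
    pure (U′ , gr′ , (λ x∈ → ⊆′ (⊆ x∈)) , λ { (zero , refl) → new refl ; (suc i , e) → ⊆′ (cov (i , e)) })

  zero-off-cycle : Connected G → Found ⊎ (∀ a b → ¬ (OnCycle a × OnCycle b) → γ a b ≡ 0ℚ)
  zero-off-cycle conn = do
    (U , gr , _ , cov) ← cover conn id
    pure (λ a b → Grown.vanish gr a b (cov (a , refl)) (cov (b , refl)))

-- Pairs of marked vertices

sum-four : ∀ {t} (f : Fin t → ℚ) (a b c e : Fin t) → a ≢ b → a ≢ c → a ≢ e → b ≢ c → b ≢ e → c ≢ e →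
  (∀ i → i ≢ a → i ≢ b → i ≢ c → i ≢ e → f i ≡ 0ℚ) →
  sumℚ f ≡ f a ℚ.+ (f b ℚ.+ (f c ℚ.+ f e))
sum-four f a b c e ab ac ae bc be ce off = begin
  sumℚ f
    ≡⟨ sum-cong pointwise ⟩
  sumℚ (λ i → f i ℚ.* δ a i ℚ.+ (f i ℚ.* δ b i ℚ.+ (f i ℚ.* δ c i ℚ.+ f i ℚ.* δ e i)))
    ≡⟨ trans (sum-+ (λ i → f i ℚ.* δ a i) (λ i → f i ℚ.* δ b i ℚ.+ (f i ℚ.* δ c i ℚ.+ f i ℚ.* δ e i)))
       (cong₂ ℚ._+_ (sum-δ f a) (trans (sum-+ (λ i → f i ℚ.* δ b i) (λ i → f i ℚ.* δ c i ℚ.+ f i ℚ.* δ e i))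
       (cong₂ ℚ._+_ (sum-δ f b) (trans (sum-+ (λ i → f i ℚ.* δ c i) (λ i → f i ℚ.* δ e i))
       (cong₂ ℚ._+_ (sum-δ f c) (sum-δ f e)))))) ⟩
  f a ℚ.+ (f b ℚ.+ (f c ℚ.+ f e)) ∎
  where
  open ≡-Reasoning
  combine : ∀ p {x y z w x′ y′ z′ w′} → x ≡ x′ → y ≡ y′ → z ≡ z′ → w ≡ w′ → 
    p ℚ.* x ℚ.+ (p ℚ.* y ℚ.+ (p ℚ.* z ℚ.+ p ℚ.* w)) ≡ p ℚ.* x′ ℚ.+ (p ℚ.* y′ ℚ.+ (p ℚ.* z′ ℚ.+ p ℚ.* w′))
  combine p refl refl refl refl = refl
  pointwise : ∀ i → f i ≡ f i ℚ.* δ a i ℚ.+ (f i ℚ.* δ b i ℚ.+ (f i ℚ.* δ c i ℚ.+ f i ℚ.* δ e i))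
  pointwise i with i Finₚ.≟ a | i Finₚ.≟ b | i Finₚ.≟ c | i Finₚ.≟ e
  ... | yes refl | _ | _ | _ = sym (trans (combine (f i) (δ-refl i) (δ-≢ (ab ∘ sym)) (δ-≢ (ac ∘ sym)) (δ-≢ (ae ∘ sym)))
    (solve 1 (λ p → p :* con 1ℚ :+ (p :* con 0ℚ :+ (p :* con 0ℚ :+ p :* con 0ℚ)) := p) refl (f i)))
  ... | no ne | yes refl | _ | _ = sym (trans (combine (f i) (δ-≢ ab) (δ-refl i) (δ-≢ (bc ∘ sym)) (δ-≢ (be ∘ sym)))
    (solve 1 (λ p → p :* con 0ℚ :+ (p :* con 1ℚ :+ (p :* con 0ℚ :+ p :* con 0ℚ)) := p) refl (f i)))
  ... | no _ | no _ | yes refl | _ = sym (trans (combine (f i) (δ-≢ ac) (δ-≢ bc) (δ-refl i) (δ-≢ (ce ∘ sym)))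
    (solve 1 (λ p → p :* con 0ℚ :+ (p :* con 0ℚ :+ (p :* con 1ℚ :+ p :* con 0ℚ)) := p) refl (f i)))
  ... | no _ | no _ | no _ | yes refl = sym (trans (combine (f i) (δ-≢ ae) (δ-≢ be) (δ-≢ ce) (δ-refl i))
    (solve 1 (λ p → p :* con 0ℚ :+ (p :* con 0ℚ :+ (p :* con 0ℚ :+ p :* con 1ℚ)) := p) refl (f i)))
  ... | no na | no nb | no nc | no ne = trans zero-here (sym (trans
    (cong (λ p → p ℚ.* δ a i ℚ.+ (p ℚ.* δ b i ℚ.+ (p ℚ.* δ c i ℚ.+ p ℚ.* δ e i))) zero-here)
    (solve 4 (λ x y z w → con 0ℚ :* x :+ (con 0ℚ :* y :+ (con 0ℚ :* z :+ con 0ℚ :* w)) := con 0ℚ) refl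
      (δ a i) (δ b i) (δ c i) (δ e i))))
    where
    zero-here : f i ≡ 0ℚ
    zero-here = off i na nb nc ne

module Conclusion {n} {G : Graph n} {m d : ℕ} (F : Frame G m d)
  (γ : Fin n → Fin n → ℚ) (γ-sym : ∀ a b → γ a b ≡ γ b a) (γ-diag : ∀ a → γ a a ≡ 0ℚ)
  (Found : Set) (weigh : ∀ g → FrameProperties.Good F g → Found ⊎ Weights.weight γ γ-sym γ-diag g ≡ 0ℚ) where
  open FrameProperties F
  open Slides F
  open ArcIndicators F
  open Weights γ γ-sym γ-diag
  open Forcing γ γ-sym γ-diag Found weigh
  open Leaves F γ γ-sym γ-diag Found weigh

  -- The alternative `Found` can be pulled out of finitely many cases only; periodicity reduces all
  -- `q` to one period.
  for-all-periodic : ∀ {A : ℕ → Set} → (∀ q → A q → A (q + k)) → (∀ q → Found ⊎ A q) → Found ⊎ (∀ q → A q)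
  for-all-periodic {A} step each = do
    first ← sequence {k} (λ i → each (toℕ i))
    pure (λ q → subst A (sym (m≡m%n+[m/n]*n q k)) (steps (q % k) (q ℕ./ k)
      (subst A (Finₚ.toℕ-fromℕ< (m%n<n q k)) (first (fromℕ< (m%n<n q k))))))
    where
    steps : ∀ r c → A r → A (r + c * k)
    steps r zero    a = subst A (sym (+-identityʳ r)) a
    steps r (suc c) a = subst A (reorder r k (c * k)) (step _ (steps r c a))
      where
      reorder : ∀ r m p → r + p + m ≡ r + (m + p)
      reorder = solve-∀

  module Marks
    (unmarked : ∀ a b → ¬ (Marked a × Marked b) → γ a b ≡ 0ℚ)
    (chords : ∀ q e → 2 ≤ e → e < d → γ (V (q + e)) (V q) ≡ 0ℚ) where
    open ≡-Reasoning

    sum-marked : ∀ p (f : Fin n → ℚ) → (∀ b → ¬ Marked b → f b ≡ 0ℚ) → sumℚ f ≡ sumℚ {k} (λ o → f (V (p + toℕ o)))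
    sum-marked p f off = begin
      sumℚ f
        ≡⟨ sum-cong pointwise ⟩
      sumℚ (λ b → sumℚ {k} (λ o → f (V (p + toℕ o)) ℚ.* δ (V (p + toℕ o)) b))
        ≡⟨ sum-swap {n} {k} (λ b o → f (V (p + toℕ o)) ℚ.* δ (V (p + toℕ o)) b) ⟩
      sumℚ {k} (λ o → sumℚ (λ b → f (V (p + toℕ o)) ℚ.* δ (V (p + toℕ o)) b))
        ≡⟨ sum-cong {k} (λ o → sum-δ (λ _ → f (V (p + toℕ o))) (V (p + toℕ o))) ⟩
      sumℚ {k} (λ o → f (V (p + toℕ o))) ∎
      where
      pointwise : ∀ b → f b ≡ sumℚ {k} (λ o → f (V (p + toℕ o)) ℚ.* δ (V (p + toℕ o)) b)
      pointwise b with marked? b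
      ... | no un = trans (off b un) (sym (sum-zero {k} (λ o → trans
        (cong (f (V (p + toℕ o)) ℚ.*_) (δ-≢ (λ e → un (p + toℕ o , e)))) (ℚₚ.*-zeroʳ (f (V (p + toℕ o)))))))
      ... | yes M with marked-window M p
      ...   | o , o<k , refl = sym (trans (sum-cong {k} (λ i → cong (f (V (p + toℕ i)) ℚ.*_)
          (⟦⟧-cong (V (p + toℕ i) Finₚ.≟ V (p + o)) (o′ Finₚ.≟ i)
            (λ e → Finₚ.toℕ-injective (trans (Finₚ.toℕ-fromℕ< o<k) (sym (V-inj p _ _ (Finₚ.toℕ<n i) o<k e))))
            (λ { refl → cong (λ l → V (p + l)) (Finₚ.toℕ-fromℕ< o<k) }))))
        (trans (sum-δ {k} (λ i → f (V (p + toℕ i))) o′) (cong (λ l → f (V (p + l))) (Finₚ.toℕ-fromℕ< o<k))))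
        where
        o′ = fromℕ< o<k

    1<k : 1 < k
    1<k = s≤s (≤-trans 1≤d (m≤m+n d (d + 0)))
    d<k : d < k
    d<k = s≤s (m≤m+n d (d + 0))
    sd<k : suc d < k
    sd<k = s≤s (≤-trans (≤-reflexive (+-comm 1 d)) (+-monoʳ-≤ d (≤-trans 1≤d (m≤m+n d 0))))
    2d<k : 2 * d < k
    2d<k = n<1+n (2 * d)
    1<2d : 1 < 2 * d
    1<2d = ≤-trans 2≤d (m≤m+n d (d + 0))
    d<2d : d < 2 * d
    d<2d = ≤-trans (m<m+n d 1≤d) (≤-reflexive (cong (d +_) (sym (+-identityʳ d))))
    sd<2d : suc d < 2 * d
    sd<2d = ≤-trans (≤-reflexive (+-comm 2 d)) (≤-trans (+-monoʳ-≤ d 2≤d) (≤-reflexive (cong (d +_) (sym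
        (+-identityʳ d)))))

    -- Modulo `k` the excluded offsets are 1, -1, `d` and `-d`. An offset beyond `d + 1` is a chord
    -- of length `k - o`, between 2 and `d - 1`, seen from its other end.
    far : ∀ p o → o < k → o ≢ 1 → o ≢ d → o ≢ suc d → o ≢ 2 * d → γ (V p) (V (p + o)) ≡ 0ℚ
    far p zero o<k _ _ _ _ = trans (cong (λ l → γ (V p) (V l)) (+-identityʳ p)) (γ-diag (V p))
    far p o@(suc o₁) (s≤s o≤2d) o≢1 o≢d o≢sd o≢2d with o <? d
    ... | yes o<d = trans (γ-sym (V p) (V (p + o))) (chords p o (≤∧≢⇒< (s≤s z≤n) (o≢1 ∘ sym)) o<d)
    ... | no o≮d with ≤⇒∃+ (≤∧≢⇒< (≤∧≢⇒< (≮⇒≥ o≮d) (o≢d ∘ sym)) (o≢sd ∘ sym)) | ≤⇒∃+ (≤∧≢⇒< o≤2d o≢2d)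
    ...   | f , o≡ | e , 2d≡ = trans (cong (λ a → γ a (V (p + o))) (trans (sym (V-per p)) (cong V k≡)))
              (chords (p + o) (suc (suc e)) (s≤s (s≤s z≤n)) e<d)
      where
      k≡ : p + k ≡ p + o + suc (suc e)
      k≡ = trans (cong (λ l → p + suc l) 2d≡) (shuffle p o e)
        where
        shuffle : ∀ p o e → p + suc (suc o + e) ≡ p + o + suc (suc e)
        shuffle = solve-∀
      e<d : suc (suc e) < d
      e<d = +-cancelˡ-≤ d _ _ (≤-trans (m≤m+n _ f) (≤-reflexive (trans (shuffle d e f) (trans (cong (λ l → suc
          (l + e)) (sym o≡)) (trans (sym 2d≡) (cong (d +_) (+-identityʳ d)))))))
        where
        shuffle : ∀ d e f → d + suc (suc (suc e)) + f ≡ suc (suc (suc d) + f + e)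
        shuffle = solve-∀

    T : (Fin n → ℕ) → ℕ → ℕ → ℚ
    T g p o = γ (V p) (V (p + o)) ℚ.* ind g (V p) (V (p + o))

    row-marked : ∀ g p → row g (V p) ≡ T g p 1 ℚ.+ (T g p d ℚ.+ (T g p (suc d) ℚ.+ T g p (2 * d)))
    row-marked g p = begin
      row g (V p)
        ≡⟨ sum-marked p (λ b → γ (V p) b ℚ.* ind g (V p) b)
             (λ b un → trans (cong (ℚ._* ind g (V p) b) (unmarked (V p) b (un ∘ proj₂))) (ℚₚ.*-zeroˡ (ind g (V p) b))) ⟩
      sumℚ {k} (λ o → T g p (toℕ o))
        ≡⟨ sum-four (λ o → T g p (toℕ o)) (at 1<k) (at d<k) (at sd<k) (at 2d<k)
             (apart 1<k d<k (λ e → <-irrefl e 2≤d))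
             (apart 1<k sd<k (λ e → <-irrefl e (≤-trans 2≤d (n≤1+n d))))
             (apart 1<k 2d<k (λ e → <-irrefl e 1<2d))
             (apart d<k sd<k (λ e → 1+n≢n (sym e)))
             (apart d<k 2d<k (λ e → <-irrefl e d<2d))
             (apart sd<k 2d<k (λ e → <-irrefl e sd<2d))
             (λ i i≢1 i≢d i≢sd i≢2d → trans (cong (ℚ._* ind g (V p) (V (p + toℕ i)))
               (far p (toℕ i) (Finₚ.toℕ<n i) (away 1<k i≢1) (away d<k i≢d) (away sd<k i≢sd) (away 2d<k i≢2d)))
               (ℚₚ.*-zeroˡ (ind g (V p) (V (p + toℕ i))))) ⟩
      T g p (toℕ (at 1<k)) ℚ.+ (T g p (toℕ (at d<k)) ℚ.+ (T g p (toℕ (at sd<k)) ℚ.+ T g p (toℕ (at 2d<k))))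
        ≡⟨ cong₂ ℚ._+_ (back 1<k) (cong₂ ℚ._+_ (back d<k) (cong₂ ℚ._+_ (back sd<k) (back 2d<k))) ⟩
      T g p 1 ℚ.+ (T g p d ℚ.+ (T g p (suc d) ℚ.+ T g p (2 * d))) ∎
      where
      at : ∀ {o} → o < k → Fin k
      at p = fromℕ< p
      apart : ∀ {o o′} (p : o < k) (q : o′ < k) → o ≢ o′ → at p ≢ at q
      apart p q ne e = ne (trans (sym (Finₚ.toℕ-fromℕ< p)) (trans (cong toℕ e) (Finₚ.toℕ-fromℕ< q)))
      away : ∀ {o i} (p : o < k) → i ≢ at p → toℕ i ≢ o
      away p ne e = ne (Finₚ.toℕ-injective (trans e (sym (Finₚ.toℕ-fromℕ< p))))
      back : ∀ {o} (q : o < k) → T g p (toℕ (at q)) ≡ T g p o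
      back q = cong (T g p) (Finₚ.toℕ-fromℕ< q)

    T-same : ∀ g p o → g (V p) ≡ g (V (p + o)) → T g p o ≡ γ (V p) (V (p + o))
    T-same g p o e = trans (cong (γ (V p) (V (p + o)) ℚ.*_) (ind-≡ g e)) (ℚₚ.*-identityʳ (γ (V p) (V (p + o))))

    T-other : ∀ g p o → g (V p) ≢ g (V (p + o)) → T g p o ≡ 0ℚ
    T-other g p o ne = trans (cong (γ (V p) (V (p + o)) ℚ.*_) (ind-≢ g ne)) (ℚₚ.*-zeroʳ (γ (V p) (V (p + o))))

    same-arc : ∀ {g a p q} → Arc g a p q → ∀ {i j} → g (V i) ≡ a → N p ≤ j → j < N q → g (V i) ≡ g (V j)
    same-arc A gi p≤j j<q = trans gi (sym (Arc.index-inside A _ p≤j j<q))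

    other-arc : ∀ {g a p q} → Arc g a p q → p ≤ q → ∀ {i j} → g (V i) ≡ a → N q ≤ j → j < N p + k → g (V i) ≢ g (V j)
    other-arc A p≤q gi q≤j j<p+k e = Arc.index-outside A _ q≤j j<p+k p≤q (trans (sym e) gi)

    -- Before the slide, the only neighbour of `V (q + 1)` with a surviving coefficient is `V q`.
    -- After it, the block reaches to `V (q + d)`, and among its offsets 1 to `d - 1` only 1
    -- survives.
    step : ∀ q → Found ⊎ γ (V q) (V (q + 1)) ≡ γ (V (q + 1)) (V (q + 1 + 1))
    step q = do
      e ← slide-row S
      pure (begin
        γ (V q) (V x)
          ≡⟨ γ-sym (V q) (V x) ⟩
        γ (V x) (V q)
          ≡⟨ cong (γ (V x)) (sym wrap) ⟩
        γ (V x) (V (x + 2 * d))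
          ≡⟨ solve 1 (λ a → a := con 0ℚ :+ (con 0ℚ :+ (con 0ℚ :+ a))) refl (γ (V x) (V (x + 2 * d))) ⟩
        0ℚ ℚ.+ (0ℚ ℚ.+ (0ℚ ℚ.+ γ (V x) (V (x + 2 * d))))
          ≡⟨ sym (cong₂ ℚ._+_ (T-other U x 1 (out₀ 1 ≤-refl 1<2d)) (cong₂ ℚ._+_ (T-other U x d (out₀ d 1≤d d<2d))
               (cong₂ ℚ._+_ (T-other U x (suc d) (out₀ (suc d) (s≤s z≤n) sd<2d))
                 (T-same U x (2 * d) wrapped)))) ⟩
        T U x 1 ℚ.+ (T U x d ℚ.+ (T U x (suc d) ℚ.+ T U x (2 * d)))
          ≡⟨ sym (row-marked U x) ⟩
        row U (V x)
          ≡⟨ e ⟩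
        row L (V x)
          ≡⟨ row-marked L x ⟩
        T L x 1 ℚ.+ (T L x d ℚ.+ (T L x (suc d) ℚ.+ T L x (2 * d)))
          ≡⟨ cong₂ ℚ._+_ (T-same L x 1 (same-arc A₁ (slide-lower-1 S) (≤-trans (≤-reflexive (N-s x)) (m≤m+n x 1))
              (≤-trans (+-monoʳ-< x 2≤d) (≤-reflexive (sym (N-s (x + d)))))))
               (cong₂ ℚ._+_ (T-other L x d (out₁ d ≤-refl d<k))
                 (cong₂ ℚ._+_ (T-other L x (suc d) (out₁ (suc d) (n≤1+n d) sd<k)) (T-other L x (2 * d) (out₁ (2 * d)
                     (m≤m+n d (d + 0)) 2d<k)))) ⟩
        γ (V x) (V (x + 1)) ℚ.+ (0ℚ ℚ.+ (0ℚ ℚ.+ 0ℚ))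
          ≡⟨ ℚₚ.+-identityʳ (γ (V x) (V (x + 1))) ⟩
        γ (V x) (V (x + 1)) ∎)
      where
      x = q + 1
      S = slide-chord q 1 ≤-refl 2≤d
      U = arcs (s q) (suc (s x)) (s (x + d))
      L = arcs (s q) (s x) (s (x + d))
      A₀ = arc₀ (Slide.cuts-upper S)
      A₁ = arc₁ (Slide.cuts-lower S)
      wrap : V (x + 2 * d) ≡ V q
      wrap = trans (cong V (+-assoc q 1 (2 * d))) (V-per q)
      wrapped : U (V x) ≡ U (V (x + 2 * d))
      wrapped = trans (slide-upper-0 S) (sym (trans (cong U wrap)
        (Arc.index-inside A₀ q (≤-reflexive (N-s q)) (s<⇒<N (s≤s (Slide.t₀≤x S))))))
      out₀ : ∀ o → 1 ≤ o → o < 2 * d → U (V x) ≢ U (V (x + o))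
      out₀ o 1≤o o<2d = other-arc A₀ (≤-trans (Slide.t₀≤x S) (n≤1+n (s x))) (slide-upper-0 S)
        (≤-trans (≤-reflexive (trans (N-suc-s x) (+-comm 1 x))) (+-monoʳ-≤ x 1≤o))
        (≤-trans (≤-trans (≤-reflexive (cong suc (+-assoc q 1 o))) (≤-trans (≤-reflexive (sym (+-suc q (suc o))))
            (+-monoʳ-≤ q (s≤s o<2d)))) (≤-reflexive (cong (_+ k) (sym (N-s q)))))
      out₁ : ∀ o → d ≤ o → o < k → L (V x) ≢ L (V (x + o))
      out₁ o d≤o o<k = other-arc A₁ (<⇒≤ (Slide.x<t₂ S)) (slide-lower-1 S)
        (≤-trans (≤-reflexive (N-s (x + d))) (+-monoʳ-≤ x d≤o))
        (≤-trans (+-monoʳ-< x o<k) (≤-reflexive (cong (_+ k) (sym (N-s x)))))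

    -- The slide makes `V (q + d)` a block of its own. Before, its block held `V q` up to
    -- `V (q + d - 1)`, of which only the two ends, at offsets `-d` and -1, have surviving
    -- coefficients.
    half : ∀ q → Found ⊎ γ (V (q + d)) (V (q + d + suc d)) ℚ.+ γ (V (q + d)) (V (q + d + 2 * d)) ≡ 0ℚ
    half q = do
      e ← slide-row S
      pure (begin
        γ (V x) (V (x + suc d)) ℚ.+ γ (V x) (V (x + 2 * d))
          ≡⟨ solve 2 (λ a b → a :+ b := con 0ℚ :+ (con 0ℚ :+ (a :+ b))) refl (γ (V x) (V (x + suc d))) (γ (V x) (V
              (x + 2 * d))) ⟩
        0ℚ ℚ.+ (0ℚ ℚ.+ (γ (V x) (V (x + suc d)) ℚ.+ γ (V x) (V (x + 2 * d))))
          ≡⟨ sym (cong₂ ℚ._+_ (T-other U x 1 (out₀ 1 ≤-refl 1≤d)) (cong₂ ℚ._+_ (T-other U x d (out₀ d 1≤d ≤-refl))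
               (cong₂ ℚ._+_ (T-same U x (suc d) (in₀ (suc d) 0 (arith₁ q d) z≤n)) (T-same U x (2 * d)
                   (back-one d 1≤d refl))))) ⟩
        T U x 1 ℚ.+ (T U x d ℚ.+ (T U x (suc d) ℚ.+ T U x (2 * d)))
          ≡⟨ sym (row-marked U x) ⟩
        row U (V x)
          ≡⟨ e ⟩
        row L (V x)
          ≡⟨ row-marked L x ⟩
        T L x 1 ℚ.+ (T L x d ℚ.+ (T L x (suc d) ℚ.+ T L x (2 * d)))
          ≡⟨ cong₂ ℚ._+_ (T-other L x 1 (out₁ 1 ≤-refl 1<k)) (cong₂ ℚ._+_ (T-other L x d (out₁ d 1≤d d<k))
               (cong₂ ℚ._+_ (T-other L x (suc d) (out₁ (suc d) (s≤s z≤n) sd<k)) (T-other L x (2 * d) (out₁ (2 * d)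
                   (≤-trans 1≤d (m≤m+n d (d + 0))) 2d<k)))) ⟩
        0ℚ ∎)
      where
      x = q + d
      S = slide-half q
      U = arcs (s q) (suc (s x)) (suc (s x))
      L = arcs (s q) (s x) (suc (s x))
      A₀ = arc₀ (Slide.cuts-upper S)
      A₁ = arc₁ (Slide.cuts-lower S)
      arith₁ : ∀ q d → q + d + suc d ≡ q + 0 + suc (2 * d)
      arith₁ = solve-∀
      out₀ : ∀ o → 1 ≤ o → o ≤ d → U (V x) ≢ U (V (x + o))
      out₀ o 1≤o o≤d = other-arc A₀ (≤-trans (Slide.t₀≤x S) (n≤1+n (s x))) (slide-upper-0 S)
        (≤-trans (≤-reflexive (trans (N-suc-s x) (+-comm 1 x))) (+-monoʳ-≤ x 1≤o))
        (≤-trans (s≤s (+-monoʳ-≤ x o≤d)) (≤-reflexive (trans (arith q d) (cong (_+ k) (sym (N-s q))))))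
        where
        arith : ∀ q d → suc (q + d + d) ≡ q + suc (2 * d)
        arith = solve-∀
      in₀ : ∀ o i → x + o ≡ q + i + k → i ≤ d → U (V x) ≡ U (V (x + o))
      in₀ o i e i≤d = trans (slide-upper-0 S) (sym (trans (cong U (trans (cong V e) (V-per (q + i))))
        (Arc.index-inside A₀ (q + i) (≤-trans (≤-reflexive (N-s q)) (m≤m+n q i)) (≤-trans (s≤s (+-monoʳ-≤ q i≤d))
            (≤-reflexive (sym (N-suc-s x)))))))
      back-one : ∀ d′ → 1 ≤ d′ → d ≡ d′ → U (V x) ≡ U (V (x + 2 * d))
      back-one (suc d′) _ d≡ = in₀ (2 * d) d′ (trans (cong (λ l → q + l + 2 * l) d≡) (trans (arith q d′) (cong (λ l
          → q + d′ + suc (2 * l)) (sym d≡))))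
        (≤-trans (n≤1+n d′) (≤-reflexive (sym d≡)))
        where
        arith : ∀ q d → q + suc d + 2 * suc d ≡ q + d + suc (2 * suc d)
        arith = solve-∀
      out₁ : ∀ o → 1 ≤ o → o < k → L (V x) ≢ L (V (x + o))
      out₁ o 1≤o o<k = other-arc A₁ (n≤1+n (s x)) (slide-lower-1 S)
        (≤-trans (≤-reflexive (trans (N-suc-s x) (+-comm 1 x))) (+-monoʳ-≤ x 1≤o))
        (≤-trans (+-monoʳ-< x o<k) (≤-reflexive (cong (_+ k) (sym (N-s x)))))

    module Proportional
      (steps  : ∀ q → γ (V q) (V (q + 1)) ≡ γ (V (q + 1)) (V (q + 1 + 1)))
      (halves : ∀ q → γ (V (q + d)) (V (q + d + suc d)) ℚ.+ γ (V (q + d)) (V (q + d + 2 * d)) ≡ 0ℚ) where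

      ρ : ℚ
      ρ = γ (V 0) (V 1)

      γ-1 : ∀ q → γ (V q) (V (q + 1)) ≡ ρ
      γ-1 zero    = refl
      γ-1 (suc q) = trans (cong (λ l → γ (V l) (V (l + 1))) (+-comm 1 q)) (trans (sym (steps q)) (γ-1 q))

      γ-2d : ∀ q → γ (V q) (V (q + 2 * d)) ≡ ρ
      γ-2d q = trans (γ-sym (V q) (V (q + 2 * d))) (trans
        (cong (γ (V (q + 2 * d))) (trans (sym (V-per q)) (cong V (arith q d)))) (γ-1 (q + 2 * d)))
        where
        arith : ∀ q d → q + suc (2 * d) ≡ q + 2 * d + 1
        arith = solve-∀

      γ-suc-d : ∀ q → γ (V q) (V (q + suc d)) ≡ ℚ.- ρ
      γ-suc-d q = begin
        A
          ≡⟨ solve 2 (λ a b → a := (a :+ b) :- b) refl A B ⟩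
        (A ℚ.+ B) ℚ.- B
          ≡⟨ cong₂ ℚ._-_ (trans (cong₂ ℚ._+_ (shift (suc d)) (shift (2 * d))) (halves (q + suc d))) (γ-2d q) ⟩
        0ℚ ℚ.- ρ
          ≡⟨ ℚₚ.+-identityˡ (ℚ.- ρ) ⟩
        ℚ.- ρ ∎
        where
        A = γ (V q) (V (q + suc d))
        B = γ (V q) (V (q + 2 * d))
        x≡ : q + suc d + d ≡ q + k
        x≡ = arith q d
          where
          arith : ∀ q d → q + suc d + d ≡ q + suc (2 * d)
          arith = solve-∀
        shift : ∀ o → γ (V q) (V (q + o)) ≡ γ (V (q + suc d + d)) (V (q + suc d + d + o))
        shift o = sym (cong₂ γ (trans (cong V x≡) (V-per q)) (trans (cong (λ l → V (l + o)) x≡) (V-per′ q o)))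

      γ-d : ∀ q → γ (V q) (V (q + d)) ≡ ℚ.- ρ
      γ-d q = trans (γ-sym (V q) (V (q + d))) (trans
        (cong (γ (V (q + d))) (trans (sym (V-per q)) (cong V (arith q d)))) (γ-suc-d (q + d)))
        where
        arith : ∀ q d → q + suc (2 * d) ≡ q + d + suc d
        arith = solve-∀

      -- By now the weight is `ρ` times the agreements at distance 1 minus those at distance `d`,
      -- each counted in both directions. With D changes and E agreements at distance `d`, the
      -- former number k - D, and tightness says D + E = 3. The form `suc r` records that the
      -- resulting factor is positive.
      weight-tight : ∀ g → Tight g → ∃ λ r → weight g ≡ ρ ℚ.* ι (suc r)
      weight-tight g tight with ≤⇒∃+ 2≤d
      ... | d″ , d≡ = r , (begin
        weight g
          ≡⟨ sum-marked 0 (row g) (λ a un → sum-zero (λ b → trans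
               (cong (ℚ._* ind g a b) (unmarked a b (un ∘ proj₁))) (ℚₚ.*-zeroˡ (ind g a b)))) ⟩
        sumℚ {k} (λ o → row g (V (toℕ o)))
          ≡⟨ sum-cong {k} (λ o → row-value (toℕ o)) ⟩
        sumℚ {k} (λ o → ρ ℚ.* (ι (a (toℕ o) + a′ (toℕ o)) ℚ.- ι (e (toℕ o) + e′ (toℕ o))))
          ≡⟨ sym (sum-*ˡ {k} ρ (λ o → ι (a (toℕ o) + a′ (toℕ o)) ℚ.- ι (e (toℕ o) + e′ (toℕ o)))) ⟩
        ρ ℚ.* sumℚ {k} (λ o → ι (a (toℕ o) + a′ (toℕ o)) ℚ.- ι (e (toℕ o) + e′ (toℕ o)))
          ≡⟨ cong (ρ ℚ.*_) (trans (sum-- {k} (λ o → ι (a (toℕ o) + a′ (toℕ o))) (λ o → ι (e (toℕ o) + e′ (toℕ o))))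
               (cong₂ ℚ._-_ (sum-ι k (λ i → a i + a′ i)) (sum-ι k (λ i → e i + e′ i)))) ⟩
        ρ ℚ.* (ι (Σ< k (λ i → a i + a′ i)) ℚ.- ι (Σ< k (λ i → e i + e′ i)))
          ≡⟨ cong (ρ ℚ.*_) (cong₂ (λ x y → ι x ℚ.- ι y)
               (trans (Σ<-+ k a a′) (cong (Σ< k a +_) Σa′)) (trans (Σ<-+ k e e′) (cong (Σ< k e +_) Σe′))) ⟩
        ρ ℚ.* (ι (Σ< k a + Σ< k a) ℚ.- ι (Σ< k e + Σ< k e))
          ≡⟨ cong (λ x → ρ ℚ.* (ι x ℚ.- ι (Σ< k e + Σ< k e))) (trans (cong₂ _+_ Σa Σa) (arith (Σ< k e) d″)) ⟩
        ρ ℚ.* (ι (Σ< k e + Σ< k e + suc r) ℚ.- ι (Σ< k e + Σ< k e))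
          ≡⟨ cong (λ x → ρ ℚ.* (x ℚ.- ι (Σ< k e + Σ< k e))) (ι-+ (Σ< k e + Σ< k e) (suc r)) ⟩
        ρ ℚ.* (ι (Σ< k e + Σ< k e) ℚ.+ ι (suc r) ℚ.- ι (Σ< k e + Σ< k e))
          ≡⟨ solve 3 (λ p x y → p :* (x :+ y :- x) := p :* y) refl ρ (ι (Σ< k e + Σ< k e)) (ι (suc r)) ⟩
        ρ ℚ.* ι (suc r) ∎)
        where
        -- `suc r` is `2 * (k - 3)`, since `k = 5 + 2 * d″`.
        r = suc (2 * d″) + (2 + 2 * d″)
        arith : ∀ e d → e + (2 + 2 * d) + (e + (2 + 2 * d)) ≡ e + e + suc (suc (2 * d) + (2 + 2 * d))
        arith = solve-∀
        h : ℕ → ℕ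
        h i = g (V i)
        a a′ e e′ D : ℕ → ℕ
        a  i = eq (h i) (h (i + 1))
        a′ i = eq (h i) (h (i + 2 * d))
        e  i = eq (h i) (h (i + d))
        e′ i = eq (h i) (h (i + suc d))
        D  i = neq (h i) (h (suc i))
        h-per : Periodic k h
        h-per = V-label-periodic g
        eq-sym : ∀ x y → eq x y ≡ eq y x
        eq-sym x y with x ≟ y | y ≟ x
        ... | yes _ | yes _ = refl
        ... | no _  | no _  = refl
        ... | yes p | no q  = ⊥-elim (q (sym p))
        ... | no p  | yes q = ⊥-elim (p (sym q))
        Σa′ : Σ< k a′ ≡ Σ< k a
        Σa′ = trans (Σ<-cong k {a′} {λ i → a (2 * d + i)} (λ i _ → trans (eq-sym (h i) (h (i + 2 * d)))
          (cong₂ (λ x y → eq (h x) y) (+-comm i (2 * d)) (trans (sym (h-per i)) (cong h (reorder i d))))))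
          (Σ<-rotate k a (agree-periodic k 1 h-per) (2 * d))
          where
          reorder : ∀ i d → i + suc (2 * d) ≡ 2 * d + i + 1
          reorder = solve-∀
        Σe′ : Σ< k e′ ≡ Σ< k e
        Σe′ = trans (Σ<-cong k {e′} {λ i → e (suc d + i)} (λ i _ → trans (eq-sym (h i) (h (i + suc d)))
          (cong₂ (λ x y → eq (h x) y) (+-comm i (suc d)) (trans (sym (h-per i)) (cong h (reorder i d))))))
          (Σ<-rotate k e (agree-periodic k d h-per) (suc d))
          where
          reorder : ∀ i d → i + suc (2 * d) ≡ suc d + i + d
          reorder = solve-∀
        Σa+ΣD : Σ< k a + Σ< k D ≡ k
        Σa+ΣD = trans (sym (Σ<-+ k a D)) (trans (Σ<-cong k {λ i → a i + D i} {λ _ → 1} (λ i _ → trans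
          (cong (λ l → eq (h i) (h l) + D i) (+-comm i 1)) (agree+differ h i (suc i)))) (Σ<-ones k))
        Σa : Σ< k a ≡ Σ< k e + (2 + 2 * d″)
        Σa = +-cancelʳ-≡ (Σ< k D) _ _ (trans Σa+ΣD (trans (cong (λ l → suc (2 * l)) d≡) (trans (arith₂ d″)
          (trans (cong (_+ (2 + 2 * d″)) (trans (sym tight) (Σ<-+ k e D))) (+-rotate (Σ< k e) (Σ< k D) (2 + 2 * d″))))))
          where
          arith₂ : ∀ d → suc (2 * (2 + d)) ≡ 3 + (2 + 2 * d)
          arith₂ = solve-∀
        row-value : ∀ q → row g (V q) ≡ ρ ℚ.* (ι (a q + a′ q) ℚ.- ι (e q + e′ q))
        row-value q = trans (row-marked g q) (trans
          (cong₂ ℚ._+_ (cong₂ ℚ._*_ (γ-1 q) (⟦⟧-eq (h q) (h (q + 1))))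
            (cong₂ ℚ._+_ (cong₂ ℚ._*_ (γ-d q) (⟦⟧-eq (h q) (h (q + d))))
              (cong₂ ℚ._+_ (cong₂ ℚ._*_ (γ-suc-d q) (⟦⟧-eq (h q) (h (q + suc d))))
                (cong₂ ℚ._*_ (γ-2d q) (⟦⟧-eq (h q) (h (q + 2 * d)))))))
          (trans (solve 5 (λ p x y z w → p :* x :+ ((:- p) :* y :+ ((:- p) :* z :+ p :* w)) := p :* ((x :+ w) :-
              (y :+ z)))
            refl ρ (ι (a q)) (ι (e q)) (ι (e′ q)) (ι (a′ q)))
            (cong₂ (λ x y → ρ ℚ.* (x ℚ.- y)) (sym (ι-+ (a q) (a′ q))) (sym (ι-+ (e q) (e′ q))))))

      ρ≡0-by : ∀ g → Good g → Found ⊎ ρ ≡ 0ℚ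
      ρ≡0-by g good-g = do
        W≡0 ← weigh g good-g
        pure (vanish (weight-tight g (Good.tight good-g)) W≡0)
        where
        vanish : (∃ λ r → weight g ≡ ρ ℚ.* ι (suc r)) → weight g ≡ 0ℚ → ρ ≡ 0ℚ
        vanish (r , e) W≡0 = *-cancel-0 (ι-suc≢0 r) (trans (ℚₚ.*-comm (ι (suc r)) ρ) (trans (sym e) W≡0))

      ρ≡0 : Found ⊎ ρ ≡ 0ℚ
      ρ≡0 = ρ≡0-by (arcs (s 0) (suc (s d)) (suc (s d))) (slide-good-upper (slide-half 0))

      all-zero : ρ ≡ 0ℚ → ∀ a b → γ a b ≡ 0ℚ
      all-zero ρ≡0 a b with marked? a | marked? b
      ... | no un | _ = unmarked a b (un ∘ proj₁)
      ... | yes _ | no un = unmarked a b (un ∘ proj₂)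
      ... | yes (q , refl) | yes M with marked-window M q
      ...   | o , o<k , refl with o ≟ 1 | o ≟ d | o ≟ suc d | o ≟ 2 * d
      ...     | yes refl | _ | _ | _ = trans (γ-1 q) ρ≡0
      ...     | no _ | yes refl | _ | _ = trans (γ-d q) (cong ℚ.-_ ρ≡0)
      ...     | no _ | no _ | yes refl | _ = trans (γ-suc-d q) (cong ℚ.-_ ρ≡0)
      ...     | no _ | no _ | no _ | yes refl = trans (γ-2d q) ρ≡0
      ...     | no p | no q′ | no r | no t = far q o o<k p q′ r t

  all-unmarked : Connected G → Found ⊎ (∀ a b → ¬ (Marked a × Marked b) → γ a b ≡ 0ℚ)
  all-unmarked conn = do
    off ← zero-off-cycle conn
    sequence (λ a → sequence (λ b → each off a b))
    where
    each : (∀ a b → ¬ (OnCycle a × OnCycle b) → γ a b ≡ 0ℚ) → ∀ a b → Found ⊎ (¬ (Marked a × Marked b) → γ a b ≡ 0ℚ)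
    each off a b with onCycle? a | onCycle? b
    ... | no a-off | _        = pure (λ _ → off a b (a-off ∘ proj₁))
    ... | yes _    | no b-off = pure (λ _ → off a b (b-off ∘ proj₂))
    ... | yes a-on | yes b-on with marked? a | marked? b
    ...   | yes a-m | yes b-m = pure (λ ¬both → ⊥-elim (¬both (a-m , b-m)))
    ...   | no a-un | _ = do
      e ← zero-unmarked a b a-on b-on a-un
      pure (λ _ → e)
    ...   | yes _ | no b-un = do
      e ← zero-unmarked b a b-on a-on b-un
      pure (λ _ → trans (γ-sym a b) e)

  all-chords : Found ⊎ (∀ q e → 2 ≤ e → e < d → γ (V (q + e)) (V q) ≡ 0ℚ)
  all-chords = for-all-periodic
    (λ q chord e 2≤e e<d → trans (cong₂ γ (V-per′ q e) (V-per q)) (chord e 2≤e e<d))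
    (λ q → do
      zeros ← sequence {d} (λ e → each q (toℕ e) (Finₚ.toℕ<n e))
      pure (λ e 2≤e e<d → subst (λ l → 2 ≤ l → γ (V (q + l)) (V q) ≡ 0ℚ) (Finₚ.toℕ-fromℕ< e<d) (zeros
          (fromℕ< e<d)) 2≤e))
    where
    each : ∀ q e → e < d → Found ⊎ (2 ≤ e → γ (V (q + e)) (V q) ≡ 0ℚ)
    each q e e<d with 2 ≤? e
    ... | no ¬2≤e = pure (λ 2≤e → ⊥-elim (¬2≤e 2≤e))
    ... | yes 2≤e = do
      z ← zero-chord q e 2≤e e<d
      pure (λ _ → z)

  forced : Connected G → Found ⊎ (∀ a b → γ a b ≡ 0ℚ)
  forced conn = do
    unmarked ← all-unmarked conn
    chords ← all-chords
    let open Marks unmarked chords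
    steps ← for-all-periodic
      (λ q e → trans (cong₂ γ (V-per q) (V-per′ q 1)) (trans e (sym (cong₂ γ (V-per′ q 1)
        (trans (cong V (+-assoc (q + k) 1 1)) (trans (V-per′ q 2) (cong V (sym (+-assoc q 1 1)))))))))
      step
    halves ← for-all-periodic
      (λ q e → trans (cong₂ ℚ._+_ (cong₂ γ (V-per′ q d) (shift q (suc d))) (cong₂ γ (V-per′ q d) (shift q (2 * d)))) e)
      half
    let open Proportional steps halves
    z ← ρ≡0
    pure (all-zero z)
    where
    shift : ∀ q o → V (q + k + d + o) ≡ V (q + d + o)
    shift q o = trans (cong V (+-assoc (q + k) d o)) (trans (V-per′ q (d + o)) (cong V (sym (+-assoc q d o))))

-- The walk around the cycle

%-+ˡ : ∀ u y m → (u % suc m + y) % suc m ≡ (u + y) % suc m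
%-+ˡ u y m = begin
  (u % suc m + y) % suc m                        ≡⟨ %-distribˡ-+ (u % suc m) y (suc m) ⟩
  (u % suc m % suc m + y % suc m) % suc m        ≡⟨ cong (λ l → (l + y % suc m) % suc m) (m%n%n≡m%n u (suc m)) ⟩
  (u % suc m + y % suc m) % suc m                ≡⟨ sym (%-distribˡ-+ u y (suc m)) ⟩
  (u + y) % suc m                                ∎
  where open ≡-Reasoning

%-+ʳ : ∀ y u m → (y + u % suc m) % suc m ≡ (y + u) % suc m
%-+ʳ y u m = trans (cong (_% suc m) (+-comm y (u % suc m))) (trans (%-+ˡ u y m) (cong (_% suc m) (+-comm u y)))

-- Adding `x * m` undoes the addition of `x` modulo `suc m`.
%-+-cancel : ∀ m x {o o′} → o < suc m → o′ < suc m → (x + o) % suc m ≡ (x + o′) % suc m → o ≡ o′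
%-+-cancel m x {o} {o′} o<m o′<m e = trans (sym (value o<m)) (trans (trans (sym (%-+ˡ (x + o) (x * m) m))
  (trans (cong (λ l → (l + x * m) % suc m) e) (%-+ˡ (x + o′) (x * m) m))) (value o′<m))
  where
  value : ∀ {o} → o < suc m → (x + o + x * m) % suc m ≡ o
  value {o} o<m = trans (cong (_% suc m) (reorder x o m)) (trans ([m+kn]%n≡m%n o x (suc m)) (m<n⇒m%n≡m o<m))
    where
    reorder : ∀ x o m → x + o + x * m ≡ o + x * suc m
    reorder = solve-∀

toℕ-addMod : ∀ {m} (i : Fin (suc m)) j → toℕ (addMod i j) ≡ (toℕ i + j) % suc m
toℕ-addMod {m} i j = Finₚ.toℕ-fromℕ< (m%n<n (toℕ i + j) (suc m))

addMod-fdist : ∀ {m} (a x : Fin (suc m)) → addMod a (fdist a x) ≡ x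
addMod-fdist {m} a x = Finₚ.toℕ-injective (begin
  toℕ (addMod a (fdist a x))                                ≡⟨ toℕ-addMod a (fdist a x) ⟩
  (toℕ a + (toℕ x + (suc m ∸ toℕ a)) % suc m) % suc m        ≡⟨ %-+ʳ (toℕ a) (toℕ x + (suc m ∸ toℕ a)) m ⟩
  (toℕ a + (toℕ x + (suc m ∸ toℕ a))) % suc m                ≡⟨ cong (_% suc m) (trans (reorder (toℕ a) (toℕ x)
      (suc m ∸ toℕ a))
                                                                (cong (toℕ x +_) (m+[n∸m]≡n (<⇒≤ (Finₚ.toℕ<n a))))) ⟩
  (toℕ x + suc m) % suc m                                   ≡⟨ [m+n]%n≡m%n (toℕ x) (suc m) ⟩
  toℕ x % suc m                                             ≡⟨ m<n⇒m%n≡m (Finₚ.toℕ<n x) ⟩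
  toℕ x                                                     ∎)
  where
  open ≡-Reasoning
  reorder : ∀ a x y → a + (x + y) ≡ x + (a + y)
  reorder = solve-∀

fdist< : ∀ {m} (a x : Fin (suc m)) → fdist a x < suc m
fdist< {m} a x = m%n<n (toℕ x + (suc m ∸ toℕ a)) (suc m)

fdist-self : ∀ {m} (a : Fin (suc m)) → fdist a a ≡ 0
fdist-self {m} a = trans (cong (_% suc m) (m+[n∸m]≡n (<⇒≤ (Finₚ.toℕ<n a)))) (n%n≡0 (suc m))

%-decompose : ∀ k {r} q → r < suc k → (r + q * suc k) % suc k ≡ r × (r + q * suc k) ℕ./ suc k ≡ q
%-decompose k {r} q r<k = trans ([m+kn]%n≡m%n r q (suc k)) (m<n⇒m%n≡m r<k) ,
  trans (+-distrib-/-∣ʳ r (n∣m*n q)) (cong₂ _+_ (m<n⇒m/n≡0 r<k) (m*n/n≡m q (suc k)))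

index : ∀ k → ℕ → Fin (suc k)
index k i = fromℕ< (m%n<n i (suc k))

index-toℕ : ∀ {k} (i : Fin (suc k)) → index k (toℕ i) ≡ i
index-toℕ {k} i = Finₚ.toℕ-injective (trans (Finₚ.toℕ-fromℕ< (m%n<n (toℕ i) (suc k))) (m<n⇒m%n≡m (Finₚ.toℕ<n i)))

index-suc : ∀ k r → index k (suc r) ≡ addMod (index k r) 1
index-suc k r = Finₚ.toℕ-injective (begin
  toℕ (index k (suc r))         ≡⟨ Finₚ.toℕ-fromℕ< (m%n<n (suc r) (suc k)) ⟩
  suc r % suc k                 ≡⟨ cong (_% suc k) (+-comm 1 r) ⟩
  (r + 1) % suc k               ≡⟨ sym (%-+ˡ r 1 k) ⟩
  (r % suc k + 1) % suc k       ≡⟨ cong (λ l → (l + 1) % suc k) (sym (Finₚ.toℕ-fromℕ< (m%n<n r (suc k)))) ⟩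
  (toℕ (index k r) + 1) % suc k ≡⟨ sym (toℕ-addMod (index k r) 1) ⟩
  toℕ (addMod (index k r) 1)    ∎)
  where open ≡-Reasoning

index-periodic : ∀ k r q → index k (r + q * suc k) ≡ index k r
index-periodic k r q = Finₚ.toℕ-injective (trans (Finₚ.toℕ-fromℕ< (m%n<n (r + q * suc k) (suc k)))
  (trans ([m+kn]%n≡m%n r q (suc k)) (sym (Finₚ.toℕ-fromℕ< (m%n<n r (suc k))))))

module BuildFrame {n} {G : Graph n} {m d : ℕ} (2≤d : 2 ≤ d)
  (z : ℕ → Fin n) (z-per : ∀ t → z (t + m) ≡ z t)
  (z-inj : ∀ t o o′ → o < m → o′ < m → z (t + o) ≡ z (t + o′) → o ≡ o′)
  (z-adj : ∀ t → Adj G (z t) (z (suc t)))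
  (S : Fin (suc (2 * d)) → ℕ) (S-0 : S zero ≡ 0) (S< : ∀ i → S i < m)
  (S-suc : ∀ i → suc (toℕ i) < suc (2 * d) → S i < S (addMod i 1)) where

  k : ℕ
  k = suc (2 * d)

  s : ℕ → ℕ
  s i = S (index (2 * d) i) + (i ℕ./ k) * m

  s-value : ∀ r q → r < k → s (r + q * k) ≡ S (index (2 * d) r) + q * m
  s-value r q r<k = cong₂ (λ j l → S j + l * m) (index-periodic (2 * d) r q) (proj₂ (%-decompose (2 * d) q r<k))

  s-suc : ∀ i → s i < s (suc i)
  s-suc i = subst (λ l → s l < s (suc l)) (sym (m≡m%n+[m/n]*n i k)) (go (i % k) (i ℕ./ k) (m%n<n i k))
    where
    go : ∀ r q → r < k → s (r + q * k) < s (suc (r + q * k))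
    go r q r<k with suc r <? k
    ... | yes sr<k = subst₂ _<_ (sym (s-value r q r<k)) (sym (s-value (suc r) q sr<k))
      (+-monoˡ-< (q * m) (subst (λ j → S (index (2 * d) r) < S j) (sym (index-suc (2 * d) r))
        (S-suc (index (2 * d) r) (subst (λ l → suc l < k) (sym (trans (Finₚ.toℕ-fromℕ< (m%n<n r k))
            (m<n⇒m%n≡m r<k))) sr<k))))
    -- At the turn of a lap the times increase because `S` stays below `m`, where the next lap
    -- begins.
    ... | no sr≮k = subst₂ _<_ (sym (s-value r q r<k)) (sym (trans (cong s (cong (_+ q * k) (≤-antisym r<k (≮⇒≥ sr≮k))))
      (trans (s-value 0 (suc q) (s≤s z≤n)) (cong (_+ (m + q * m)) S-0)))) (+-monoˡ-< (q * m) (S< (index (2 * d) r)))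

  s-per : ∀ i → s (i + k) ≡ s i + m
  s-per i = subst (λ l → s (l + k) ≡ s l + m) (sym (m≡m%n+[m/n]*n i k)) (go (i % k) (i ℕ./ k) (m%n<n i k))
    where
    reorder : ∀ r k p → r + p + k ≡ r + (k + p)
    reorder = solve-∀
    reorder′ : ∀ r k p → r + (k + p) ≡ r + p + k
    reorder′ = solve-∀
    go : ∀ r q → r < k → s (r + q * k + k) ≡ s (r + q * k) + m
    go r q r<k = trans (cong s (reorder r k (q * k))) (trans (s-value r (suc q) r<k)
      (trans (reorder′ (S (index (2 * d) r)) m (q * m)) (cong (_+ m) (sym (s-value r q r<k)))))

  frame : Frame G m d
  frame = record
    { 2≤d = 2≤d ; z = z ; z-per = z-per ; z-inj = z-inj ; z-adj = z-adj
    ; s = s ; s-0 = trans (+-identityʳ _) S-0 ; s-suc = s-suc ; s-per = s-per }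

  frame-marks : ∀ i → z (s i) ≡ z (S (index (2 * d) i))
  frame-marks i = periodic-+* m z z-per (S (index (2 * d) i)) (i ℕ./ k)

module FrameOf {n} {G : Graph n} {m d : ℕ} (2≤d : 2 ≤ d) {c : Fin (suc m) → Fin n} (cyc : IsCycle G (suc m) c)
  (v : Fin (suc (2 * d)) → Fin (suc m)) where

  c-inj : ∀ i j → c i ≡ c j → i ≡ j
  c-inj = proj₁ (proj₂ cyc)

  c-adj : ∀ i → Adj G (c i) (c (addMod i 1))
  c-adj = proj₂ (proj₂ cyc)

  Marking : Set
  Marking = Σ (Frame G (suc m) d) λ F → ∀ i → Frame.z F (Frame.s F i) ≡ c (v (index (2 * d) i))

  a : ℕ
  a = toℕ (v zero)

  -- The walk starts at `v zero` and meets `v i` at time `fdist (v zero) (v i)`. The closed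
  -- intervals make these times increase, and the excluded end makes the increase strict.
  forward : (∀ i → suc (toℕ i) < suc (2 * d) → InClOp (v zero) (v (addMod i 1)) (v i)) → Marking
  forward true = frame , λ i → trans (frame-marks i) (cong c (addMod-fdist (v zero) (v (index (2 * d) i))))
    where
    u : ℕ → Fin (suc m)
    u t = addMod (v zero) t
    open BuildFrame {G = G} {m = suc m} 2≤d (λ t → c (u t))
      (λ t → cong c (Finₚ.toℕ-injective (trans (toℕ-addMod (v zero) (t + suc m)) (trans (cong (_% suc m) (sym
          (+-assoc a t (suc m))))
        (trans ([m+n]%n≡m%n (a + t) (suc m)) (sym (toℕ-addMod (v zero) t)))))))
      (λ t o o′ o<m o′<m e → %-+-cancel m (a + t) o<m o′<m (trans (cong (_% suc m) (+-assoc a t o))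
        (trans (sym (toℕ-addMod (v zero) (t + o))) (trans (cong toℕ (c-inj _ _ e))
          (trans (toℕ-addMod (v zero) (t + o′)) (cong (_% suc m) (sym (+-assoc a t o′))))))))
      (λ t → subst (λ w → Adj G (c (u t)) (c w)) (Finₚ.toℕ-injective (trans (toℕ-addMod (u t) 1)
        (trans (cong (λ l → (l + 1) % suc m) (toℕ-addMod (v zero) t)) (trans (%-+ˡ (a + t) 1 m)
          (trans (cong (_% suc m) (trans (+-assoc a t 1) (cong (a +_) (+-comm t 1)))) (sym (toℕ-addMod (v zero)
              (suc t)))))))) (c-adj (u t)))
      (λ i → fdist (v zero) (v i)) (fdist-self (v zero)) (λ i → fdist< (v zero) (v i))
      (λ i i+1<k → ≤∧≢⇒< (proj₁ (true i i+1<k)) (λ e → proj₂ (true i i+1<k)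
        (trans (sym (addMod-fdist (v zero) (v i))) (trans (cong u e) (addMod-fdist (v zero) (v (addMod i 1)))))))

  -- Walking backwards: - t is represented by t * m modulo 1 + m.
  backward : (∀ i → suc (toℕ i) < suc (2 * d) → InOpCl (v (addMod i 1)) (v zero) (v i)) → Marking
  backward true = frame , λ i → trans (frame-marks i) (cong c (u-fdist (v (index (2 * d) i))))
    where
    open ≡-Reasoning
    u : ℕ → Fin (suc m)
    u t = addMod (v zero) (t * m)
    u-fdist : ∀ w → u (fdist w (v zero)) ≡ w
    u-fdist w = Finₚ.toℕ-injective (begin
      toℕ (u D)                                  ≡⟨ toℕ-addMod (v zero) (D * m) ⟩
      (a + D * m) % suc m                        ≡⟨ cong (λ l → (toℕ l + D * m) % suc m) (sym (addMod-fdist w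
          (v zero))) ⟩
      (toℕ (addMod w D) + D * m) % suc m         ≡⟨ cong (λ l → (l + D * m) % suc m) (toℕ-addMod w D) ⟩
      ((toℕ w + D) % suc m + D * m) % suc m      ≡⟨ %-+ˡ (toℕ w + D) (D * m) m ⟩
      (toℕ w + D + D * m) % suc m                ≡⟨ cong (_% suc m) (reorder (toℕ w) D m) ⟩
      (toℕ w + D * suc m) % suc m                ≡⟨ [m+kn]%n≡m%n (toℕ w) D (suc m) ⟩
      toℕ w % suc m                              ≡⟨ m<n⇒m%n≡m (Finₚ.toℕ<n w) ⟩
      toℕ w                                      ∎)
      where
      D = fdist w (v zero)
      reorder : ∀ w D m → w + D + D * m ≡ w + D * suc m
      reorder = solve-∀
    u-inj : ∀ t o o′ → o < suc m → o′ < suc m → u (t + o) ≡ u (t + o′) → o ≡ o′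
    u-inj t o o′ o<m o′<m e = sym (%-+-cancel m (a + t * m) o′<m o<m (begin
      (a + t * m + o′) % suc m                    ≡⟨ sym ([m+kn]%n≡m%n (a + t * m + o′) o (suc m)) ⟩
      (a + t * m + o′ + o * suc m) % suc m        ≡⟨ cong (_% suc m) (reorder a t m o o′) ⟩
      (a + (t + o) * m + (o + o′)) % suc m        ≡⟨ sym (%-+ˡ (a + (t + o) * m) (o + o′) m) ⟩
      ((a + (t + o) * m) % suc m + (o + o′)) % suc m
        ≡⟨ cong (λ l → (l + (o + o′)) % suc m) (trans (sym (toℕ-addMod (v zero) ((t + o) * m))) (trans (cong toℕ e)
            (toℕ-addMod (v zero) ((t + o′) * m)))) ⟩
      ((a + (t + o′) * m) % suc m + (o + o′)) % suc m ≡⟨ %-+ˡ (a + (t + o′) * m) (o + o′) m ⟩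
      (a + (t + o′) * m + (o + o′)) % suc m       ≡⟨ cong (_% suc m) (reorder′ a t m o o′) ⟩
      (a + t * m + o + o′ * suc m) % suc m        ≡⟨ [m+kn]%n≡m%n (a + t * m + o) o′ (suc m) ⟩
      (a + t * m + o) % suc m                     ∎))
      where
      reorder : ∀ a t m o o′ → a + t * m + o′ + o * suc m ≡ a + (t + o) * m + (o + o′)
      reorder = solve-∀
      reorder′ : ∀ a t m o o′ → a + (t + o′) * m + (o + o′) ≡ a + t * m + o + o′ * suc m
      reorder′ = solve-∀
    u-suc : ∀ t → addMod (u (suc t)) 1 ≡ u t
    u-suc t = Finₚ.toℕ-injective (begin
      toℕ (addMod (u (suc t)) 1)               ≡⟨ toℕ-addMod (u (suc t)) 1 ⟩
      (toℕ (u (suc t)) + 1) % suc m            ≡⟨ cong (λ l → (l + 1) % suc m) (toℕ-addMod (v zero) (suc t * m)) ⟩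
      ((a + suc t * m) % suc m + 1) % suc m    ≡⟨ %-+ˡ (a + suc t * m) 1 m ⟩
      (a + suc t * m + 1) % suc m              ≡⟨ cong (_% suc m) (reorder a t m) ⟩
      (a + t * m + suc m) % suc m              ≡⟨ [m+n]%n≡m%n (a + t * m) (suc m) ⟩
      (a + t * m) % suc m                      ≡⟨ sym (toℕ-addMod (v zero) (t * m)) ⟩
      toℕ (u t)                                ∎)
      where
      reorder : ∀ a t m → a + suc t * m + 1 ≡ a + t * m + suc m
      reorder = solve-∀
    u-per : ∀ t → u (t + suc m) ≡ u t
    u-per t = Finₚ.toℕ-injective (begin
      toℕ (u (t + suc m))                 ≡⟨ toℕ-addMod (v zero) ((t + suc m) * m) ⟩
      (a + (t + suc m) * m) % suc m       ≡⟨ cong (_% suc m) (reorder a t m) ⟩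
      (a + t * m + m * suc m) % suc m     ≡⟨ [m+kn]%n≡m%n (a + t * m) m (suc m) ⟩
      (a + t * m) % suc m                 ≡⟨ sym (toℕ-addMod (v zero) (t * m)) ⟩
      toℕ (u t)                           ∎)
      where
      reorder : ∀ a t m → a + (t + suc m) * m ≡ a + t * m + m * suc m
      reorder = solve-∀
    -- Going forward, `w` lies between `b` and `v zero`, so the distance from `w` to `v zero` is
    -- what `fdist b w` leaves of the distance from `b`.
    closer : ∀ b w → fdist b w ≤ fdist b (v zero) → w ≢ b → fdist w (v zero) < fdist b (v zero)
    closer b w le w≢b = subst (_< D₂) (sym E≡) (subst (D₂ ∸ D₁ <_) (m∸n+n≡m le) (m<m+n (D₂ ∸ D₁) 0<D₁))
      where
      D₁ = fdist b w
      D₂ = fdist b (v zero)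
      0<D₁ : 0 < D₁
      0<D₁ = n≢0⇒n>0 λ D₁≡0 → w≢b (trans (sym (addMod-fdist b w)) (trans (cong (addMod b) D₁≡0) (Finₚ.toℕ-injective
        (trans (toℕ-addMod b 0) (trans (cong (_% suc m) (+-identityʳ (toℕ b))) (m<n⇒m%n≡m (Finₚ.toℕ<n b)))))))
      E≡ : fdist w (v zero) ≡ D₂ ∸ D₁
      E≡ = %-+-cancel m (toℕ w) (fdist< w (v zero)) (≤-trans (s≤s (m∸n≤m D₂ D₁)) (fdist< b (v zero))) (begin
        (toℕ w + fdist w (v zero)) % suc m                ≡⟨ sym (toℕ-addMod w (fdist w (v zero))) ⟩
        toℕ (addMod w (fdist w (v zero)))                 ≡⟨ cong toℕ (trans (addMod-fdist w (v zero)) (sym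
            (addMod-fdist b (v zero)))) ⟩
        toℕ (addMod b D₂)                                 ≡⟨ toℕ-addMod b D₂ ⟩
        (toℕ b + D₂) % suc m                              ≡⟨ cong (λ l → (toℕ b + l) % suc m) (sym (m+[n∸m]≡n le)) ⟩
        (toℕ b + (D₁ + (D₂ ∸ D₁))) % suc m                ≡⟨ cong (_% suc m) (sym (+-assoc (toℕ b) D₁ (D₂ ∸ D₁))) ⟩
        (toℕ b + D₁ + (D₂ ∸ D₁)) % suc m                  ≡⟨ sym (%-+ˡ (toℕ b + D₁) (D₂ ∸ D₁) m) ⟩
        ((toℕ b + D₁) % suc m + (D₂ ∸ D₁)) % suc m        ≡⟨ cong (λ l → (l + (D₂ ∸ D₁)) % suc m) (trans (sym
            (toℕ-addMod b D₁)) (cong toℕ (addMod-fdist b w))) ⟩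
        (toℕ w + (D₂ ∸ D₁)) % suc m                       ∎)
    open BuildFrame {G = G} {m = suc m} 2≤d (λ t → c (u t)) (λ t → cong c (u-per t))
      (λ t o o′ p q e → u-inj t o o′ p q (c-inj _ _ e))
      (λ t → symm G (subst (λ w → Adj G (c (u (suc t))) (c w)) (u-suc t) (c-adj (u (suc t)))))
      (λ i → fdist (v i) (v zero)) (fdist-self (v zero)) (λ i → fdist< (v i) (v zero))
      (λ i i+1<k → closer (v (addMod i 1)) (v i) (proj₁ (true i i+1<k)) (proj₂ (true i i+1<k)))

  marking : TrueTo v → Marking
  marking = [ forward , backward ]′

-- The facet

-- Each block is named after its least vertex.
canonical : ∀ {n} → (Fin n → ℕ) → Fin n → Fin n
canonical {suc n} g zero    = zero
canonical {suc n} g (suc a) with g (suc a) ≟ g zero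
... | yes _ = zero
... | no  _ = suc (canonical (λ x → g (suc x)) a)

canonical-reflects : ∀ {n} (g : Fin n → ℕ) a b → canonical g a ≡ canonical g b → g a ≡ g b
canonical-reflects {suc n} g zero    zero    e = refl
canonical-reflects {suc n} g zero    (suc b) e with g (suc b) ≟ g zero
... | yes p = sym p
canonical-reflects {suc n} g (suc a) zero    e with g (suc a) ≟ g zero
... | yes p = p
canonical-reflects {suc n} g (suc a) (suc b) e with g (suc a) ≟ g zero | g (suc b) ≟ g zero
... | yes p | yes q = trans p (sym q)
... | no _  | no _  = canonical-reflects (λ x → g (suc x)) a b (Finₚ.suc-injective e)

canonical-cong : ∀ {n} (g : Fin n → ℕ) a b → g a ≡ g b → canonical g a ≡ canonical g b
canonical-cong {suc n} g zero    zero    e = refl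
canonical-cong {suc n} g zero    (suc b) e with g (suc b) ≟ g zero
... | yes p = refl
... | no ¬p = ⊥-elim (¬p (sym e))
canonical-cong {suc n} g (suc a) zero    e with g (suc a) ≟ g zero
... | yes p = refl
... | no ¬p = ⊥-elim (¬p e)
canonical-cong {suc n} g (suc a) (suc b) e with g (suc a) ≟ g zero | g (suc b) ≟ g zero
... | yes p | yes q = refl
... | no _  | no _  = cong suc (canonical-cong (λ x → g (suc x)) a b e)
... | yes p | no ¬q = ⊥-elim (¬q (trans (sym e) p))
... | no ¬p | yes q = ⊥-elim (¬p (trans e q))

liftedMulticut-ind : ∀ {n} (f : Fin n → Fin n) (g : Fin n → ℕ) → (∀ a b → f a ≡ f b → g a ≡ g b) → (∀ a b → g a ≡ g b
    → f a ≡ f b) →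
  ∀ p → liftedMulticut f p ≡ 1ℚ ℚ.- onPair (ind g) p
liftedMulticut-ind f g to from (a , b , p) with f a Fin.≟ f b
... | yes e = sym (cong (λ q → 1ℚ ℚ.- q) (ind-≡ g (to a b e)))
... | no ne = sym (cong (λ q → 1ℚ ℚ.- q) (ind-≢ g (λ e → ne (from a b e))))

coord-1-ind : ∀ {n} {x : Vect n} (g : Fin n → ℕ) → (∀ p → x p ≡ 1ℚ ℚ.- onPair (ind g) p) →
  ∀ a b → coord x a b ≡ 1ℚ ℚ.- ind g a b
coord-1-ind {x = x} g e a b with Finₚ.<-cmp a b
... | tri< p _ _    = trans (coord-pair x a b p) (e (a , b , p))
... | tri≈ _ refl _ = trans (coord-diag x a) (sym (cong (λ q → 1ℚ ℚ.- q) (ind-≡ g refl)))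
... | tri> _ _ p    = trans (coord-pair′ x b a p) (trans (e (b , a , p))
  (cong (λ q → 1ℚ ℚ.- q) (⟦⟧-cong (g b ≟ g a) (g a ≟ g b) sym sym)))

module _ {n m : ℕ} (d : ℕ) (c : Fin m → Fin n) (v : Fin (suc (2 * d)) → Fin m) where
  open ≡-Reasoning

  private
    k : ℕ
    k = suc (2 * d)
    α : Vect n → ℚ
    α = halfChordedLHS c v d
    term : Vect n → Fin k → ℚ
    term x i = coord x (c (v i)) (c (v (addMod i d))) ℚ.- coord x (c (v i)) (c (v (addMod i 1)))

  lhs-cong : ∀ {x y : Vect n} → (∀ p → x p ≡ y p) → α x ≡ α y
  lhs-cong e = sum-cong {k} (λ i → cong₂ ℚ._-_ (coord-cong e (c (v i)) (c (v (addMod i d)))) (coord-cong e (c (v i))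
      (c (v (addMod i 1)))))

  lhs-combination : ∀ {t} (λs : Fin t → ℚ) (y : Fin t → Vect n) →
    α (λ p → sumℚ (λ j → λs j ℚ.* y j p)) ≡ sumℚ (λ j → λs j ℚ.* α (y j))
  lhs-combination λs y = begin
    α (λ p → sumℚ (λ j → λs j ℚ.* y j p))
      ≡⟨ sum-cong {k} (λ i → trans (cong₂ ℚ._-_ (coord-combination λs y (c (v i)) (c (v (addMod i d))))
                                                (coord-combination λs y (c (v i)) (c (v (addMod i 1)))))
           (sym (sum-- (λ j → λs j ℚ.* coord (y j) (c (v i)) (c (v (addMod i d)))) (λ j → λs j ℚ.* coord (y j) (c
               (v i)) (c (v (addMod i 1))))))) ⟩
    sumℚ {k} (λ i → sumℚ (λ j → λs j ℚ.* coord (y j) (c (v i)) (c (v (addMod i d))) ℚ.- λs j ℚ.* coord (y j) (c (v i))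
        (c (v (addMod i 1)))))
      ≡⟨ sum-swap {k} (λ i j → λs j ℚ.* coord (y j) (c (v i)) (c (v (addMod i d))) ℚ.- λs j ℚ.* coord (y j) (c (v i))
          (c (v (addMod i 1)))) ⟩
    sumℚ (λ j → sumℚ {k} (λ i → λs j ℚ.* coord (y j) (c (v i)) (c (v (addMod i d))) ℚ.- λs j ℚ.* coord (y j) (c (v i))
        (c (v (addMod i 1)))))
      ≡⟨ sum-cong (λ j → trans (sum-cong {k} (λ i → solve 3 (λ l p q → l :* p :- l :* q := l :* (p :- q)) refl
           (λs j) (coord (y j) (c (v i)) (c (v (addMod i d)))) (coord (y j) (c (v i)) (c (v (addMod i 1))))))
           (sym (sum-*ˡ {k} (λs j) (term (y j))))) ⟩
    sumℚ (λ j → λs j ℚ.* α (y j)) ∎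

  mark : ℕ → Fin n
  mark i = c (v (index (2 * d) i))

  mark-periodic : Periodic k mark
  mark-periodic i = cong (c ∘ v) (trans (cong (index (2 * d)) (cong (i +_) (sym (+-identityʳ k)))) (index-periodic
      (2 * d) i 1))

  lhs-deficit : ∀ {x : Vect n} (g : Fin n → ℕ) → (∀ p → x p ≡ 1ℚ ℚ.- onPair (ind g) p) →
    α x ≡ ι k ℚ.- ι (Σ< k (deficit d (λ i → g (mark i))))
  lhs-deficit {x} g e = begin
    α x
      ≡⟨ sum-cong {k} (λ i → value (toℕ i) (cong (c ∘ v) (sym (index-toℕ i)))) ⟩
    sumℚ {k} (λ i → ι 1 ℚ.- ι (deficit d h (toℕ i)))
      ≡⟨ sum-- {k} (λ i → ι 1) (λ i → ι (deficit d h (toℕ i))) ⟩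
    sumℚ {k} (λ i → ι 1) ℚ.- sumℚ {k} (λ i → ι (deficit d h (toℕ i)))
      ≡⟨ cong₂ ℚ._-_ (trans (sum-ι k (λ _ → 1)) (cong ι (Σ<-ones k))) (sum-ι k (deficit d h)) ⟩
    ι k ℚ.- ι (Σ< k (deficit d h)) ∎
    where
    h : ℕ → ℕ
    h i = g (mark i)
    value : ∀ i {u} → u ≡ mark i → coord x u (mark (i + d)) ℚ.- coord x u (mark (i + 1)) ≡ ι 1 ℚ.- ι (deficit d h i)
    value i refl = begin
      coord x (mark i) (mark (i + d)) ℚ.- coord x (mark i) (mark (i + 1))
        ≡⟨ cong₂ ℚ._-_ (trans (coord-1-ind g e (mark i) (mark (i + d))) (cong (λ q → 1ℚ ℚ.- q) (⟦⟧-eq (h i) (h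
            (i + d)))))
             (trans (coord-1-ind g e (mark i) (mark (i + 1))) (cong (λ q → 1ℚ ℚ.- q) (trans (⟦⟧-eq (h i) (h (i + 1)))
                 (cong (λ l → ι (eq (h i) (h l))) (+-comm i 1))))) ⟩
      (1ℚ ℚ.- ι E) ℚ.- (1ℚ ℚ.- ι A)
        -- One of the two units is written as `A + D`, agreement plus change of consecutive labels;
        -- this turns `A - E` into `1 - (E + D)`.
        ≡⟨ cong (λ o → (1ℚ ℚ.- ι E) ℚ.- (o ℚ.- ι A)) (trans (cong ι (sym (agree+differ h i (suc i)))) (ι-+ A D)) ⟩
      (1ℚ ℚ.- ι E) ℚ.- ((ι A ℚ.+ ι D) ℚ.- ι A)
        ≡⟨ solve 3 (λ e a d → (con 1ℚ :- e) :- ((a :+ d) :- a) := con 1ℚ :- (e :+ d)) refl (ι E) (ι A) (ι D) ⟩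
      1ℚ ℚ.- (ι E ℚ.+ ι D)
        ≡⟨ cong (λ q → 1ℚ ℚ.- q) (sym (ι-+ E D)) ⟩
      ι 1 ℚ.- ι (deficit d h i) ∎
      where
      E = eq (h i) (h (i + d))
      A = eq (h i) (h (suc i))
      D = neq (h i) (h (suc i))

-- Affine independence as linear independence of the homogenised points

hom : ∀ {n} → Vect n → Fin (suc (numPairs n)) → ℚ
hom x = cons 1ℚ (λ i → x (pairAt i))

LinIndep⇒AffinelyIndependent : ∀ {n t} (y : Fin t → Vect n) → LinIndep (λ j → hom (y j)) → AffinelyIndependent y
LinIndep⇒AffinelyIndependent y ind λs Σλ Σy = ind λs λ
  { zero    → trans (sum-cong (λ j → ℚₚ.*-identityʳ (λs j))) Σλ
  ; (suc i) → Σy (pairAt i) }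

-- A nontrivial solution of the homogeneous system with the homogenised points as columns is an
-- affine dependence: the row of ones gives the condition on the sum of the coefficients.
no-more-than-suc-numPairs : ∀ {n} (y : Fin (suc (suc (numPairs n))) → Vect n) → ¬ AffinelyIndependent y
no-more-than-suc-numPairs {n} y ind with underdetermined (λ i j → hom (y j) i)
... | x , (j , xⱼ≢0) , sol = xⱼ≢0 (ind x
  (trans (sum-cong (λ j → sym (ℚₚ.*-identityˡ (x j)))) (sol zero))
  (λ p → subst (λ q → sumℚ (λ j → x j ℚ.* y j q) ≡ 0ℚ) (pairAt-indexOf p)
    (trans (sum-cong (λ j → ℚₚ.*-comm (x j) (y j (pairAt (indexOf p))))) (sol (suc (indexOf p)))))
  j)

LinIndep-tail : ∀ {t M} {w : Fin M → ℚ} {y : Fin t → Fin M → ℚ} → LinIndep (cons w y) → LinIndep y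
LinIndep-tail {w = w} {y} ind λs rel j = ind (cons 0ℚ λs)
  (λ i → trans (cong₂ ℚ._+_ (ℚₚ.*-zeroˡ (w i)) (rel i)) refl) (suc j)

vertex∈LMC : ∀ {n} (G : Graph n) (f : Fin n → Fin n) → IsDecomposition G f → LMC G (liftedMulticut f)
vertex∈LMC G f dec = 1 , (λ _ → liftedMulticut f) , (λ _ → 1ℚ) , (λ _ → f , dec , λ p → refl) ,
  (λ _ → ℚₚ.nonNegative⁻¹ 1ℚ) , refl , λ p → sym (trans (ℚₚ.+-identityʳ _) (ℚₚ.*-identityˡ (liftedMulticut f p)))

-- Validity, and the dimensions of the polytope and of the face.

module Main {n} {G : Graph n} (conn : Connected G) {m d : ℕ} (c : Fin m → Fin n) (v : Fin (suc (2 * d)) → Fin m)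
  (F : Frame G m d) (marks : ∀ i → Frame.z F (Frame.s F i) ≡ mark d c v i) where
  open FrameProperties F

  private
    α : Vect n → ℚ
    α = halfChordedLHS c v d

  r : ℕ
  r = k ∸ 3

  β : ℚ
  β = ι r

  k≡3+r : k ≡ 3 + r
  k≡3+r = sym (m+[n∸m]≡n (s≤s (≤-trans 2≤d (m≤m+n d (d + 0)))))

  β≢0 : β ≢ 0ℚ
  β≢0 with ≤⇒∃+ 2≤d
  ... | e , d≡ = λ β≡0 → ι-suc≢0 (suc (2 * e)) (trans (cong ι (+-cancelˡ-≡ 3 _ _ (trans (sym (arith e)) (trans (cong
      (λ l → suc (2 * l)) (sym d≡)) k≡3+r)))) β≡0)
    where
    arith : ∀ e → suc (2 * (2 + e)) ≡ 3 + suc (suc (2 * e))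
    arith = solve-∀

  lhs-value : ∀ t → ι k ℚ.- ι (3 + t) ≡ β ℚ.- ι t
  lhs-value t = trans (cong₂ ℚ._-_ (trans (cong ι k≡3+r) (ι-+ 3 r)) (ι-+ 3 t))
    (solve 3 (λ a b c → (a :+ b) :- (a :+ c) := b :- c) refl (ι 3) β (ι t))

  vertex-valid : ∀ f → α (liftedMulticut f) ℚ.≤ β
  vertex-valid f with ≤⇒∃+ (deficit≥3 d 1≤d (λ i → toℕ (f (mark d c v i))) (λ i → cong (toℕ ∘ f)
      (mark-periodic d c v i)))
  ... | t , e = begin
    α (liftedMulticut f)   ≡⟨ lhs-deficit d c v (toℕ ∘ f) (liftedMulticut-ind f (toℕ ∘ f) (λ _ _ → cong toℕ) (λ _ _
        → Finₚ.toℕ-injective)) ⟩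
    ι k ℚ.- ι (Σ< k (deficit d (λ i → toℕ (f (mark d c v i))))) ≡⟨ cong (λ l → ι k ℚ.- ι l) e ⟩
    ι k ℚ.- ι (3 + t)      ≡⟨ lhs-value t ⟩
    β ℚ.- ι t              ≤⟨ ℚₚ.+-monoʳ-≤ β (ℚₚ.neg-antimono-≤ (0≤ι t)) ⟩
    β ℚ.+ 0ℚ               ≡⟨ ℚₚ.+-identityʳ β ⟩
    β                      ∎
    where open ℚₚ.≤-Reasoning

  valid : ∀ x → LMC G x → α x ℚ.≤ β
  valid x (t , y , λs , y∈ , λ≥0 , Σλ , x≡) = begin
    α x                                  ≡⟨ lhs-cong d c v x≡ ⟩
    α (λ p → sumℚ (λ j → λs j ℚ.* y j p)) ≡⟨ lhs-combination d c v λs y ⟩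
    sumℚ (λ j → λs j ℚ.* α (y j))        ≤⟨ sum-mono (λ j → ℚₚ.*-monoˡ-≤-nonNeg (λs j) {{ℚ.nonNegative (λ≥0 j)}}
        (each j)) ⟩
    sumℚ (λ j → λs j ℚ.* β)              ≡⟨ sym (sum-*ʳ β λs) ⟩
    sumℚ λs ℚ.* β                        ≡⟨ cong (ℚ._* β) Σλ ⟩
    1ℚ ℚ.* β                             ≡⟨ ℚₚ.*-identityˡ β ⟩
    β                                    ∎
    where
    open ℚₚ.≤-Reasoning
    each : ∀ j → α (y j) ℚ.≤ β
    each j = let (f , _ , y≡) = y∈ j in subst (ℚ._≤ β) (sym (lhs-cong d c v y≡)) (vertex-valid f)

  vertex : (Fin n → ℕ) → Vect n
  vertex g = liftedMulticut (canonical g)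

  vertex-ind : ∀ g p → vertex g p ≡ 1ℚ ℚ.- onPair (ind g) p
  vertex-ind g = liftedMulticut-ind (canonical g) g (canonical-reflects g) (canonical-cong g)

  vertex∈ : ∀ g → Decomposition G g → LMC G (vertex g)
  vertex∈ g dec = vertex∈LMC G (canonical g) (λ a b e → gmap id
    (λ { (uw , gu , gw) → uw , canonical-cong g _ _ gu , canonical-cong g _ _ gw }) (dec a b
        (canonical-reflects g a b e)))

  tight-face : ∀ g → Good g → LMC G (vertex g) × α (vertex g) ≡ β
  tight-face g (good dec tight) = vertex∈ g dec , (begin
    α (vertex g)                                         ≡⟨ lhs-deficit d c v g (vertex-ind g) ⟩
    ι k ℚ.- ι (Σ< k (deficit d (λ i → g (mark d c v i))))  ≡⟨ cong (λ l → ι k ℚ.- ι l) (trans (Σ<-cong k {deficit d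
        (λ i → g (mark d c v i))} {deficit d (λ i → g (V i))} same) tight) ⟩
    ι k ℚ.- ι (3 + 0)                                    ≡⟨ lhs-value 0 ⟩
    β ℚ.- ι 0                                            ≡⟨ ℚₚ.+-identityʳ β ⟩
    β                                                    ∎)
    where
    open ≡-Reasoning
    same : ∀ i → i < k → deficit d (λ i → g (mark d c v i)) i ≡ deficit d (λ i → g (V i)) i
    same i _ = cong₂ _+_ (cong₂ eq (cong g (sym (marks i))) (cong g (sym (marks (i + d)))))
                         (cong₂ neq (cong g (sym (marks i))) (cong g (sym (marks (suc i)))))

  singletons : Vect n
  singletons = vertex toℕ

  singletons∈ : LMC G singletons
  singletons∈ = vertex∈ toℕ (λ a b e → subst (Star _ a) (Finₚ.toℕ-injective e) ε)

  singletons-1 : ∀ p → singletons p ≡ 1ℚ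
  singletons-1 p@(a , b , a<b) = trans (vertex-ind toℕ p) (cong (λ q → 1ℚ ℚ.- q) (ind-≢ toℕ (λ e → <-irrefl e a<b)))

  lhs-singletons : α singletons ≡ 0ℚ
  lhs-singletons = trans (lhs-deficit d c v toℕ (vertex-ind toℕ)) (trans (cong (λ l → ι k ℚ.- ι l) total)
      (ℚₚ.+-inverseʳ (ι k)))
    where
    distinct : ∀ i {o} → o < k → o ≢ 0 → toℕ (mark d c v i) ≢ toℕ (mark d c v (i + o))
    distinct i {o} o<k o≢0 e = o≢0 (sym (V-inj i 0 o (s≤s z≤n) o<k
      (trans (cong V (+-identityʳ i)) (trans (marks i) (trans (Finₚ.toℕ-injective e) (sym (marks (i + o))))))))
    h : ℕ → ℕ
    h i = toℕ (mark d c v i)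
    total : Σ< k (deficit d h) ≡ k
    total = trans (Σ<-cong k {deficit d h} {λ _ → 1} (λ i _ → cong₂ _+_
        (agree-≢ h {i} {i + d} (distinct i (s≤s (m≤m+n d (d + 0))) (λ d≡0 → <-irrefl (sym d≡0) 1≤d)))
        (trans (sym (cong (_+ differ h i (suc i)) (agree-≢ h {i} {suc i}
            (subst (λ l → h i ≢ h l) (+-comm i 1) (distinct i (s≤s (≤-trans 1≤d (m≤m+n d (d + 0)))) (λ ()))))))
          (agree+differ h i (suc i)))))
      (Σ<-ones k)

  OnFace : (Fin (suc (numPairs n)) → ℚ) → Set
  OnFace x = Σ (Fin n → ℕ) λ g → Good g × (∀ i → x i ≡ hom (vertex g) i)

  -- The pair coordinates of `γ` form the symmetric matrix `γ̂`. Were it zero, the constant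
  -- coordinate would be the value at the singletons, hence 0 as well; so `Conclusion.forced` must
  -- end with a separating point.
  separating : ∀ γ → NonZeroVec γ → hom singletons ∙ γ ≡ 0ℚ →
    Σ (Fin (suc (numPairs n)) → ℚ) λ x → OnFace x × x ∙ γ ≢ 0ℚ
  separating γ (i , γᵢ≢0) w·γ≡0 = conclude (Conclusion.forced F γ̂ γ̂-sym γ̂-diag Found weigh conn)
    where
    open ≡-Reasoning
    Found : Set
    Found = Σ (Fin (suc (numPairs n)) → ℚ) λ x → OnFace x × x ∙ γ ≢ 0ℚ
    Γ : Vect n
    Γ p = γ (suc (indexOf p))
    γ̂ : Fin n → Fin n → ℚ
    γ̂ = coord Γ
    γ̂-sym : ∀ a b → γ̂ a b ≡ γ̂ b a
    γ̂-sym = coord-sym Γ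
    γ̂-diag : ∀ a → γ̂ a a ≡ 0ℚ
    γ̂-diag = coord-diag Γ
    open Weights γ̂ γ̂-sym γ̂-diag
    γ̂-pairAt : ∀ i → onPair γ̂ (pairAt i) ≡ γ (suc i)
    γ̂-pairAt i = trans (coord-pair Γ _ _ (proj₂ (proj₂ (pairAt i)))) (cong (γ ∘ suc) (indexOf-pairAt {n} i))
    half : (Fin n → ℕ) → ℚ
    half g = sumℚ (λ i → onPair (λ a b → γ̂ a b ℚ.* ind g a b) (pairAt {n} i))
    half-value : ∀ g → half g ≡ hom singletons ∙ γ ℚ.- hom (vertex g) ∙ γ
    half-value g = begin
      half g
        ≡⟨ sum-cong (λ i → pointwise i) ⟩
      sumℚ (λ i → singletons (pairAt i) ℚ.* γ (suc i) ℚ.- vertex g (pairAt i) ℚ.* γ (suc i))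
        ≡⟨ sum-- (λ i → singletons (pairAt i) ℚ.* γ (suc i)) (λ i → vertex g (pairAt i) ℚ.* γ (suc i)) ⟩
      A ℚ.- B
        -- The constant coordinate contributes equally to both points and cancels.
        ≡⟨ solve 3 (λ a b o → a :- b := (o :+ a) :- (o :+ b)) refl A B (1ℚ ℚ.* γ zero) ⟩
      hom singletons ∙ γ ℚ.- hom (vertex g) ∙ γ ∎
      where
      A = sumℚ (λ i → singletons (pairAt {n} i) ℚ.* γ (suc i))
      B = sumℚ (λ i → vertex g (pairAt {n} i) ℚ.* γ (suc i))
      pointwise : ∀ i → onPair (λ a b → γ̂ a b ℚ.* ind g a b) (pairAt i) ≡ singletons (pairAt i) ℚ.* γ
          (suc i) ℚ.- vertex g (pairAt i) ℚ.* γ (suc i)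
      pointwise i = begin
        onPair γ̂ (pairAt i) ℚ.* onPair (ind g) (pairAt i)
          ≡⟨ cong (ℚ._* onPair (ind g) (pairAt i)) (γ̂-pairAt i) ⟩
        γ (suc i) ℚ.* onPair (ind g) (pairAt i)
          ≡⟨ solve 2 (λ x y → x :* y := con 1ℚ :* x :- (con 1ℚ :- y) :* x) refl (γ (suc i)) (onPair (ind g)
              (pairAt i)) ⟩
        1ℚ ℚ.* γ (suc i) ℚ.- (1ℚ ℚ.- onPair (ind g) (pairAt i)) ℚ.* γ (suc i)
          ≡⟨ sym (cong₂ (λ x y → x ℚ.* γ (suc i) ℚ.- y ℚ.* γ (suc i)) (singletons-1 (pairAt i)) (vertex-ind g
              (pairAt i))) ⟩
        singletons (pairAt i) ℚ.* γ (suc i) ℚ.- vertex g (pairAt i) ℚ.* γ (suc i) ∎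
    ind-sym : ∀ (g : Fin n → ℕ) a b → ind g a b ≡ ind g b a
    ind-sym g a b = ⟦⟧-cong (g a ≟ g b) (g b ≟ g a) sym sym
    -- A nonzero value ends the search. Otherwise the weight, twice the difference between the
    -- values at the singletons and at `vertex g`, is 0.
    weigh : ∀ g → Good g → Found ⊎ weight g ≡ 0ℚ
    weigh g G′ with hom (vertex g) ∙ γ ℚₚ.≟ 0ℚ
    ... | no ≢0  = inj₁ (hom (vertex g) , (g , G′ , λ i → refl) , ≢0)
    ... | yes ≡0 = inj₂ (begin
      weight g
        ≡⟨ sum-square (λ a b → γ̂ a b ℚ.* ind g a b) (λ a b → cong₂ ℚ._*_ (γ̂-sym a b) (ind-sym g a b))
             (λ a → trans (cong (ℚ._* ind g a a) (γ̂-diag a)) (ℚₚ.*-zeroˡ (ind g a a))) ⟩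
      half g ℚ.+ half g
        ≡⟨ cong₂ ℚ._+_ half≡0 half≡0 ⟩
      0ℚ ∎)
      where
      half≡0 : half g ≡ 0ℚ
      half≡0 = trans (half-value g) (cong₂ ℚ._-_ w·γ≡0 ≡0)
    conclude : Found ⊎ (∀ a b → γ̂ a b ≡ 0ℚ) → Found
    conclude (inj₁ found) = found
    conclude (inj₂ zero-γ̂) = ⊥-elim (γᵢ≢0 (vanishes i))
      where
      tail : ∀ i → γ (suc i) ≡ 0ℚ
      tail i = trans (sym (γ̂-pairAt i)) (zero-γ̂ (proj₁ (pairAt i)) (proj₁ (proj₂ (pairAt i))))
      vanishes : ∀ i → γ i ≡ 0ℚ
      vanishes (suc i) = tail i
      vanishes zero = begin
        γ zero
          ≡⟨ solve 1 (λ x → x := con 1ℚ :* x :+ con 0ℚ) refl (γ zero) ⟩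
        1ℚ ℚ.* γ zero ℚ.+ 0ℚ
          ≡⟨ cong (1ℚ ℚ.* γ zero ℚ.+_) (sym (sum-zero (λ i → trans (cong (singletons (pairAt {n} i) ℚ.*_) (tail i))
              (ℚₚ.*-zeroʳ (singletons (pairAt i)))))) ⟩
        hom singletons ∙ γ
          ≡⟨ w·γ≡0 ⟩
        0ℚ ∎

  facet : FacetDefining (LMC G) α β
  facet = valid , numPairs n ,
    ((cons singletons y , (λ { zero → singletons∈ ; (suc j) → proj₁ (y-face j) }) ,
       LinIndep⇒AffinelyIndependent (cons singletons y) indep) ,
     λ { (x , _ , aff) → no-more-than-suc-numPairs x aff }) ,
    ((y , y-face , LinIndep⇒AffinelyIndependent y (λ λs rel → LinIndep-tail {w = hom singletons} {λ j → hom
        (y j)} indep′ λs rel)) ,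
     -- Together with the singletons, more than `numPairs n` independent points of the face would be
     -- too many.
     λ { (x , x∈ , aff) → no-more-than-suc-numPairs (cons singletons x) (off-face x (λ j → proj₂ (x∈ j)) aff) })
    where
    open ≡-Reasoning
    basis = extend-indep OnFace (hom singletons) (zero , λ ()) separating (numPairs n) (n<1+n (numPairs n))
    g : Fin (numPairs n) → Fin n → ℕ
    g j = proj₁ (proj₁ (proj₂ basis) j)
    y : Fin (numPairs n) → Vect n
    y j = vertex (g j)
    y-face : ∀ j → LMC G (y j) × α (y j) ≡ β
    y-face j = tight-face (g j) (proj₁ (proj₂ (proj₁ (proj₂ basis) j)))
    indep′ : LinIndep (cons (hom singletons) (λ j → hom (y j)))
    indep′ λs rel = proj₂ (proj₂ basis) λs (λ i → trans (cong (λs zero ℚ.* hom singletons i ℚ.+_)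
      (sum-cong (λ j → cong (λs (suc j) ℚ.*_) (proj₂ (proj₂ (proj₁ (proj₂ basis) j)) i)))) (rel i))
    indep : LinIndep (λ j → hom (cons singletons y j))
    indep λs rel = indep′ λs rel
    -- `α` is linear, 0 at the singletons and the nonzero `β` at each `x j`. Applied to a dependence
    -- it shows that the coefficients of the `x j` sum to 0, which leaves coefficient 0 for the
    -- singletons.
    off-face : ∀ {t} (x : Fin t → Vect n) → (∀ j → α (x j) ≡ β) → AffinelyIndependent x → AffinelyIndependent
        (cons singletons x)
    off-face x on aff λs Σλ Σx = λ { zero → λ₀≡0 ; (suc j) → aff (λ j → λs (suc j)) Σtail Σx′ j }
      where
      Σtail : sumℚ (λ j → λs (suc j)) ≡ 0ℚ
      Σtail = *-cancel-0 β≢0 (begin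
        β ℚ.* sumℚ (λ j → λs (suc j))
          ≡⟨ trans (ℚₚ.*-comm β (sumℚ (λ j → λs (suc j)))) (sum-*ʳ β (λ j → λs (suc j))) ⟩
        sumℚ (λ j → λs (suc j) ℚ.* β)
          ≡⟨ sym (trans (cong₂ ℚ._+_ (trans (cong (λs zero ℚ.*_) lhs-singletons) (ℚₚ.*-zeroʳ (λs zero)))
               (sum-cong (λ j → cong (λs (suc j) ℚ.*_) (on j)))) (ℚₚ.+-identityˡ (sumℚ (λ j → λs (suc j) ℚ.* β)))) ⟩
        sumℚ (λ j → λs j ℚ.* α (cons singletons x j))
          ≡⟨ sym (lhs-combination d c v λs (cons singletons x)) ⟩
        α (λ p → sumℚ (λ j → λs j ℚ.* cons singletons x j p))
          ≡⟨ lhs-cong d c v {y = λ _ → 0ℚ} Σx ⟩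
        α (λ _ → 0ℚ)
          -- The zero vector is taken as the empty linear combination.
          ≡⟨ lhs-combination d c v {0} (λ ()) (λ ()) ⟩
        0ℚ ∎)
      λ₀≡0 : λs zero ≡ 0ℚ
      λ₀≡0 = trans (sym (ℚₚ.+-identityʳ (λs zero))) (trans (cong (λs zero ℚ.+_) (sym Σtail)) Σλ)
      Σx′ : ∀ p → sumℚ (λ j → λs (suc j) ℚ.* x j p) ≡ 0ℚ
      Σx′ p = trans (sym (ℚₚ.+-identityˡ (sumℚ (λ j → λs (suc j) ℚ.* x j p)))) (trans
        (cong (ℚ._+ sumℚ (λ j → λs (suc j) ℚ.* x j p)) (sym (trans (cong (ℚ._* singletons p) λ₀≡0) (ℚₚ.*-zeroˡ
            (singletons p))))) (Σx p))

half-length≥2 : ∀ d → 5 ≤ suc (2 * d) → 2 ≤ d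
half-length≥2 (suc zero)    (s≤s (s≤s (s≤s ())))
half-length≥2 (suc (suc d)) _ = s≤s (s≤s z≤n)

open import Data.Integer using (+_)
open import Data.Rational using (_/_)

theorem7p27 : ∀ {n} (G : Graph n) → Connected G →
    (m : ℕ) (c : Fin m → Fin n) → IsCycle G m c →
    (k d : ℕ) → 5 ≤ k → k ≤ m → k ≡ suc (2 * d) →
    (v : Fin k → Fin m) → (∀ i j → v i ≡ v j → i ≡ j) → TrueTo v →
    FacetDefining (LMC G) (halfChordedLHS c v d) (+ (k ∸ 3) / 1)
theorem7p27 G conn zero    c (() , _)
theorem7p27 G conn (suc m) c cyc .(suc (2 * d)) d 5≤k _ refl v _ true = Main.facet conn c v (proj₁ marked) (proj₂ marked)
  where
  marked : FrameOf.Marking {G = G} (half-length≥2 d 5≤k) cyc v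
  marked = FrameOf.marking {G = G} (half-length≥2 d 5≤k) cyc v true
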